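{- Let $n\ge1$, let $r_1>r_2>\cdots>r_n\ge0$ be integers, $\mathbf r=(r_1,\dots,r_n)$, and let $F_{\mathbf r}(q)$ be the coefficient of $t_1^{r_1+\frac12}\cdots t_n^{r_n+\frac12}$ in $F(t_1,\dots,t_n)$. Write $$\frac{F_{\mathbf r}(q)}{(q;q)_\infty}=\sum_{\ell\ge0}b_\ell q^\ell .$$ Then, as $\ell\to\infty$, $$b_\ell\sim\frac{p(\ell)}{2^n},$$ where $p(\ell)$ is the number of partitions of $\ell$.
   Context: $(q;q)_\infty=\prod_{m\ge1}(1-q^m)$. Fermionic Fock space: let $\psi(k+\tfrac12),\psi^*(k+\tfrac12)$, $k\in\mathbb Z$, satisfy $[\psi^*(\ell+\tfrac12),\psi(k+\tfrac12)]_+=\delta_{\ell+k+1,0}$ for $\ell,k\in\mathbb{Z}$, all other anticommutators being zero. $\mathcal F$ is the complex vector space generated from a vacuum vector $\mathbf 1$, annihilated by all $\psi(k+\tfrac12)$ and $\psi^*(k+\tfrac12)$ with $k\ge 0$, with basis the monomials $\psi(-n_a-\tfrac12)\cdots\psi(-n_1-\tfrac12)\psi^*(-m_b-\tfrac12)\cdots\psi^*(-m_1-\tfrac12)\mathbf 1$, where $n_a>\cdots>n_1\ge0$ and $m_b>\cdots>m_1\ge 0$. Such a monomial has charge $a-b$ and is an eigenvector of $L(0)$ with eigenvalue $\sum_i(n_i+\tfrac12)+\sum_i(m_i+\tfrac12)$. $\mathcal F_0$ is the span of the monomials of charge $0$. Let $A(t)=\sum_{\ell\in\mathbb Z}\psi^*(\ell+\tfrac12)\psi(-\ell-\tfrac12)\,t^{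 -\ell-\frac12}$, and define the Bloch-Okounkov $n$-point function (a formal series in the $t_j$, whose coefficients are power series in $q=e^{2\pi i\tau}$, $|q|<1$) by $$F(t_1,\dots,t_n)=\eta(\tau)\,\mathrm{tr}_{\mathcal F_0}A(t_1)\cdots A(t_n)\,q^{L(0)-\frac1{24}},\qquad \eta(\tau)=q^{\frac1{24}}\prod_{m\ge1}(1-q^m).$$ -}

module Defs where

open import Algebra.Bundles using (CommutativeRing)
open import Algebra.Module.Bundles using (LeftModule)
open import Algebra.Module.Morphism.Structures using (module LeftModuleMorphisms)
open import Data.Bool using (if_then_else_)
open import Data.Integer as ℤ using (ℤ; +_; -[1+_])
import Data.Integer.Properties as ℤ
open import Data.List as List using
  (List; []; _∷_; _++_; concatMap; filter; foldr; length; replicate; upTo)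
import Data.List.Properties as List
open import Data.List.Relation.Unary.All as All using (All; []; _∷_)
open import Data.List.Relation.Unary.AllPairs as AllPairs using (AllPairs; []; _∷_)
open import Data.Nat as ℕ using (ℕ; zero; suc; _≥_; _>_; _<_; _⊔_; _∸_)
import Data.Nat.ListAction as ℕ using (sum)
import Data.Nat.Properties as ℕ
open import Data.Product using (Σ; ∃; ∃-syntax; _×_; _,_; proj₁; proj₂)
open import Data.Rational as ℚ using (ℚ; 0ℚ; 1ℚ; ½; Positive; ∣_∣)
import Data.Rational.Properties as ℚ
open import Data.Rational.Solver using (module +-*-Solver)
open import Data.Vec as Vec using (Vec)
open import Function using (_∘_; id)
open import Level using (Level; 0ℓ) renaming (suc to lsuc; _⊔_ to _l⊔_)
open import Relation.Binary using (DecidableEquality; IsEquivalence; Setoid)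
open import Relation.Binary.PropositionalEquality
  using (_≡_; refl; sym; trans; cong; cong₂; subst)
open import Relation.Nullary using (Dec; yes; no; does)
open import Relation.Nullary.Decidable using (_×-dec_; map′)

------------------------------------------------------------------------
-- Real numbers: Cauchy sequences of rationals

Eventually : (ℕ → Set) → Set
Eventually P = ∃[ N ] ∀ n → n ≥ N → P n

IsCauchy : (ℕ → ℚ) → Set
IsCauchy x = ∀ ε → .{{Positive ε}} →
  ∃[ N ] ∀ m n → m ≥ N → n ≥ N → ∣ x m ℚ.- x n ∣ ℚ.≤ ε

record ℝ : Set where
  no-eta-equality
  field
    seq    : ℕ → ℚ
    cauchy : IsCauchy seq

open ℝ public

infix 4 _≃_ _≤ℝ_

record _≃_ (x y : ℝ) : Set where
  constructor mk≃
  field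
    null : ∀ ε → .{{Positive ε}} → Eventually λ n → ∣ seq x n ℚ.- seq y n ∣ ℚ.≤ ε

open _≃_ public

record _≤ℝ_ (x y : ℝ) : Set where
  constructor mk≤
  field
    below : ∀ ε → .{{Positive ε}} → Eventually λ n → seq x n ℚ.≤ seq y n ℚ.+ ε

open _≤ℝ_ public

private
  both : ∀ {P Q : ℕ → Set} → Eventually P → Eventually Q → Eventually λ n → P n × Q n
  both (M , p) (N , q) = M ⊔ N , λ n n≥ →
    p n (ℕ.m⊔n≤o⇒m≤o M N n≥) , q n (ℕ.m⊔n≤o⇒n≤o M N n≥)

  half : ∀ ε → ε ℚ.* ½ ℚ.+ ε ℚ.* ½ ≡ ε
  half ε = trans (sym (ℚ.*-distribˡ-+ ε ½ ½)) (ℚ.*-identityʳ ε)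

  half⁺ : ∀ ε → .{{Positive ε}} → Positive (ε ℚ.* ½)
  half⁺ ε = ℚ.pos*pos⇒pos ε ½

  +-bound : ∀ a b c d {δ} → ∣ a ℚ.- c ∣ ℚ.≤ δ → ∣ b ℚ.- d ∣ ℚ.≤ δ →
            ∣ (a ℚ.+ b) ℚ.- (c ℚ.+ d) ∣ ℚ.≤ δ ℚ.+ δ
  +-bound a b c d p q = subst (λ z → ∣ z ∣ ℚ.≤ _) (sym eq)
    (ℚ.≤-trans (ℚ.∣p+q∣≤∣p∣+∣q∣ (a ℚ.- c) (b ℚ.- d)) (ℚ.+-mono-≤ p q))
    where
    open +-*-Solver
    eq : (a ℚ.+ b) ℚ.- (c ℚ.+ d) ≡ (a ℚ.- c) ℚ.+ (b ℚ.- d)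
    eq = solve 4 (λ a b c d → (a :+ b) :- (c :+ d) := (a :- c) :+ (b :- d)) refl a b c d

  ∣∣-swap : ∀ a b → ∣ a ℚ.- b ∣ ≡ ∣ b ℚ.- a ∣
  ∣∣-swap a b = trans (sym (ℚ.∣-p∣≡∣p∣ (a ℚ.- b))) (cong ∣_∣ eq)
    where
    open +-*-Solver
    eq : ℚ.- (a ℚ.- b) ≡ b ℚ.- a
    eq = solve 2 (λ a b → :- (a :- b) := b :- a) refl a b

  neg-swap : ∀ a b → ∣ ℚ.- a ℚ.- ℚ.- b ∣ ≡ ∣ a ℚ.- b ∣
  neg-swap a b = trans (cong ∣_∣ eq) (∣∣-swap b a)
    where
    open +-*-Solver
    eq : ℚ.- a ℚ.- ℚ.- b ≡ b ℚ.- a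
    eq = solve 2 (λ a b → :- a :- :- b := b :- a) refl a b

  *-mono : ∀ {a b c d} → 0ℚ ℚ.≤ a → 0ℚ ℚ.≤ d → a ℚ.≤ b → c ℚ.≤ d → a ℚ.* c ℚ.≤ b ℚ.* d
  *-mono {a} {b} {c} {d} 0≤a 0≤d a≤b c≤d = ℚ.≤-trans
    (ℚ.*-monoˡ-≤-nonNeg a {{ℚ.nonNegative 0≤a}} c≤d)
    (ℚ.*-monoʳ-≤-nonNeg d {{ℚ.nonNegative 0≤d}} a≤b)

  *-bound : ∀ a b c d K δ → .{{Positive K}} → .{{Positive δ}} →
            ∣ a ∣ ℚ.≤ K → ∣ d ∣ ℚ.≤ K → ∣ a ℚ.- c ∣ ℚ.≤ δ → ∣ b ℚ.- d ∣ ℚ.≤ δ →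
            ∣ a ℚ.* b ℚ.- c ℚ.* d ∣ ℚ.≤ δ ℚ.* K ℚ.+ δ ℚ.* K
  *-bound a b c d K δ a≤ d≤ ac bd = begin
    ∣ a ℚ.* b ℚ.- c ℚ.* d ∣
      ≡⟨ cong ∣_∣ eq ⟩
    ∣ (b ℚ.- d) ℚ.* a ℚ.+ (a ℚ.- c) ℚ.* d ∣
      ≤⟨ ℚ.∣p+q∣≤∣p∣+∣q∣ ((b ℚ.- d) ℚ.* a) ((a ℚ.- c) ℚ.* d) ⟩
    ∣ (b ℚ.- d) ℚ.* a ∣ ℚ.+ ∣ (a ℚ.- c) ℚ.* d ∣
      ≡⟨ cong₂ ℚ._+_ (ℚ.∣p*q∣≡∣p∣*∣q∣ (b ℚ.- d) a) (ℚ.∣p*q∣≡∣p∣*∣q∣ (a ℚ.- c) d) ⟩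
    ∣ b ℚ.- d ∣ ℚ.* ∣ a ∣ ℚ.+ ∣ a ℚ.- c ∣ ℚ.* ∣ d ∣
      ≤⟨ ℚ.+-mono-≤ (*-mono (ℚ.0≤∣p∣ (b ℚ.- d)) 0≤K bd a≤)
                    (*-mono (ℚ.0≤∣p∣ (a ℚ.- c)) 0≤K ac d≤) ⟩
    δ ℚ.* K ℚ.+ δ ℚ.* K ∎
    where
    open ℚ.≤-Reasoning
    0≤K : 0ℚ ℚ.≤ K
    0≤K = ℚ.<⇒≤ (ℚ.positive⁻¹ K)
    eq : a ℚ.* b ℚ.- c ℚ.* d ≡ (b ℚ.- d) ℚ.* a ℚ.+ (a ℚ.- c) ℚ.* d
    eq = solve 4 (λ a b c d → a :* b :- c :* d := (b :- d) :* a :+ (a :- c) :* d)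
         refl a b c d
      where open +-*-Solver

  quotient : ∀ ε K → .{{Positive ε}} → .(Positive K) →
             ∃[ δ ] Positive δ × δ ℚ.* K ℚ.+ δ ℚ.* K ≡ ε
  quotient ε K K⁺ = δ , δ⁺ , trans (cong (λ z → z ℚ.+ z) δK) (half ε)
    where
    instance
      K≢0 : ℚ.NonZero K
      K≢0 = ℚ.pos⇒nonZero K {{K⁺}}
    δ : ℚ
    δ = ε ℚ.* ½ ℚ.* (ℚ.1/ K)
    δ⁺ : Positive δ
    δ⁺ = ℚ.pos*pos⇒pos (ε ℚ.* ½) {{half⁺ ε}} (ℚ.1/ K) {{ℚ.1/pos⇒pos K {{K⁺}}}}
    δK : δ ℚ.* K ≡ ε ℚ.* ½
    δK = trans (ℚ.*-assoc (ε ℚ.* ½) (ℚ.1/ K) K)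
        (trans (cong (ε ℚ.* ½ ℚ.*_) (ℚ.*-inverseˡ K)) (ℚ.*-identityʳ _))

  triangle : ∀ a b {B} → ∣ a ℚ.- b ∣ ℚ.≤ B → ∣ a ∣ ℚ.≤ B ℚ.+ ∣ b ∣
  triangle a b {B} a-b≤B = begin
    ∣ a ∣                   ≡⟨ cong ∣_∣ eq ⟩
    ∣ (a ℚ.- b) ℚ.+ b ∣     ≤⟨ ℚ.∣p+q∣≤∣p∣+∣q∣ (a ℚ.- b) b ⟩
    ∣ a ℚ.- b ∣ ℚ.+ ∣ b ∣   ≤⟨ ℚ.+-monoˡ-≤ ∣ b ∣ a-b≤B ⟩
    B ℚ.+ ∣ b ∣             ∎
    where
    open ℚ.≤-Reasoning
    eq : a ≡ (a ℚ.- b) ℚ.+ b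
    eq = solve 2 (λ a b → a := (a :- b) :+ b) refl a b
      where open +-*-Solver

  bounded-by : ∀ x δ → .{{Positive δ}} → ∃[ B ] Positive B × Eventually λ n → ∣ seq x n ∣ ℚ.≤ B
  bounded-by x δ = let (N , close) = cauchy x δ in
                    δ ℚ.+ ∣ seq x N ∣
                  , ℚ.pos+nonNeg⇒pos δ ∣ seq x N ∣ {{ℚ.∣-∣-nonNeg (seq x N)}}
                  , N , λ n n≥N → triangle (seq x n) (seq x N) (close n N n≥N ℕ.≤-refl)

  bounded : ∀ x → ∃[ B ] Positive B × Eventually λ n → ∣ seq x n ∣ ℚ.≤ B
  bounded x = bounded-by x 1ℚ

  grow : ∀ B C → .{{Positive C}} → B ℚ.≤ B ℚ.+ C
  grow B C = ℚ.≤-trans (ℚ.≤-reflexive (sym (ℚ.+-identityʳ B)))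
                       (ℚ.+-monoʳ-≤ B (ℚ.<⇒≤ (ℚ.positive⁻¹ C)))

  growʳ : ∀ B C {a} → .{{Positive C}} → a ℚ.≤ B → a ℚ.≤ B ℚ.+ C
  growʳ B C a≤B = ℚ.≤-trans a≤B (grow B C)

  growˡ : ∀ B C {a} → .{{Positive B}} → a ℚ.≤ C → a ℚ.≤ B ℚ.+ C
  growˡ B C {a} a≤C = subst (a ℚ.≤_) (ℚ.+-comm C B) (growʳ C B a≤C)

  bounded₂ : ∀ x y → ∃[ B ] Positive B ×
             Eventually λ n → ∣ seq x n ∣ ℚ.≤ B × ∣ seq y n ∣ ℚ.≤ B
  bounded₂ x y = let (B , B⁺ , N , p) = bounded x ; (C , C⁺ , M , q) = bounded y in
    B ℚ.+ C , ℚ.pos+pos⇒pos B {{B⁺}} C {{C⁺}} , N ⊔ M , λ n n≥ →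
      growʳ B C {{C⁺}} (p n (ℕ.m⊔n≤o⇒m≤o N M n≥)) ,
      growˡ B C {{B⁺}} (q n (ℕ.m⊔n≤o⇒n≤o N M n≥))

fromℚ : ℚ → ℝ
seq    (fromℚ a) _ = a
cauchy (fromℚ a) ε = 0 , λ _ _ _ _ →
  subst (λ z → ∣ z ∣ ℚ.≤ ε) (sym (ℚ.+-inverseʳ a)) (ℚ.<⇒≤ (ℚ.positive⁻¹ ε))

infixl 6 _+ℝ_
infixl 7 _*ℝ_
infix  8 -ℝ_

_+ℝ_ : ℝ → ℝ → ℝ
seq    (x +ℝ y) n = seq x n ℚ.+ seq y n
cauchy (x +ℝ y) ε =
  let (M , p) = cauchy x (ε ℚ.* ½) {{half⁺ ε}}
      (N , q) = cauchy y (ε ℚ.* ½) {{half⁺ ε}}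
  in M ⊔ N , λ m n m≥ n≥ → subst (_ ℚ.≤_) (half ε)
    (+-bound (seq x m) (seq y m) (seq x n) (seq y n)
      (p m n (ℕ.m⊔n≤o⇒m≤o M N m≥) (ℕ.m⊔n≤o⇒m≤o M N n≥))
      (q m n (ℕ.m⊔n≤o⇒n≤o M N m≥) (ℕ.m⊔n≤o⇒n≤o M N n≥)))

-ℝ_ : ℝ → ℝ
seq    (-ℝ x) n = ℚ.- seq x n
cauchy (-ℝ x) ε = let (N , p) = cauchy x ε in N , λ m n m≥ n≥ →
  subst (ℚ._≤ ε) (sym (neg-swap (seq x m) (seq x n))) (p m n m≥ n≥)

_*ℝ_ : ℝ → ℝ → ℝ
seq    (x *ℝ y) n = seq x n ℚ.* seq y n
cauchy (x *ℝ y) ε =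
  let (K , K⁺ , L , bnd) = bounded₂ x y
      (δ , δ⁺ , eq) = quotient ε K K⁺
      (M , p) = cauchy x δ {{δ⁺}}
      (N , q) = cauchy y δ {{δ⁺}}
  in L ⊔ (M ⊔ N) , λ m n m≥ n≥ →
    let m≥′ = ℕ.m⊔n≤o⇒n≤o L (M ⊔ N) m≥
        n≥′ = ℕ.m⊔n≤o⇒n≤o L (M ⊔ N) n≥
    in subst (_ ℚ.≤_) eq
      (*-bound (seq x m) (seq y m) (seq x n) (seq y n) K δ {{K⁺}} {{δ⁺}}
        (proj₁ (bnd m (ℕ.m⊔n≤o⇒m≤o L (M ⊔ N) m≥)))
        (proj₂ (bnd n (ℕ.m⊔n≤o⇒m≤o L (M ⊔ N) n≥)))
        (p m n (ℕ.m⊔n≤o⇒m≤o M N m≥′) (ℕ.m⊔n≤o⇒m≤o M N n≥′))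
        (q m n (ℕ.m⊔n≤o⇒n≤o M N m≥′) (ℕ.m⊔n≤o⇒n≤o M N n≥′)))

0ℝ 1ℝ : ℝ
0ℝ = fromℚ 0ℚ
1ℝ = fromℚ 1ℚ

≃-pointwise : ∀ {x y} → (∀ n → seq x n ≡ seq y n) → x ≃ y
≃-pointwise {x} {y} eq = mk≃ λ ε → 0 , λ n _ →
  subst (λ z → ∣ z ∣ ℚ.≤ ε)
    (sym (trans (cong (ℚ._- seq y n) (eq n)) (ℚ.+-inverseʳ (seq y n))))
    (ℚ.<⇒≤ (ℚ.positive⁻¹ ε))

≃-sym : ∀ {x y} → x ≃ y → y ≃ x
≃-sym {x} {y} p = mk≃ λ ε → let (N , q) = null p ε in
  N , λ n n≥ → subst (ℚ._≤ ε) (∣∣-swap (seq x n) (seq y n)) (q n n≥)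

≃-trans : ∀ {x y z} → x ≃ y → y ≃ z → x ≃ z
≃-trans {x} {y} {z} p q = mk≃ go
  where
  eq : ∀ a b c → a ℚ.- c ≡ (a ℚ.- b) ℚ.+ (b ℚ.- c)
  eq = solve 3 (λ a b c → a :- c := (a :- b) :+ (b :- c)) refl
    where open +-*-Solver
  go : ∀ ε → .{{Positive ε}} → Eventually λ n → ∣ seq x n ℚ.- seq z n ∣ ℚ.≤ ε
  go ε =
    let (N , pq) = both (null p (ε ℚ.* ½) {{half⁺ ε}}) (null q (ε ℚ.* ½) {{half⁺ ε}})
    in N , λ n n≥ → subst (_ ℚ.≤_) (half ε) (ℚ.≤-trans
    (ℚ.≤-trans (ℚ.≤-reflexive (cong ∣_∣ (eq (seq x n) (seq y n) (seq z n))))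
               (ℚ.∣p+q∣≤∣p∣+∣q∣ (seq x n ℚ.- seq y n) (seq y n ℚ.- seq z n)))
    (ℚ.+-mono-≤ (proj₁ (pq n n≥)) (proj₂ (pq n n≥))))

+ℝ-cong : ∀ {x x′ y y′} → x ≃ x′ → y ≃ y′ → x +ℝ y ≃ x′ +ℝ y′
+ℝ-cong {x} {x′} {y} {y′} p q = mk≃ go
  where
  go : ∀ ε → .{{Positive ε}} → Eventually λ n →
       ∣ (seq x n ℚ.+ seq y n) ℚ.- (seq x′ n ℚ.+ seq y′ n) ∣ ℚ.≤ ε
  go ε =
    let (N , pq) = both (null p (ε ℚ.* ½) {{half⁺ ε}}) (null q (ε ℚ.* ½) {{half⁺ ε}})
    in N , λ n n≥ → subst (_ ℚ.≤_) (half ε)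
    (+-bound (seq x n) (seq y n) (seq x′ n) (seq y′ n)
      (proj₁ (pq n n≥)) (proj₂ (pq n n≥)))

-ℝ-cong : ∀ {x x′} → x ≃ x′ → -ℝ x ≃ -ℝ x′
-ℝ-cong {x} {x′} p = mk≃ λ ε → let (N , q) = null p ε in
  N , λ n n≥ → subst (ℚ._≤ ε) (sym (neg-swap (seq x n) (seq x′ n))) (q n n≥)

*ℝ-cong : ∀ {x x′ y y′} → x ≃ x′ → y ≃ y′ → x *ℝ y ≃ x′ *ℝ y′
*ℝ-cong {x} {x′} {y} {y′} p q = mk≃ go
  where
  go : ∀ ε → .{{Positive ε}} → Eventually λ n →
       ∣ seq x n ℚ.* seq y n ℚ.- seq x′ n ℚ.* seq y′ n ∣ ℚ.≤ ε
  go ε =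
    let (K , K⁺ , bnd) = bounded₂ x y′
        (δ , δ⁺ , eq) = quotient ε K K⁺
        (N , all) = both bnd (both (null p δ {{δ⁺}}) (null q δ {{δ⁺}}))
    in N , λ n n≥ → let ((xb , yb) , (xx , yy)) = all n n≥ in
    subst (_ ℚ.≤_) eq
      (*-bound (seq x n) (seq y n) (seq x′ n) (seq y′ n) K δ {{K⁺}} {{δ⁺}} xb yb xx yy)

------------------------------------------------------------------------
-- Complex numbers

record ℂ : Set where
  no-eta-equality
  field
    re im : ℝ

open ℂ public

infix 4 _≈ℂ_

record _≈ℂ_ (z w : ℂ) : Set where
  constructor _,_
  field
    re≃ : re z ≃ re w
    im≃ : im z ≃ im w

open _≈ℂ_ public

infixl 6 _+ℂ_ _-ℂ_
infixl 7 _*ℂ_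
infix  8 -ℂ_

_+ℂ_ _*ℂ_ : ℂ → ℂ → ℂ
-ℂ_ : ℂ → ℂ

re (z +ℂ w) = re z +ℝ re w
im (z +ℂ w) = im z +ℝ im w

re (-ℂ z) = -ℝ re z
im (-ℂ z) = -ℝ im z

_-ℂ_ : ℂ → ℂ → ℂ
z -ℂ w = z +ℂ (-ℂ w)

re (z *ℂ w) = (re z *ℝ re w) +ℝ (-ℝ (im z *ℝ im w))
im (z *ℂ w) = (re z *ℝ im w) +ℝ (im z *ℝ re w)

ℝ⇒ℂ : ℝ → ℂ
re (ℝ⇒ℂ x) = x
im (ℝ⇒ℂ x) = 0ℝ

∣_∣² : ℂ → ℝ
∣ z ∣² = (re z *ℝ re z) +ℝ (im z *ℝ im z)

private
  -- Equalities of complex numbers that hold at each index of the rational sequences.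
  _at_ : ℂ → ℕ → ℚ × ℚ
  z at n = seq (re z) n , seq (im z) n

  pointwise : ∀ z w → (∀ n → z at n ≡ w at n) → z ≈ℂ w
  pointwise z w eq = ≃-pointwise (λ n → cong proj₁ (eq n)) , ≃-pointwise (λ n → cong proj₂ (eq n))

  infixl 6 _⊕_
  infixl 7 _⊗_

  _⊕_ _⊗_ : ℚ × ℚ → ℚ × ℚ → ℚ × ℚ
  (a , b) ⊕ (c , d) = a ℚ.+ c , b ℚ.+ d
  (a , b) ⊗ (c , d) = a ℚ.* c ℚ.+ ℚ.- (b ℚ.* d) , a ℚ.* d ℚ.+ b ℚ.* c

  ⊖_ : ℚ × ℚ → ℚ × ℚ
  ⊖ (a , b) = ℚ.- a , ℚ.- b

  ⊕-assoc : ∀ z w v → z ⊕ w ⊕ v ≡ z ⊕ (w ⊕ v)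
  ⊕-assoc (a , b) (c , d) (e , f) = cong₂ _,_ (ℚ.+-assoc a c e) (ℚ.+-assoc b d f)

  ⊕-comm : ∀ z w → z ⊕ w ≡ w ⊕ z
  ⊕-comm (a , b) (c , d) = cong₂ _,_ (ℚ.+-comm a c) (ℚ.+-comm b d)

  ⊕-identityˡ : ∀ z → (0ℚ , 0ℚ) ⊕ z ≡ z
  ⊕-identityˡ (a , b) = cong₂ _,_ (ℚ.+-identityˡ a) (ℚ.+-identityˡ b)

  ⊕-inverseˡ : ∀ z → (⊖ z) ⊕ z ≡ (0ℚ , 0ℚ)
  ⊕-inverseˡ (a , b) = cong₂ _,_ (ℚ.+-inverseˡ a) (ℚ.+-inverseˡ b)

  ⊗-assoc : ∀ z w v → z ⊗ w ⊗ v ≡ z ⊗ (w ⊗ v)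
  ⊗-assoc (a , b) (c , d) (e , f) = cong₂ _,_
    (solve 6 (λ a b c d e f →
      (a :* c :+ :- (b :* d)) :* e :+ :- ((a :* d :+ b :* c) :* f) :=
      a :* (c :* e :+ :- (d :* f)) :+ :- (b :* (c :* f :+ d :* e))) refl a b c d e f)
    (solve 6 (λ a b c d e f →
      (a :* c :+ :- (b :* d)) :* f :+ (a :* d :+ b :* c) :* e :=
      a :* (c :* f :+ d :* e) :+ b :* (c :* e :+ :- (d :* f))) refl a b c d e f)
    where open +-*-Solver

  ⊗-comm : ∀ z w → z ⊗ w ≡ w ⊗ z
  ⊗-comm (a , b) (c , d) = cong₂ _,_
    (solve 4 (λ a b c d → a :* c :+ :- (b :* d) := c :* a :+ :- (d :* b)) refl a b c d)
    (solve 4 (λ a b c d → a :* d :+ b :* c := c :* b :+ d :* a) refl a b c d)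
    where open +-*-Solver

  ⊗-identityˡ : ∀ z → (1ℚ , 0ℚ) ⊗ z ≡ z
  ⊗-identityˡ (a , b) = cong₂ _,_
    (solve 2 (λ a b → con 1ℚ :* a :+ :- (con 0ℚ :* b) := a) refl a b)
    (solve 2 (λ a b → con 1ℚ :* b :+ con 0ℚ :* a := b) refl a b)
    where open +-*-Solver

  ⊗-distribˡ : ∀ z w v → z ⊗ (w ⊕ v) ≡ z ⊗ w ⊕ z ⊗ v
  ⊗-distribˡ (a , b) (c , d) (e , f) = cong₂ _,_
    (solve 6 (λ a b c d e f → a :* (c :+ e) :+ :- (b :* (d :+ f)) :=
      (a :* c :+ :- (b :* d)) :+ (a :* e :+ :- (b :* f))) refl a b c d e f)
    (solve 6 (λ a b c d e f → a :* (d :+ f) :+ b :* (c :+ e) :=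
      (a :* d :+ b :* c) :+ (a :* f :+ b :* e)) refl a b c d e f)
    where open +-*-Solver

0ℂ 1ℂ : ℂ
0ℂ = ℝ⇒ℂ 0ℝ
1ℂ = ℝ⇒ℂ 1ℝ

≈ℂ-isEquivalence : IsEquivalence _≈ℂ_
≈ℂ-isEquivalence = record
  { refl  = λ {z} → pointwise z z (λ _ → refl)
  ; sym   = λ p → ≃-sym (re≃ p) , ≃-sym (im≃ p)
  ; trans = λ p q → ≃-trans (re≃ p) (re≃ q) , ≃-trans (im≃ p) (im≃ q) }

ℂ-setoid : Setoid 0ℓ 0ℓ
ℂ-setoid = record { isEquivalence = ≈ℂ-isEquivalence }

ℂ-commutativeRing : CommutativeRing 0ℓ 0ℓ
ℂ-commutativeRing = record
  { Carrier = ℂ ; _≈_ = _≈ℂ_ ; _+_ = _+ℂ_ ; _*_ = _*ℂ_ ; -_ = -ℂ_ ; 0# = 0ℂ ; 1# = 1ℂ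
  ; isCommutativeRing = record
    { isRing = record
      { +-isAbelianGroup = record
        { isGroup = record
          { isMonoid = record
            { isSemigroup = record
              { isMagma = record
                { isEquivalence = ≈ℂ-isEquivalence
                ; ∙-cong = λ p q → +ℝ-cong (re≃ p) (re≃ q) , +ℝ-cong (im≃ p) (im≃ q) }
              ; assoc = λ z w v → pointwise (z +ℂ w +ℂ v) (z +ℂ (w +ℂ v))
                  λ n → ⊕-assoc (z at n) (w at n) (v at n) }
            ; identity = comm∧idˡ⇒id +ℂ-comm λ z → pointwise (0ℂ +ℂ z) z
                λ n → ⊕-identityˡ (z at n) }
          ; inverse = comm∧invˡ⇒inv +ℂ-comm λ z → pointwise (-ℂ z +ℂ z) 0ℂ
              λ n → ⊕-inverseˡ (z at n)
          ; ⁻¹-cong = λ p → -ℝ-cong (re≃ p) , -ℝ-cong (im≃ p) }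
        ; comm = +ℂ-comm }
      ; *-cong = *ℂ-cong
      ; *-assoc = λ z w v → pointwise (z *ℂ w *ℂ v) (z *ℂ (w *ℂ v))
          λ n → ⊗-assoc (z at n) (w at n) (v at n)
      ; *-identity = comm∧idˡ⇒id *ℂ-comm λ z → pointwise (1ℂ *ℂ z) z
          λ n → ⊗-identityˡ (z at n)
      ; distrib = comm∧distrˡ⇒distr
          (λ p q → +ℝ-cong (re≃ p) (re≃ q) , +ℝ-cong (im≃ p) (im≃ q)) *ℂ-comm
          λ z w v → pointwise (z *ℂ (w +ℂ v)) (z *ℂ w +ℂ z *ℂ v)
            λ n → ⊗-distribˡ (z at n) (w at n) (v at n) }
    ; *-comm = *ℂ-comm } }
  where
  open import Algebra.Consequences.Setoid ℂ-setoid
  +ℂ-comm : ∀ z w → z +ℂ w ≈ℂ w +ℂ z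
  +ℂ-comm z w = pointwise (z +ℂ w) (w +ℂ z) λ n → ⊕-comm (z at n) (w at n)
  *ℂ-comm : ∀ z w → z *ℂ w ≈ℂ w *ℂ z
  *ℂ-comm z w = pointwise (z *ℂ w) (w *ℂ z) λ n → ⊗-comm (z at n) (w at n)
  *ℂ-cong : ∀ {z z′ w w′} → z ≈ℂ z′ → w ≈ℂ w′ → z *ℂ w ≈ℂ z′ *ℂ w′
  *ℂ-cong p q =
      +ℝ-cong (*ℝ-cong (re≃ p) (re≃ q)) (-ℝ-cong (*ℝ-cong (im≃ p) (im≃ q)))
    , +ℝ-cong (*ℝ-cong (re≃ p) (im≃ q)) (*ℝ-cong (im≃ p) (re≃ q))

infix 4 _∼_

-- u ℓ ∼ v ℓ as ℓ → ∞, meaning |u ℓ - v ℓ| ≤ ε |v ℓ| for all large ℓ, for every ε > 0.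
-- The inequality is squared, which avoids square roots of reals.
_∼_ : (ℕ → ℂ) → (ℕ → ℂ) → Set
u ∼ v = ∀ ε → .{{Positive ε}} → Eventually λ ℓ →
  ∣ u ℓ -ℂ v ℓ ∣² ≤ℝ fromℚ (ε ℚ.* ε) *ℝ ∣ v ℓ ∣²

------------------------------------------------------------------------
-- Partitions

-- Partitions of n into parts ≤ k, as weakly decreasing lists; j is the
-- multiplicity of the part k.
partitions≤ : ℕ → ℕ → List (List ℕ)
partitions≤ zero    zero    = [] ∷ []
partitions≤ zero    (suc _) = []
partitions≤ (suc k) n = concatMap
  (λ j → List.map (replicate j (suc k) ++_) (partitions≤ k (n ∸ j ℕ.* suc k)))
  (filter (λ j → j ℕ.* suc k ℕ.≤? n) (upTo (suc n)))

p : ℕ → ℕ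
p ℓ = length (partitions≤ ℓ ℓ)

------------------------------------------------------------------------
-- Monomials in the fermionic modes

Decreasing : List ℕ → Set
Decreasing = AllPairs _>_

-- (n_a > ⋯ > n_1 ; m_b > ⋯ > m_1)
record Monomial : Set where
  constructor mono
  field
    ns  : List ℕ
    ms  : List ℕ
    ns↓ : Decreasing ns
    ms↓ : Decreasing ms

open Monomial public

_≟ᴹ_ : DecidableEquality Monomial
mono ns ms p q ≟ᴹ mono ns′ ms′ p′ q′ = map′ to from
  (List.≡-dec ℕ._≟_ ns ns′ ×-dec List.≡-dec ℕ._≟_ ms ms′)
  where
  irr : ∀ {xs} (p q : Decreasing xs) → p ≡ q
  irr = AllPairs.irrelevant ℕ.≤-irrelevant
  to : ns ≡ ns′ × ms ≡ ms′ → mono ns ms p q ≡ mono ns′ ms′ p′ q′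
  to (refl , refl) = cong₂ (mono ns ms) (irr p p′) (irr q q′)
  from : mono ns ms p q ≡ mono ns′ ms′ p′ q′ → ns ≡ ns′ × ms ≡ ms′
  from refl = refl , refl

charge : Monomial → ℤ
charge μ = + length (ns μ) ℤ.- + length (ms μ)

-- The L(0)-eigenvalue is a sum of half-integers k + ½; this is its double.
2·energy : Monomial → ℕ
2·energy μ = ℕ.sum (List.map odd (ns μ)) ℕ.+ ℕ.sum (List.map odd (ms μ))
  where
  odd : ℕ → ℕ
  odd k = 2 ℕ.* k ℕ.+ 1

decreasingBelow : (N : ℕ) → List (∃[ xs ] All (_< N) xs × Decreasing xs)
decreasingBelow zero    = ([] , [] , []) ∷ []
decreasingBelow (suc N) =
  List.map (λ (xs , xs<N , xs↓) → N ∷ xs , ℕ.≤-refl ∷ All.map ℕ.m<n⇒m<1+n xs<N , xs<N ∷ xs↓)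
           (decreasingBelow N)
  ++
  List.map (λ (xs , xs<N , xs↓) → xs , All.map ℕ.m<n⇒m<1+n xs<N , xs↓)
           (decreasingBelow N)

-- All monomials of charge 0 and L(0)-eigenvalue ℓ, each once. An entry k of such
-- a monomial satisfies k + ½ ≤ ℓ, hence k < ℓ.
monomials₀ : ℕ → List Monomial
monomials₀ ℓ = filter (λ μ → (charge μ ℤ.≟ + 0) ×-dec (2·energy μ ℕ.≟ 2 ℕ.* ℓ))
  (List.cartesianProductWith
    (λ (ns , _ , ns↓) (ms , _ , ms↓) → mono ns ms ns↓ ms↓)
    (decreasingBelow ℓ) (decreasingBelow ℓ))

------------------------------------------------------------------------

module Over {c ℓc : Level} (K : CommutativeRing c ℓc) where

  open CommutativeRing K hiding (zero)

  sum : List Carrier → Carrier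
  sum = foldr _+_ 0#

  -- f is the formal series Σ f ℓ q^ℓ.
  PowerSeries : Set c
  PowerSeries = ℕ → Carrier

  infixl 7 _⊛_

  _⊛_ : PowerSeries → PowerSeries → PowerSeries
  (f ⊛ g) ℓ = sum (List.map (λ i → f i * g (ℓ ∸ i)) (upTo (suc ℓ)))

  q^_ : ℕ → PowerSeries
  (q^ m) ℓ = if does (m ℕ.≟ ℓ) then 1# else 0#

  -- (1 - q)(1 - q²)⋯(1 - q^M)
  qq : ℕ → PowerSeries
  qq zero    = q^ 0
  qq (suc M) = qq M ⊛ (λ ℓ → (q^ 0) ℓ - (q^ suc M) ℓ)

  -- (q;q)_∞: the factors 1 - q^m with m > ℓ do not affect the coefficient of q^ℓ.
  qq∞ : PowerSeries
  qq∞ ℓ = qq ℓ ℓ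

  module Bases {m ℓm} (V : LeftModule ring m ℓm) where

    open LeftModule V

    module _ {I : Set} (e : I → Carrierᴹ) where

      combination : List (Carrier × I) → Carrierᴹ
      combination = foldr (λ (a , i) v → a *ₗ e i +ᴹ v) 0ᴹ

    module _ {I : Set} (_≟_ : DecidableEquality I) where

      -- The coefficient of j in a formal combination, in which j may occur repeatedly.
      coefficient : I → List (Carrier × I) → Carrier
      coefficient j = foldr (λ (a , i) s → if does (i ≟ j) then a + s else s) 0#

      record IsBasis (e : I → Carrierᴹ) : Set (c l⊔ ℓc l⊔ m l⊔ ℓm) where
        field
          spans       : ∀ v → ∃[ xs ] v ≈ᴹ combination e xs
          independent : ∀ xs → combination e xs ≈ᴹ 0ᴹ → ∀ j → coefficient j xs ≈ 0#

        coordinate : I → Carrierᴹ → Carrier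
        coordinate j v = coefficient j (proj₁ (spans v))

  -- ψ k and ψ* k stand for the modes ψ(k + ½) and ψ*(k + ½).
  record FockSpace (m ℓm : Level) : Set (c l⊔ ℓc l⊔ lsuc (m l⊔ ℓm)) where
    field
      space : LeftModule ring m ℓm

    open LeftModule space public
    open LeftModuleMorphisms rawLeftModule rawLeftModule using (IsLeftModuleHomomorphism)
    open Bases space

    δ₀ : ℤ → Carrier
    δ₀ k = if does (k ℤ.≟ + 0) then 1# else 0#

    field
      ψ ψ*      : ℤ → Carrierᴹ → Carrierᴹ
      ψ-linear  : ∀ k → IsLeftModuleHomomorphism (ψ k)
      ψ*-linear : ∀ k → IsLeftModuleHomomorphism (ψ* k)

      [ψ*,ψ]₊   : ∀ l k v → ψ* l (ψ k v) +ᴹ ψ k (ψ* l v) ≈ᴹ δ₀ (l ℤ.+ k ℤ.+ + 1) *ₗ v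
      [ψ,ψ]₊    : ∀ l k v → ψ l (ψ k v) +ᴹ ψ k (ψ l v) ≈ᴹ 0ᴹ
      [ψ*,ψ*]₊  : ∀ l k v → ψ* l (ψ* k v) +ᴹ ψ* k (ψ* l v) ≈ᴹ 0ᴹ

      𝟏         : Carrierᴹ
      ψ-𝟏       : ∀ k → ψ (+ k) 𝟏 ≈ᴹ 0ᴹ
      ψ*-𝟏      : ∀ k → ψ* (+ k) 𝟏 ≈ᴹ 0ᴹ

    -- ψ(-n-½) is ψ -[1+ n ], since -n-½ = -(1+n) + ½.
    ⟦_⟧ : Monomial → Carrierᴹ
    ⟦ μ ⟧ = foldr (λ n → ψ -[1+ n ]) (foldr (λ m → ψ* -[1+ m ]) 𝟏 (ms μ)) (ns μ)

    field
      basis : IsBasis _≟ᴹ_ ⟦_⟧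

    open IsBasis basis public

    -- tr_{𝓕₀} X q^{L(0)}
    trace₀ : (Carrierᴹ → Carrierᴹ) → PowerSeries
    trace₀ X ℓ = sum (List.map (λ μ → coordinate μ (X ⟦ μ ⟧)) (monomials₀ ℓ))

    -- The ℓ-th summand ψ*(ℓ+½) ψ(-ℓ-½) of A(t), which carries t^{-ℓ-½}.
    A-summand : ℤ → Carrierᴹ → Carrierᴹ
    A-summand ℓ = ψ* ℓ ∘ ψ (ℤ.- ℓ ℤ.- + 1)

    -- The coefficient of t^{k+½} in A(t): -ℓ-½ = k+½ for ℓ = -k-1.
    A : ℤ → Carrierᴹ → Carrierᴹ
    A k = A-summand (ℤ.- k ℤ.- + 1)

    -- The coefficient of t₁^{k₁+½}⋯tₙ^{kₙ+½} in F(t₁,…,tₙ). The factor q^{1/24} of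
    -- η cancels against q^{-1/24} in the trace, leaving (q;q)_∞ tr A(t₁)⋯A(tₙ) q^{L(0)}.
    F : ∀ {n} → Vec ℤ n → PowerSeries
    F ks = qq∞ ⊛ trace₀ (Vec.foldr′ (λ k X → A k ∘ X) id ks)

open Over ℂ-commutativeRing public

{-# OPTIONS --safe #-}
module Submission where

-- A(t) acts diagonally: the coefficient of t^(k+½) is the number operator of ψ*(-k-½), so b_ℓ counts
-- the charge 0 monomials of energy ℓ with all r_i among the m_j. Let Z_R(c, ℓ) count those of charge c
-- with R ⊆ {m_j}. Removing m_j = r raises the charge, so Z_R(c+1, ·) is the sum of Z_{R∪r}(c, ·) and
-- Z_{R∪r}(c+1, ·) up to a shift of the energy, and such shifts are harmless since Z_R is monotone in
-- the energy and p(ℓ+1) ∼ p(ℓ). For R = ∅ the triple product identity gives Z_∅(c, ·) ∼ p for every c.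
-- Thus if z = Z_R is asymptotically independent of c, then u = Z_{R∪r} satisfies u(c) + u(c+1) ∼ z;
-- inserting one more element r′ shows that u cannot oscillate in c, so u ∼ z/2.

open import Defs
open import Algebra.Bundles using (CommutativeRing)
open import Algebra.Module.Morphism.Structures using (module LeftModuleMorphisms)
open import Data.Bool using (Bool; true; false; if_then_else_)
open import Data.Integer using (+_)
open import Data.Integer as ℤ using (ℤ; -[1+_]; ∣_∣)
import Data.Integer.Properties as ℤ
import Data.Integer.Solver as ℤ using (module +-*-Solver)
open import Data.List as List using
  (List; []; _∷_; _++_; applyUpTo; cartesianProductWith; concatMap; filter; foldr; length; replicate; upTo)
open import Data.List.Membership.Propositional using (_∈_; _∉_; find)
open import Data.List.Properties using
  (filter-accept; filter-reject; length-++; length-map; map-++; map-cong; map-∘)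
open import Data.List.Relation.Unary.All as All using (All; []; _∷_)
open import Data.List.Relation.Unary.All.Properties using (All¬⇒¬Any; ¬All⇒Any¬; ¬Any⇒All¬)
open import Data.List.Relation.Unary.AllPairs using ([]; _∷_) renaming (tail to unique-tail)
open import Data.List.Relation.Unary.Any using (here; there)
open import Data.List.Relation.Unary.Unique.Propositional using (Unique)
open import Data.Nat using (ℕ; _≥_; _>_; _^_)
open import Data.Nat as ℕ using
  (zero; suc; _+_; _*_; _∸_; _⊔_; _≤_; _<_; z≤n; s≤s; s≤s⁻¹; z<s; ≤′-refl; ≤′-step; NonZero; _≟_; _≤?_)
open import Data.List.Membership.DecPropositional _≟_ using (_∈?_)
open import Data.Nat.DivMod using (/-monoˡ-≤; m%n<n; m*n/n≡m; m/n*n≤m; m≡m%n+[m/n]*n)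
import Data.Nat.ListAction as ℕ using (sum)
open import Data.Nat.ListAction.Properties using (sum-++)
open import Data.Nat.Properties hiding (_≟_; _≤?_)
open import Data.Nat.Properties using (m^n≢0)
open import Data.Nat.Solver using (module +-*-Solver)
open import Data.Product using (∃; ∃-syntax; _×_; _,_; proj₁; proj₂)
open import Data.Rational using (_/_)
open import Data.Rational as ℚ using (ℚ; 0ℚ; 1ℚ; Positive; ↥_; ↧ₙ_; toℚᵘ)
import Data.Rational.Properties as ℚ
import Data.Rational.Solver as ℚ using (module +-*-Solver)
open import Data.Rational.Unnormalised as ℚᵘ using (*≡*; *≤*; mkℚᵘ)
import Data.Rational.Unnormalised.Properties as ℚᵘ
open import Data.Sum using (inj₁; inj₂)
open import Data.Vec using (Vec; map)
open import Data.Vec as Vec using ([]; _∷_; toList)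
open import Data.Vec.Properties using (length-toList)
import Data.Vec.Relation.Unary.All as VecAll
open import Data.Vec.Relation.Unary.All using ([]; _∷_)
open import Data.Vec.Relation.Unary.AllPairs using (AllPairs)
open import Data.Vec.Relation.Unary.AllPairs using ([]; _∷_)
open import Function using (_∘_; id)
open import Relation.Binary.PropositionalEquality using
  (_≡_; _≢_; _≗_; refl; sym; trans; cong; cong₂; subst; module ≡-Reasoning)
open import Relation.Nullary using (¬_; Dec; yes; no; does; contradiction)
open import Relation.Nullary.Decidable using (dec-true; dec-false; _×-dec_)
open import Relation.Unary using (Decidable)

-- Partitions and power series

-- The relation u(c) + u(c+1) ∼ z alone leaves room for u(c) ∼ z/2 + (-1)^c e with e of order p. One
-- further mode r′ turns e into a drift: v = Z_{R∪r∪r′} satisfies v(c+2) - v(c) ∼ ±2e with a sign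
-- that persists along c, c+2, c+4, ..., so v would grow linearly in c, while every v(c) is
-- eventually at most 2p. No asymptotic formula for p enters. Errors are measured against p itself,
-- and the powers of 2 stay on the side of Z, so that integers suffice. The analytic input is p(ℓ+1)
-- - p(ℓ) = o(p(ℓ)). This difference counts the partitions of ℓ+1 without ones. Breaking one copy of
-- a part a of such a partition into ones yields a partition with exactly a ones, from which the
-- original is recovered; hence pairs of a partition without ones and one of its part sizes number
-- at most p(ℓ+1). As most partitions without ones have many part sizes, there must be few of them.
-- Monotonicity in the energy comes from raising the largest n_i, which exists when the charge is
-- positive. So the induction runs over positive charges, and charge 0 is reached at the end by a
-- subtraction.

infixl 6 _⊕_
_⊕_ : (ℕ → ℕ) → (ℕ → ℕ) → ℕ → ℕ
(f ⊕ g) n = f n + g n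

-- Multiplication of a power series by q^a.
shift : ℕ → (ℕ → ℕ) → ℕ → ℕ
shift zero    f n       = f n
shift (suc a) f zero    = 0
shift (suc a) f (suc n) = shift a f n

shift-cong : ∀ a {f g} → f ≗ g → shift a f ≗ shift a g
shift-cong zero    f≗g n       = f≗g n
shift-cong (suc a) f≗g zero    = refl
shift-cong (suc a) f≗g (suc n) = shift-cong a f≗g n

shift-mono : ∀ a {f g} → (∀ n → f n ≤ g n) → ∀ n → shift a f n ≤ shift a g n
shift-mono zero    f≤g n       = f≤g n
shift-mono (suc a) f≤g zero    = z≤n
shift-mono (suc a) f≤g (suc n) = shift-mono a f≤g n

shift-⊕ : ∀ a f g → shift a (f ⊕ g) ≗ shift a f ⊕ shift a g
shift-⊕ zero    f g n       = refl
shift-⊕ (suc a) f g zero    = refl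
shift-⊕ (suc a) f g (suc n) = shift-⊕ a f g n

shift-shift : ∀ a b f → shift a (shift b f) ≗ shift (a + b) f
shift-shift zero    b f n       = refl
shift-shift (suc a) b f zero    = refl
shift-shift (suc a) b f (suc n) = shift-shift a b f n

shift-comm : ∀ a b f → shift a (shift b f) ≗ shift b (shift a f)
shift-comm a b f n = trans (shift-shift a b f n)
  (trans (cong (λ c → shift c f n) (+-comm a b)) (sym (shift-shift b a f n)))

shift-+ : ∀ a f n → shift a f (a + n) ≡ f n
shift-+ zero    f n = refl
shift-+ (suc a) f n = shift-+ a f n

shift-< : ∀ a f {n} → n < a → shift a f n ≡ 0
shift-< (suc a) f {zero}  n<a       = refl
shift-< (suc a) f {suc n} (s≤s n<a) = shift-< a f n<a

shift-≤ : ∀ a f {n} → a ≤ n → shift a f n ≡ f (n ∸ a)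
shift-≤ zero    f         a≤n       = refl
shift-≤ (suc a) f {suc n} (s≤s a≤n) = shift-≤ a f a≤n

shift-local : ∀ a {f g} n → (∀ {m} → m < n → f m ≡ g m) → shift (suc a) f n ≡ shift (suc a) g n
shift-local a {f} {g} n f≡g with suc a ≤? n
... | yes a<n = trans (shift-≤ (suc a) f a<n)
                  (trans (f≡g (∸-monoʳ-< {o = 0} z<s a<n)) (sym (shift-≤ (suc a) g a<n)))
... | no  a≮n = trans (shift-< (suc a) f (≰⇒> a≮n)) (sym (shift-< (suc a) g (≰⇒> a≮n)))

shift-bound : ∀ a {f X} n → (∀ {m} → m ≤ n → f m ≤ X) → shift a f n ≤ X
shift-bound zero    n       f≤ = f≤ ≤-refl
shift-bound (suc a) zero    f≤ = z≤n
shift-bound (suc a) (suc n) f≤ = shift-bound a n (f≤ ∘ m≤n⇒m≤1+n)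

-- Division by 1 - q^(k+1), computed with B terms of the geometric series.
geometric< : ℕ → ℕ → (ℕ → ℕ) → ℕ → ℕ
geometric< zero    k f n = 0
geometric< (suc B) k f n = f n + shift (suc k) (geometric< B k f) n

geometric : ℕ → (ℕ → ℕ) → ℕ → ℕ
geometric k f n = geometric< (suc n) k f n

geometric<-enough : ∀ B B′ k f {n} → n < B → n < B′ → geometric< B k f n ≡ geometric< B′ k f n
geometric<-enough (suc B) (suc B′) k f {n} n<B n<B′ = cong (_+_ (f n)) (shift-local k n λ m<n →
  geometric<-enough B B′ k f (<-≤-trans m<n (s≤s⁻¹ n<B)) (<-≤-trans m<n (s≤s⁻¹ n<B′)))

geometric-rec : ∀ k f → geometric k f ≗ f ⊕ shift (suc k) (geometric k f)
geometric-rec k f n = cong (_+_ (f n)) (shift-local k n λ {m} m<n →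
  geometric<-enough n (suc m) k f m<n ≤-refl)

-- The shift by `suc k` makes the recursion determine `h` degree by degree. Identities between
-- geometric series then reduce to checking one recursion.
geometric-unique : ∀ k {f h} → h ≗ f ⊕ shift (suc k) h → h ≗ geometric k f
geometric-unique k {f} {h} h-rec n = go (suc n) n ≤-refl
  where
  go : ∀ B n → n < B → h n ≡ geometric< B k f n
  go (suc B) n n<B = trans (h-rec n) (cong (_+_ (f n)) (shift-local k n λ {m} m<n →
    go B m (<-≤-trans m<n (s≤s⁻¹ n<B))))

geometric-cong : ∀ k {f g} → f ≗ g → geometric k f ≗ geometric k g
geometric-cong k {f} f≗g = geometric-unique k λ n →
  trans (geometric-rec k f n) (cong (_+ shift (suc k) (geometric k f) n) (f≗g n))

geometric-mono : ∀ k {f g} → (∀ n → f n ≤ g n) → ∀ n → geometric k f n ≤ geometric k g n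
geometric-mono k {f} {g} f≤g n = go (suc n) n
  where
  go : ∀ B n → geometric< B k f n ≤ geometric< B k g n
  go zero    n = z≤n
  go (suc B) n = +-mono-≤ (f≤g n) (shift-mono (suc k) (go B) n)

geometric-⊕ : ∀ k f g → geometric k (f ⊕ g) ≗ geometric k f ⊕ geometric k g
geometric-⊕ k f g n = sym (geometric-unique k {f ⊕ g} {geometric k f ⊕ geometric k g} rec n)
  where
  open +-*-Solver
  rec : geometric k f ⊕ geometric k g ≗ f ⊕ g ⊕ shift (suc k) (geometric k f ⊕ geometric k g)
  rec n = begin
    geometric k f n + geometric k g n
      ≡⟨ cong₂ _+_ (geometric-rec k f n) (geometric-rec k g n) ⟩
    (f n + sf) + (g n + sg)
      ≡⟨ solve 4 (λ a b c d → (a :+ b) :+ (c :+ d) := (a :+ c) :+ (b :+ d)) refl (f n) sf (g n) sg ⟩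
    (f n + g n) + (sf + sg)
      ≡⟨ cong (_+_ (f n + g n)) (sym (shift-⊕ (suc k) (geometric k f) (geometric k g) n)) ⟩
    (f n + g n) + shift (suc k) (geometric k f ⊕ geometric k g) n ∎
    where
    open ≡-Reasoning
    sf = shift (suc k) (geometric k f) n
    sg = shift (suc k) (geometric k g) n

geometric-shift : ∀ k a f → geometric k (shift a f) ≗ shift a (geometric k f)
geometric-shift k a f n = sym (geometric-unique k {shift a f} {shift a (geometric k f)} rec n)
  where
  rec : shift a (geometric k f) ≗ shift a f ⊕ shift (suc k) (shift a (geometric k f))
  rec n = trans (shift-cong a (geometric-rec k f) n)
         (trans (shift-⊕ a f (shift (suc k) (geometric k f)) n)
                (cong (_+_ (shift a f n)) (shift-comm a (suc k) (geometric k f) n)))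

geometric-bound : ∀ k {f X} n → (∀ {m} → m ≤ n → f m ≤ X) → geometric k f n ≤ suc n * X
geometric-bound k {f} {X} n f≤ = go (suc n) n f≤
  where
  go : ∀ B n → (∀ {m} → m ≤ n → f m ≤ X) → geometric< B k f n ≤ B * X
  go zero    n f≤ = z≤n
  go (suc B) n f≤ = +-mono-≤ (f≤ ≤-refl)
    (shift-bound (suc k) n λ {m} m≤n → go B m λ l≤m → f≤ (≤-trans l≤m m≤n))

-- The terms 0, ..., m of the geometric series all reach this degree, and each is at least `f n` by
-- monotonicity.
geometric-lower : ∀ k {f} m n → (∀ {i j} → i ≤ j → f i ≤ f j) →
                  suc m * f n ≤ geometric k f (m * suc k + n)
geometric-lower k {f} zero    n f-mono = begin
  f n + 0                                   ≤⟨ +-monoʳ-≤ (f n) z≤n ⟩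
  f n + shift (suc k) (geometric k f) n     ≡⟨ geometric-rec k f n ⟨
  geometric k f n                           ∎
  where open ≤-Reasoning
geometric-lower k {f} (suc m) n f-mono = begin
  f n + suc m * f n
    ≤⟨ +-mono-≤ (f-mono (m≤n+m n (suc m * suc k))) (geometric-lower k m n f-mono) ⟩
  f N + geometric k f (m * suc k + n)
    ≡⟨ cong (_+_ (f N)) (shift-+ (suc k) (geometric k f) (m * suc k + n)) ⟨
  f N + shift (suc k) (geometric k f) (suc k + (m * suc k + n))
    ≡⟨ cong (λ z → f N + shift (suc k) (geometric k f) z) (+-assoc (suc k) (m * suc k) n) ⟨
  f N + shift (suc k) (geometric k f) N
    ≡⟨ geometric-rec k f N ⟨
  geometric k f N ∎
  where
  open ≤-Reasoning
  N = suc m * suc k + n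

-- Partitions with bounded parts

P : ℕ → ℕ → ℕ
P k n = length (partitions≤ k n)

shift-sum : ∀ a (g : ℕ → ℕ → ℕ) B n →
            shift a (λ m → ℕ.sum (applyUpTo (λ j → g j m) B)) n ≡ ℕ.sum (applyUpTo (λ j → shift a (g j) n) B)
shift-sum zero    g zero    n       = refl
shift-sum (suc a) g zero    zero    = refl
shift-sum (suc a) g zero    (suc n) = shift-sum a g zero n
shift-sum a       g (suc B) n       = trans (shift-⊕ a (g 0) _ n)
  (cong (_+_ (shift a (g 0) n)) (shift-sum a (g ∘ suc) B n))

applyUpTo-cong : ∀ {f g : ℕ → ℕ} → f ≗ g → ∀ n → applyUpTo f n ≡ applyUpTo g n
applyUpTo-cong f≗g zero    = refl
applyUpTo-cong f≗g (suc n) = cong₂ _∷_ (f≗g 0) (applyUpTo-cong (f≗g ∘ suc) n)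

geometric<-sum : ∀ B k f n →
  geometric< B k f n ≡ ℕ.sum (applyUpTo (λ j → shift (j * suc k) f n) B)
geometric<-sum zero    k f n = refl
geometric<-sum (suc B) k f n = cong (_+_ (f n)) (begin
  shift (suc k) (geometric< B k f) n
    ≡⟨ shift-cong (suc k) (geometric<-sum B k f) n ⟩
  shift (suc k) (λ m → ℕ.sum (applyUpTo (λ j → shift (j * suc k) f m) B)) n
    ≡⟨ shift-sum (suc k) (λ j → shift (j * suc k) f) B n ⟩
  ℕ.sum (applyUpTo (λ j → shift (suc k) (shift (j * suc k) f) n) B)
    ≡⟨ cong ℕ.sum (applyUpTo-cong (λ j → shift-shift (suc k) (j * suc k) f n) B) ⟩
  ℕ.sum (applyUpTo (λ j → shift (suc j * suc k) f n) B) ∎)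
  where open ≡-Reasoning

-- The multiplicity of the part k+1 is the index of the geometric series; the multiplicities removed
-- by the filter are those whose shifted term vanishes.
P-suc : ∀ k → P (suc k) ≗ geometric k (P k)
P-suc k n = trans (length-concatMap (filter fits? (upTo (suc n))))
           (trans (filtered (suc n) id) (sym (geometric<-sum (suc n) k (P k) n)))
  where
  fits? = λ j → j * suc k ≤? n

  body : ℕ → List (List ℕ)
  body j = List.map (replicate j (suc k) ++_) (partitions≤ k (n ∸ j * suc k))

  term : ℕ → ℕ
  term j = P k (n ∸ j * suc k)

  length-concatMap : ∀ js → length (concatMap body js) ≡ ℕ.sum (List.map term js)
  length-concatMap []       = refl
  length-concatMap (j ∷ js) = trans (length-++ (body j))
    (cong₂ _+_ (length-map _ (partitions≤ k (n ∸ j * suc k))) (length-concatMap js))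

  filtered : ∀ B i → ℕ.sum (List.map term (filter fits? (applyUpTo i B)))
                   ≡ ℕ.sum (applyUpTo (λ j → shift (i j * suc k) (P k) n) B)
  filtered zero    i = refl
  filtered (suc B) i = cases (fits? (i 0))
    where
    js = applyUpTo (i ∘ suc) B
    rest = ℕ.sum (applyUpTo (λ j → shift (i (suc j) * suc k) (P k) n) B)
    cases : Dec (i 0 * suc k ≤ n) → ℕ.sum (List.map term (filter fits? (i 0 ∷ js)))
                                    ≡ shift (i 0 * suc k) (P k) n + rest
    cases (yes fits) = trans (cong (ℕ.sum ∘ List.map term) (filter-accept fits? {i 0} {js} fits))
      (cong₂ _+_ (sym (shift-≤ (i 0 * suc k) (P k) fits)) (filtered B (i ∘ suc)))
    cases (no ¬fits) = trans (cong (ℕ.sum ∘ List.map term) (filter-reject fits? {i 0} {js} ¬fits))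
      (trans (filtered B (i ∘ suc))
        (cong (_+ rest) (sym (shift-< (i 0 * suc k) (P k) (≰⇒> ¬fits)))))

P-rec : ∀ k → P (suc k) ≗ P k ⊕ shift (suc k) (P (suc k))
P-rec k n = trans (P-suc k n) (trans (geometric-rec k (P k) n)
  (cong (_+_ (P k n)) (sym (shift-cong (suc k) (P-suc k) n))))

P-stable : ∀ {k n} → n ≤ k → P k n ≡ p n
P-stable n≤k with ≤⇒≤′ n≤k
... | ≤′-refl          = refl
... | ≤′-step {k} n≤′k = trans (P-rec k _)
  (trans (cong (_+_ (P k _)) (shift-< (suc k) (P (suc k)) (s≤s (≤′⇒≤ n≤′k))))
         (trans (+-identityʳ _) (P-stable (≤′⇒≤ n≤′k))))

P-mono-parts : ∀ {k l} → k ≤ l → ∀ n → P k n ≤ P l n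
P-mono-parts k≤l n with ≤⇒≤′ k≤l
... | ≤′-refl          = ≤-refl
... | ≤′-step {l} k≤′l = ≤-trans (P-mono-parts (≤′⇒≤ k≤′l) n)
  (≤-trans (m≤m+n (P l n) _) (≤-reflexive (sym (P-rec l n))))

P≤p : ∀ k n → P k n ≤ p n
P≤p k n = ≤-trans (P-mono-parts (m≤m⊔n k n) n) (≤-reflexive (P-stable (m≤n⊔m k n)))

-- Partitions into parts from {2, …, k+1}.
G : ℕ → ℕ → ℕ
G zero    = P zero
G (suc k) = geometric (suc k) (G k)

-- Either 1 is not a part, or one copy of it can be removed. The induction multiplies both sides by
-- 1/(1 - q^(k+2)), so no bijection on lists is required.
P-ones : ∀ k → P (suc k) ≗ G k ⊕ shift 1 (P (suc k))
P-ones zero    = P-rec zero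
P-ones (suc k) n = begin
  P (2 + k) n
    ≡⟨ P-suc (suc k) n ⟩
  geometric (suc k) (P (suc k)) n
    ≡⟨ geometric-cong (suc k) (P-ones k) n ⟩
  geometric (suc k) (G k ⊕ shift 1 (P (suc k))) n
    ≡⟨ geometric-⊕ (suc k) (G k) (shift 1 (P (suc k))) n ⟩
  G (suc k) n + geometric (suc k) (shift 1 (P (suc k))) n
    ≡⟨ cong (_+_ (G (suc k) n)) (geometric-shift (suc k) 1 (P (suc k)) n) ⟩
  G (suc k) n + shift 1 (geometric (suc k) (P (suc k))) n
    ≡⟨ cong (_+_ (G (suc k) n)) (sym (shift-cong 1 (P-suc (suc k)) n)) ⟩
  G (suc k) n + shift 1 (P (2 + k)) n ∎
  where open ≡-Reasoning

P-suc-mono : ∀ k {m n} → m ≤ n → P (suc k) m ≤ P (suc k) n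
P-suc-mono k m≤n with ≤⇒≤′ m≤n
... | ≤′-refl          = ≤-refl
... | ≤′-step {n} m≤′n = ≤-trans (P-suc-mono k (≤′⇒≤ m≤′n))
  (≤-trans (m≤n+m (P (suc k) n) (G k (suc n))) (≤-reflexive (sym (P-ones k (suc n)))))

p-suc : ∀ n → p (suc n) ≡ G n (suc n) + p n
p-suc n = trans (P-ones n (suc n)) (cong (_+_ (G n (suc n))) (P-stable (n≤1+n n)))

p-mono : ∀ {m n} → m ≤ n → p m ≤ p n
p-mono m≤n with ≤⇒≤′ m≤n
... | ≤′-refl          = ≤-refl
... | ≤′-step {n} m≤′n = ≤-trans (p-mono (≤′⇒≤ m≤′n))
  (≤-trans (m≤n+m (p n) (G n (suc n))) (≤-reflexive (sym (p-suc n))))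

-- Slow growth: p(n+1) - p(n) = o(p(n))

-- Multiplication by q^(k+1)/(1 - q^(k+1)): the part k+1 occurs at least once.
tail : ℕ → (ℕ → ℕ) → ℕ → ℕ
tail k f = shift (suc k) (geometric k f)

tail-mono : ∀ k {f g} → (∀ n → f n ≤ g n) → ∀ n → tail k f n ≤ tail k g n
tail-mono k f≤g = shift-mono (suc k) (geometric-mono k f≤g)

tail-⊕ : ∀ k f g → tail k (f ⊕ g) ≗ tail k f ⊕ tail k g
tail-⊕ k f g n = trans (shift-cong (suc k) (geometric-⊕ k f g) n)
  (shift-⊕ (suc k) (geometric k f) (geometric k g) n)

tail-* : ∀ k c f → tail k (λ n → c * f n) ≗ (λ n → c * tail k f n)
tail-* k zero    f n = ≤-antisym (shift-bound (suc k) n λ {m} _ →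
  ≤-trans (geometric-bound k m λ _ → ≤-refl) (≤-reflexive (*-zeroʳ (suc m)))) z≤n
tail-* k (suc c) f n = trans (tail-⊕ k f (λ n → c * f n) n) (cong (_+_ (tail k f n)) (tail-* k c f n))

-- Σ over the partitions λ counted by G k of the number of distinct part sizes of λ.
distinct : ℕ → ℕ → ℕ
distinct zero    n = 0
distinct (suc k) = distinct k ⊕ tail (suc k) (distinct k ⊕ G k)

-- Σ over the same partitions of the truncated difference K ∸ (number of part sizes).
deficit : ℕ → ℕ → ℕ → ℕ
deficit zero    k       n = 0
deficit (suc K) zero    n = suc K * P zero n
deficit (suc K) (suc k)   = deficit (suc K) k ⊕ tail (suc k) (deficit K k)

-- A partition with d part sizes contributes d + (K ∸ d), which is at least K.
G≤distinct+deficit : ∀ K k n → K * G k n ≤ distinct k n + deficit K k n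
G≤distinct+deficit zero    k       n = z≤n
G≤distinct+deficit (suc K) zero    n = ≤-refl
G≤distinct+deficit (suc K) (suc k) n = begin
  suc K * G (suc k) n
    ≡⟨ cong (suc K *_) (geometric-rec (suc k) (G k) n) ⟩
  suc K * (G k n + tail (suc k) (G k) n)
    ≡⟨ *-distribˡ-+ (suc K) (G k n) _ ⟩
  suc K * G k n + suc K * tail (suc k) (G k) n
    ≡⟨ cong (_+_ (suc K * G k n)) (sym (tail-* (suc k) (suc K) (G k) n)) ⟩
  suc K * G k n + tail (suc k) (λ m → suc K * G k m) n
    ≤⟨ +-mono-≤ (G≤distinct+deficit (suc K) k n) (tail-mono (suc k) (λ m → begin
         G k m + K * G k m                           ≤⟨ +-monoʳ-≤ (G k m) (G≤distinct+deficit K k m) ⟩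
         G k m + (distinct k m + deficit K k m)      ≡⟨ solve 3 (λ a b c → a :+ (b :+ c) := b :+ a :+ c) refl (G k m) (distinct k m) (deficit K k m) ⟩
         (distinct k ⊕ G k ⊕ deficit K k) m          ∎) n) ⟩
  (distinct k n + deficit (suc K) k n) + tail (suc k) (distinct k ⊕ G k ⊕ deficit K k) n
    ≡⟨ cong (_+_ (distinct k n + deficit (suc K) k n)) (tail-⊕ (suc k) (distinct k ⊕ G k) (deficit K k) n) ⟩
  (distinct k n + deficit (suc K) k n) + (t₁ + t₂)
    ≡⟨ solve 4 (λ a b c d → (a :+ b) :+ (c :+ d) := (a :+ c) :+ (b :+ d)) refl
         (distinct k n) (deficit (suc K) k n) t₁ t₂ ⟩
  distinct (suc k) n + deficit (suc K) (suc k) n ∎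
  where
  open ≤-Reasoning
  open +-*-Solver
  t₁ = tail (suc k) (distinct k ⊕ G k) n
  t₂ = tail (suc k) (deficit K k) n

-- Replacing all copies of one part a ≥ 2 of λ by ones gives a partition with parts ≤ k+1
-- and at least 2 ones, and their number a ≤ k+1 recovers λ.
distinct-bound : ∀ k n → distinct k n + shift (2 + k) (P (suc k)) n ≤ P (suc k) n
distinct-bound zero    n = shift-≤-self n
  where
  shift-≤-self : ∀ n → shift 2 (P 1) n ≤ P 1 n
  shift-≤-self zero          = z≤n
  shift-≤-self (suc zero)    = z≤n
  shift-≤-self (suc (suc n)) = P-suc-mono 0 (m≤n+m n 2)
distinct-bound (suc k) n = begin
  (D n + tail (suc k) (D ⊕ G k) n) + shift (3 + k) C′ n
    ≡⟨ +-assoc (D n) _ _ ⟩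
  D n + (tail (suc k) (D ⊕ G k) n + shift (3 + k) C′ n)
    -- As a series, `distinct k` is q² + ... + q^(k+1) times `G k`, that is, q² - q^(k+2) times
    -- `P (suc k)`. The added term with shift 2 + k completes this to q² times `P (suc k)`, and only
    -- with it does the induction telescope.
    ≡⟨ cong (_+_ (D n)) (begin-equality
        tail (suc k) (D ⊕ G k) n + shift (3 + k) C′ n
          ≡⟨ cong₂ _+_ (tail-⊕ (suc k) D (G k) n)
               (trans (cong (λ z → shift z C′ n) (cong (_+_ 2) (+-comm 1 k)))
                      (sym (shift-shift (2 + k) 1 C′ n))) ⟩
        (tail (suc k) D n + shift (2 + k) (G (suc k)) n) + shift (2 + k) (shift 1 C′) n
          ≡⟨ +-assoc (tail (suc k) D n) _ _ ⟩
        tail (suc k) D n + (shift (2 + k) (G (suc k)) n + shift (2 + k) (shift 1 C′) n)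
          ≡⟨ cong (_+_ (tail (suc k) D n)) (trans
               (sym (shift-⊕ (2 + k) (G (suc k)) (shift 1 C′) n))
               (sym (shift-cong (2 + k) (P-ones (suc k)) n))) ⟩
        tail (suc k) D n + shift (2 + k) C′ n ∎) ⟩
  D n + (tail (suc k) D n + shift (2 + k) C′ n)
    ≡⟨ +-assoc (D n) _ _ ⟨
  (D n + tail (suc k) D n) + shift (2 + k) C′ n
    ≡⟨ cong₂ _+_ (sym (geometric-rec (suc k) D n)) (trans
         (shift-cong (2 + k) (P-suc (suc k)) n) (sym (geometric-shift (suc k) (2 + k) C n))) ⟩
  geometric (suc k) D n + geometric (suc k) (shift (2 + k) C) n
    ≡⟨ geometric-⊕ (suc k) D (shift (2 + k) C) n ⟨
  geometric (suc k) (D ⊕ shift (2 + k) C) n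
    ≤⟨ geometric-mono (suc k) (distinct-bound k) n ⟩
  geometric (suc k) C n
    ≡⟨ P-suc (suc k) n ⟨
  C′ n ∎
  where
  open ≤-Reasoning
  D = distinct k
  C = P (suc k)
  C′ = P (2 + k)

P-zero≤1 : ∀ n → P 0 n ≤ 1
P-zero≤1 zero    = ≤-refl
P-zero≤1 (suc n) = z≤n

-- Only partitions with fewer than K part sizes contribute, each at most K. Such a partition is
-- given by at most K choices of a size and a multiplicity, so for fixed K the bound is polynomial.
deficit-bound : ∀ K k n → deficit K k n ≤ K * (suc k * suc n) ^ K
deficit-bound zero    k       n = z≤n
deficit-bound (suc K) zero    n = *-monoʳ-≤ (suc K)
  (≤-trans (P-zero≤1 n) (m^n>0 (1 * suc n) (suc K)))
deficit-bound (suc K) (suc k) n = begin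
  deficit (suc K) k n + tail (suc k) (deficit K k) n
    ≤⟨ +-mono-≤ (deficit-bound (suc K) k n) (shift-bound (2 + k) n λ {m} m≤n →
         ≤-trans (geometric-bound (suc k) m λ {l} l≤m → ≤-trans (deficit-bound K k l)
                   (*-monoʳ-≤ K (^-monoˡ-≤ K (*-monoʳ-≤ (suc k) (s≤s (≤-trans l≤m m≤n))))))
                 (*-monoˡ-≤ (K * x ^ K) (s≤s m≤n))) ⟩
  suc K * (x * x ^ K) + suc n * (K * x ^ K)
    ≤⟨ +-monoʳ-≤ (suc K * (x * x ^ K)) (*-monoʳ-≤ (suc n) (*-monoˡ-≤ (x ^ K) (n≤1+n K))) ⟩
  suc K * (x * x ^ K) + suc n * (suc K * x ^ K)
    ≡⟨ solve 4 (λ c x z n → c :* (x :* z) :+ n :* (c :* z) := c :* ((n :+ x) :* z)) refl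
         (suc K) x (x ^ K) (suc n) ⟩
  suc K * ((suc n + x) * x ^ K)
    ≤⟨ *-monoʳ-≤ (suc K) (*-monoʳ-≤ (suc n + x) (^-monoˡ-≤ K (m≤n+m x (suc n)))) ⟩
  suc K * ((suc n + x) * (suc n + x) ^ K) ∎
  where
  open ≤-Reasoning
  open +-*-Solver
  x = suc k * suc n

^-distribʳ-* : ∀ k a b → (a * b) ^ k ≡ a ^ k * b ^ k
^-distribʳ-* zero    a b = refl
^-distribʳ-* (suc k) a b = trans (cong (a * b *_) (^-distribʳ-* k a b))
  (solve 4 (λ a b x y → (a :* b) :* (x :* y) := (a :* x) :* (b :* y)) refl a b (a ^ k) (b ^ k))
  where open +-*-Solver

-- Allowing the new part k+2 up to m times gains a factor m+1 and costs m(k+2) in the argument. Thus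
-- every new part size adds one power, while the argument stays linear in m.
P-superpolynomial : ∀ k → ∃[ S ] ∀ m → suc m ^ k ≤ P (suc k) (m * suc S)
P-superpolynomial zero    = 0 , λ m → ≤-trans (≤-reflexive (sym (P-stable {1} {0} z≤n))) (P-suc-mono 0 {0} {m * 1} z≤n)
P-superpolynomial (suc k) = let (S , lower) = P-superpolynomial k in 2 + k + S , λ m → begin
  suc m * suc m ^ k                                 ≤⟨ *-monoʳ-≤ (suc m) (lower m) ⟩
  suc m * P (suc k) (m * suc S)
    ≤⟨ geometric-lower (suc k) m (m * suc S) (P-suc-mono k) ⟩
  geometric (suc k) (P (suc k)) (m * (2 + k) + m * suc S)
    ≡⟨ P-suc (suc k) _ ⟨
  P (2 + k) (m * (2 + k) + m * suc S)
    ≡⟨ cong (P (2 + k)) (sym (*-distribˡ-+ m (2 + k) (suc S))) ⟩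
  P (2 + k) (m * (2 + k + suc S))
    ≡⟨ cong (λ z → P (2 + k) (m * z)) (+-suc (2 + k) S) ⟩
  P (2 + k) (m * suc (2 + k + S)) ∎
  where open ≤-Reasoning

p-superpolynomial : ∀ K k → Eventually λ n → K * suc n ^ k ≤ p n
p-superpolynomial K k = X * suc S , λ n n≥ → let m = n ℕ./ suc S in begin
  K * suc n ^ k
    ≤⟨ *-monoʳ-≤ K (^-monoˡ-≤ k (begin
         suc n                      ≡⟨ cong suc (m≡m%n+[m/n]*n n (suc S)) ⟩
         suc (n ℕ.% suc S + m * suc S)  ≤⟨ +-monoˡ-≤ (m * suc S) (m%n<n n (suc S)) ⟩
         suc m * suc S              ∎)) ⟩
  K * (suc m * suc S) ^ k
    ≡⟨ cong (K *_) (^-distribʳ-* k (suc m) (suc S)) ⟩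
  K * (suc m ^ k * suc S ^ k)
    ≡⟨ solve 3 (λ a b c → a :* (b :* c) := (a :* c) :* b) refl K (suc m ^ k) (suc S ^ k) ⟩
  X * suc m ^ k
    -- `S` was chosen for the exponent k+1; the spare factor `suc m` absorbs the constant `X`.
    ≤⟨ *-monoˡ-≤ (suc m ^ k) (m≤n⇒m≤1+n (begin
         X                          ≡⟨ m*n/n≡m X (suc S) ⟨
         X * suc S ℕ./ suc S          ≤⟨ /-monoˡ-≤ (suc S) n≥ ⟩
         m                          ∎)) ⟩
  suc m ^ suc k
    ≤⟨ lower m ⟩
  P (2 + k) (m * suc S)
    ≤⟨ P-suc-mono (suc k) (m/n*n≤m n (suc S)) ⟩
  P (2 + k) n
    ≤⟨ P≤p (2 + k) n ⟩
  p n ∎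
  where
  open ≤-Reasoning
  open +-*-Solver
  S = proj₁ (P-superpolynomial (suc k))
  lower = proj₂ (P-superpolynomial (suc k))
  X = K * suc S ^ k

-- p(n+1) - p(n) counts partitions without ones. All but polynomially many of them have at
-- least K distinct part sizes, so K (p(n+1) - p(n)) is bounded by p(n+1) up to a small error.
p-slow : ∀ K → Eventually λ n → K * (p (suc n) ∸ p n) ≤ p n
p-slow K = let (N , large) = p-superpolynomial K′ (K′ + K′) in N , λ n n≥ →
  let g = G n (suc n) in *-cancelˡ-≤ 2 (+-cancelʳ-≤ (2 * g) _ _ (begin
    2 * (K * (p (suc n) ∸ p n)) + 2 * g
      ≡⟨ cong (λ z → 2 * (K * z) + 2 * g) (trans (cong (_∸ p n) (p-suc n)) (m+n∸n≡m g (p n))) ⟩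
    2 * (K * g) + 2 * g
      ≡⟨ solve 2 (λ K g → con 2 :* (K :* g) :+ con 2 :* g := (con 2 :+ con 2 :* K) :* g) refl K g ⟩
    K′ * g
      ≤⟨ G≤distinct+deficit K′ n (suc n) ⟩
    distinct n (suc n) + deficit K′ n (suc n)
      ≤⟨ +-mono-≤ (≤-trans (m≤m+n _ _) (≤-trans (distinct-bound n (suc n)) (P≤p (suc n) (suc n))))
                  (begin
           deficit K′ n (suc n)                           ≤⟨ deficit-bound K′ n (suc n) ⟩
           K′ * (suc n * suc (suc n)) ^ K′
             ≤⟨ *-monoʳ-≤ K′ (^-monoˡ-≤ K′ (*-monoˡ-≤ (2 + n) (n≤1+n (suc n)))) ⟩
           K′ * ((2 + n) * (2 + n)) ^ K′
             ≡⟨ cong (K′ *_) (trans (^-distribʳ-* K′ (2 + n) (2 + n)) (sym (^-distribˡ-+-* (2 + n) K′ K′))) ⟩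
           K′ * (2 + n) ^ (K′ + K′)                       ≤⟨ large (suc n) (m≤n⇒m≤1+n n≥) ⟩
           p (suc n)                                      ∎) ⟩
    p (suc n) + p (suc n)
      ≡⟨ cong (λ z → z + z) (p-suc n) ⟩
    (g + p n) + (g + p n)
      ≡⟨ solve 2 (λ g p → (g :+ p) :+ (g :+ p) := con 2 :* p :+ con 2 :* g) refl g (p n) ⟩
    2 * p n + 2 * g ∎))
  where
  open ≤-Reasoning
  open +-*-Solver
  -- With g = p(n+1) - p(n), both error terms are at most p(n+1), so K′ g ≤ 2 p(n+1) = 2 g + 2 p(n).
  -- The summand 2 cancels 2 g, and the factor 2 of K cancels that of p(n).
  K′ = 2 + 2 * K

-- Subsets and monomials

opaque
  δ : ℕ → ℕ → ℕ
  δ a b = if does (a ≟ b) then 1 else 0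

  δ-≡ : ∀ {a b} → a ≡ b → δ a b ≡ 1
  δ-≡ {a} {b} a≡b = cong (if_then 1 else 0) (dec-true (a ≟ b) a≡b)

  δ-≢ : ∀ {a b} → a ≢ b → δ a b ≡ 0
  δ-≢ {a} {b} a≢b = cong (if_then 1 else 0) (dec-false (a ≟ b) a≢b)

δ-cong : ∀ {a b c d} → (a ≡ b → c ≡ d) → (c ≡ d → a ≡ b) → δ a b ≡ δ c d
δ-cong {a} {b} {c} {d} to from = cases (a ≟ b)
  where
  cases : Dec (a ≡ b) → δ a b ≡ δ c d
  cases (yes a≡b) = trans (δ-≡ a≡b) (sym (δ-≡ (to a≡b)))
  cases (no  a≢b) = trans (δ-≢ a≢b) (sym (δ-≢ (a≢b ∘ from)))

-- The second conditions need to agree only where the first one holds. In this way the charge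
-- condition turns an energy shift by a cardinality into a shift by a constant.
δδ-cong : ∀ {a b c d e f g h} → (a ≡ b → c ≡ d) → (c ≡ d → a ≡ b) →
          (a ≡ b → e ≡ f → g ≡ h) → (a ≡ b → g ≡ h → e ≡ f) → δ a b * δ e f ≡ δ c d * δ g h
δδ-cong {a} {b} {c} {d} {e} {f} {g} {h} to from to′ from′ = cases (a ≟ b)
  where
  cases : Dec (a ≡ b) → δ a b * δ e f ≡ δ c d * δ g h
  cases (yes a≡b) = cong₂ _*_ (δ-cong {a} to from) (δ-cong {e} (to′ a≡b) (from′ a≡b))
  cases (no  a≢b) = trans (cong (_* δ e f) (δ-≢ a≢b)) (sym (cong (_* δ g h) (δ-≢ (a≢b ∘ from))))

δδ-≢ : ∀ {a b c d} → (a ≡ b → c ≢ d) → δ a b * δ c d ≡ 0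
δδ-≢ {a} {b} {c} {d} ≢ = cases (a ≟ b)
  where
  cases : Dec (a ≡ b) → δ a b * δ c d ≡ 0
  cases (yes a≡b) = trans (cong (δ a b *_) (δ-≢ (≢ a≡b))) (*-zeroʳ (δ a b))
  cases (no  a≢b) = cong (_* δ c d) (δ-≢ a≢b)

-- Σ of f |x| (Σ x) over the subsets x of {0, …, N-1} containing every i < N with χ i.
sumSubsets : (ℕ → Bool) → ℕ → (ℕ → ℕ → ℕ) → ℕ
sumSubsets χ zero    f = f 0 0
sumSubsets χ (suc N) f = sumSubsets χ N (λ b s → f (suc b) (N + s)) +
                         (if χ N then 0 else sumSubsets χ N f)

none : ℕ → Bool
none _ = false

sumSubsets-cong : ∀ χ N {f g} → (∀ b s → f b s ≡ g b s) → sumSubsets χ N f ≡ sumSubsets χ N g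
sumSubsets-cong χ zero    f≡g = f≡g 0 0
sumSubsets-cong χ (suc N) f≡g with χ N
... | true  = cong (_+ 0) (sumSubsets-cong χ N λ b s → f≡g _ _)
... | false = cong₂ _+_ (sumSubsets-cong χ N λ b s → f≡g _ _) (sumSubsets-cong χ N f≡g)

sumSubsets-⊕ : ∀ χ N f g → sumSubsets χ N (λ b s → f b s + g b s) ≡ sumSubsets χ N f + sumSubsets χ N g
sumSubsets-⊕ χ zero    f g = refl
sumSubsets-⊕ χ (suc N) f g with χ N
... | true  = trans (cong (_+ 0) (sumSubsets-⊕ χ N _ _))
  (solve 2 (λ a b → (a :+ b) :+ con 0 := (a :+ con 0) :+ (b :+ con 0)) refl
    (sumSubsets χ N λ b s → f (suc b) (N + s)) (sumSubsets χ N λ b s → g (suc b) (N + s)))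
  where open +-*-Solver
... | false = trans (cong₂ _+_ (sumSubsets-⊕ χ N _ _) (sumSubsets-⊕ χ N f g))
  (solve 4 (λ a b c d → (a :+ b) :+ (c :+ d) := (a :+ c) :+ (b :+ d)) refl
    (sumSubsets χ N λ b s → f (suc b) (N + s)) (sumSubsets χ N λ b s → g (suc b) (N + s))
    (sumSubsets χ N f) (sumSubsets χ N g))
  where open +-*-Solver

sumSubsets-zero : ∀ χ N {f} → (∀ b s → f b s ≡ 0) → sumSubsets χ N f ≡ 0
sumSubsets-zero χ zero    f≡0 = f≡0 0 0
sumSubsets-zero χ (suc N) f≡0 with χ N
... | true  = cong (_+ 0) (sumSubsets-zero χ N λ b s → f≡0 _ _)
... | false = cong₂ _+_ (sumSubsets-zero χ N λ b s → f≡0 _ _) (sumSubsets-zero χ N f≡0)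

sumSubsets-mono : ∀ χ N {f g} → (∀ b s → f b s ≤ g b s) → sumSubsets χ N f ≤ sumSubsets χ N g
sumSubsets-mono χ zero    f≤g = f≤g 0 0
sumSubsets-mono χ (suc N) f≤g with χ N
... | true  = +-monoˡ-≤ 0 (sumSubsets-mono χ N λ b s → f≤g _ _)
... | false = +-mono-≤ (sumSubsets-mono χ N λ b s → f≤g _ _) (sumSubsets-mono χ N f≤g)

sumSubsets-local : ∀ {χ χ′} N f → (∀ {i} → i < N → χ i ≡ χ′ i) → sumSubsets χ N f ≡ sumSubsets χ′ N f
sumSubsets-local zero    f χ≡χ′ = refl
sumSubsets-local {χ} {χ′} (suc N) f χ≡χ′ = cong₂ _+_ (sumSubsets-local N _ (χ≡χ′ ∘ m<n⇒m<1+n))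
  (cong₂ (λ c z → if c then 0 else z) (χ≡χ′ ≤-refl) (sumSubsets-local N f (χ≡χ′ ∘ m<n⇒m<1+n)))

-- The first summand runs over the subsets without 0, the second over those with 0.
sumSubsets-bottom : ∀ N f → sumSubsets none (suc N) f ≡
  sumSubsets none N (λ a t → f a (t + a)) + sumSubsets none N (λ a t → f (suc a) (t + a))
sumSubsets-bottom zero    f = +-comm (f 1 0) (f 0 0)
sumSubsets-bottom (suc N) f = begin
  sumSubsets none (suc N) (λ b s → f (suc b) (suc N + s)) + sumSubsets none (suc N) f
    ≡⟨ cong₂ _+_ (sumSubsets-bottom N _) (sumSubsets-bottom N f) ⟩
  (sumSubsets none N (λ a t → f (suc a) (suc N + (t + a))) +
    sumSubsets none N (λ a t → f (2 + a) (suc N + (t + a)))) +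
  (sumSubsets none N (λ a t → f a (t + a)) + sumSubsets none N (λ a t → f (suc a) (t + a)))
    ≡⟨ cong (_+ (sumSubsets none N (λ a t → f a (t + a)) + sumSubsets none N (λ a t → f (suc a) (t + a)))) (cong₂ _+_
         (sumSubsets-cong none N λ a t → cong (f (suc a))
           (solve 3 (λ n t a → con 1 :+ n :+ (t :+ a) := (n :+ t) :+ (con 1 :+ a)) refl N t a))
         (sumSubsets-cong none N λ a t → cong (f (2 + a))
           (solve 3 (λ n t a → con 1 :+ n :+ (t :+ a) := (n :+ t) :+ (con 1 :+ a)) refl N t a))) ⟩
  (sumSubsets none N (λ a t → f (suc a) ((N + t) + suc a)) +
    sumSubsets none N (λ a t → f (2 + a) ((N + t) + suc a))) +
  (sumSubsets none N (λ a t → f a (t + a)) + sumSubsets none N (λ a t → f (suc a) (t + a)))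
    ≡⟨ solve 4 (λ a b c d → (a :+ b) :+ (c :+ d) := (a :+ c) :+ (b :+ d)) refl
         (sumSubsets none N (λ a t → f (suc a) ((N + t) + suc a)))
         (sumSubsets none N (λ a t → f (2 + a) ((N + t) + suc a)))
         (sumSubsets none N (λ a t → f a (t + a))) (sumSubsets none N (λ a t → f (suc a) (t + a))) ⟩
  sumSubsets none (suc N) (λ a t → f a (t + a)) + sumSubsets none (suc N) (λ a t → f (suc a) (t + a)) ∎
  where
  open ≡-Reasoning
  open +-*-Solver

-- Increasing the largest element of a nonempty subset by one is injective.
sumSubsets-raise : ∀ N {f g} → f 0 0 ≡ 0 → (∀ a t → f (suc a) t ≤ g (suc a) (suc t)) →
                   sumSubsets none N f ≤ sumSubsets none (suc N) g
sumSubsets-raise zero    f≡0 f≤g = ≤-trans (≤-reflexive f≡0) z≤n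
sumSubsets-raise (suc N) {f} {g} f≡0 f≤g = +-mono-≤
  (≤-trans (sumSubsets-mono none N λ a t → f≤g a (N + t))
           (m≤n+m (sumSubsets none N λ a t → g (suc a) (suc N + t))
                  (sumSubsets none N λ a t → g (2 + a) (suc N + (N + t)))))
  (sumSubsets-raise N {f} {g} f≡0 f≤g)

-- The sets on the left are split by whether they contain `r`. If not, adding `r` gives a set
-- admissible for `χ′` whose size and sum are exactly the arguments of `f`; if so, the set is
-- already admissible for `χ′`.
sumSubsets-insert : ∀ {χ χ′ r} M f → r < M → χ r ≡ false → χ′ r ≡ true →
  (∀ {i} → i ≢ r → χ i ≡ χ′ i) →
  sumSubsets χ M (λ b s → f (suc b) (r + s)) ≡
  sumSubsets χ′ M f + sumSubsets χ′ M (λ b s → f (suc b) (r + s))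
sumSubsets-insert {χ} {χ′} {r} (suc M) f r<1+M χr χ′r χ≡χ′ with r ≟ M
... | yes refl rewrite χr | χ′r = begin
    sumSubsets χ r f₂ + sumSubsets χ r f₁
      ≡⟨ cong₂ _+_ (same f₂) (same f₁) ⟩
    sumSubsets χ′ r f₂ + sumSubsets χ′ r f₁
      ≡⟨ solve 2 (λ a b → a :+ b := (b :+ con 0) :+ (a :+ con 0)) refl
           (sumSubsets χ′ r f₂) (sumSubsets χ′ r f₁) ⟩
    sumSubsets χ′ r f₁ + 0 + (sumSubsets χ′ r f₂ + 0) ∎
  where
  open ≡-Reasoning
  open +-*-Solver
  f₁ f₂ : ℕ → ℕ → ℕ
  f₁ b s = f (suc b) (r + s)
  f₂ b s = f (2 + b) (r + (r + s))
  same : ∀ g → sumSubsets χ r g ≡ sumSubsets χ′ r g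
  same g = sumSubsets-local r g (χ≡χ′ ∘ <⇒≢)
... | no  r≢M rewrite χ≡χ′ {M} (r≢M ∘ sym) = split (χ′ M)
  where
  open ≡-Reasoning
  open +-*-Solver
  r<M = ≤∧≢⇒< (s≤s⁻¹ r<1+M) r≢M
  g : ℕ → ℕ → ℕ
  g b s = f (suc b) (M + s)
  swap : ∀ χ → sumSubsets χ M (λ b s → f (2 + b) (r + (M + s))) ≡
               sumSubsets χ M (λ b s → g (suc b) (r + s))
  swap χ = sumSubsets-cong χ M λ b s → cong (f (2 + b))
    (solve 3 (λ r m s → r :+ (m :+ s) := m :+ (r :+ s)) refl r M s)
  IH : ∀ h → _
  IH h = sumSubsets-insert {χ} {χ′} {r} M h r<M χr χ′r χ≡χ′
  above : sumSubsets χ M (λ b s → f (2 + b) (r + (M + s))) ≡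
          sumSubsets χ′ M g + sumSubsets χ′ M (λ b s → f (2 + b) (r + (M + s)))
  above = trans (swap χ) (trans (IH g) (cong (_+_ (sumSubsets χ′ M g)) (sym (swap χ′))))
  split : ∀ c →
    sumSubsets χ M (λ b s → f (2 + b) (r + (M + s))) +
      (if c then 0 else sumSubsets χ M (λ b s → f (suc b) (r + s))) ≡
    (sumSubsets χ′ M g + (if c then 0 else sumSubsets χ′ M f)) +
    (sumSubsets χ′ M (λ b s → f (2 + b) (r + (M + s))) +
      (if c then 0 else sumSubsets χ′ M (λ b s → f (suc b) (r + s))))
  split true  = trans (cong (_+ 0) above)
    (solve 2 (λ a b → (a :+ b) :+ con 0 := (a :+ con 0) :+ (b :+ con 0)) refl
      (sumSubsets χ′ M g) (sumSubsets χ′ M (λ b s → f (2 + b) (r + (M + s)))))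
  split false = trans (cong₂ _+_ above (IH f))
    (solve 4 (λ a b c d → (a :+ b) :+ (c :+ d) := (a :+ c) :+ (b :+ d)) refl
      (sumSubsets χ′ M g) (sumSubsets χ′ M (λ b s → f (2 + b) (r + (M + s))))
      (sumSubsets χ′ M f) (sumSubsets χ′ M (λ b s → f (suc b) (r + s))))

-- Counting monomials: a finite triple product identity

-- The condition on sets x, y of sizes a, b and sums t, s to form a monomial of charge c with
-- Σ_{n ∈ x} n + Σ_{m ∈ y} (m + 1) = ε. For c = 0 this sum is the L(0)-eigenvalue.
δ-monomial : (c ε a t b s : ℕ) → ℕ
δ-monomial c ε a t b s = δ a (b + c) * δ (t + (s + b)) ε

count : (χ : ℕ → Bool) (N M c ε : ℕ) → ℕ
count χ N M c ε = sumSubsets none N λ a t → sumSubsets χ M (δ-monomial c ε a t)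

-- Moving the boundary between occupied and empty modes by one step.
count-shift : ∀ N M c ε → count none (suc N) M (suc c) (ε + c) ≡ count none N (suc M) c ε
count-shift N M c ε = begin
  count none (suc N) M (suc c) (ε + c)
    ≡⟨ sumSubsets-bottom N _ ⟩
  sumSubsets none N (λ a t → sumSubsets none M (δ-monomial (suc c) (ε + c) a (t + a))) +
  sumSubsets none N (λ a t → sumSubsets none M (δ-monomial (suc c) (ε + c) (suc a) (t + a)))
    -- An occupied boundary mode, 0 ∈ x, becomes 0 ∉ y after the move, and an empty one becomes 0 ∈
    -- y; hence the two summands change places.
    ≡⟨ +-comm (sumSubsets none N (λ a t → sumSubsets none M (δ-monomial (suc c) (ε + c) a (t + a)))) _ ⟩
  sumSubsets none N (λ a t → sumSubsets none M (δ-monomial (suc c) (ε + c) (suc a) (t + a))) +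
  sumSubsets none N (λ a t → sumSubsets none M (δ-monomial (suc c) (ε + c) a (t + a)))
    ≡⟨ cong₂ _+_ (sumSubsets-cong none N λ a t → sumSubsets-cong none M λ b s →
                    δδ-cong {suc a} (λ e → suc-injective (trans e (+-suc b c)))
                            (λ e → trans (cong suc e) (sym (+-suc b c)))
                            (λ e → to t s (suc-injective (trans e (+-suc b c))))
                            (λ e → from t s (suc-injective (trans e (+-suc b c)))))
                 (sumSubsets-cong none N λ a t → sumSubsets-cong none M λ b s →
                    δδ-cong {a} (λ e → trans e (+-suc b c)) (λ e → trans e (sym (+-suc b c))) (to′ t s) (from′ t s)) ⟩
  sumSubsets none N (λ a t → sumSubsets none M (λ b s → δ-monomial c ε a t b (s + b))) +
  sumSubsets none N (λ a t → sumSubsets none M (λ b s → δ-monomial c ε a t (suc b) (s + b)))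
    ≡⟨ sumSubsets-⊕ none N _ _ ⟨
  sumSubsets none N (λ a t → sumSubsets none M (λ b s → δ-monomial c ε a t b (s + b)) +
                             sumSubsets none M (λ b s → δ-monomial c ε a t (suc b) (s + b)))
    ≡⟨ sumSubsets-cong none N (λ a t → sym (sumSubsets-bottom M _)) ⟩
  count none N (suc M) c ε ∎
  where
  open ≡-Reasoning
  open +-*-Solver
  eq : ∀ t b s → (t + (b + c)) + (s + b) ≡ (t + ((s + b) + b)) + c
  eq t b s = solve 4 (λ t b s c → (t :+ (b :+ c)) :+ (s :+ b) := (t :+ ((s :+ b) :+ b)) :+ c) refl t b s c
  eq′ : ∀ t b s → (t + (b + suc c)) + (s + b) ≡ (t + ((s + b) + suc b)) + c
  eq′ t b s = solve 4 (λ t b s c → (t :+ (b :+ (con 1 :+ c))) :+ (s :+ b) := (t :+ ((s :+ b) :+ (con 1 :+ b))) :+ c) refl t b s c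
  to : ∀ {a b} t s → a ≡ b + c → (t + a) + (s + b) ≡ ε + c → t + ((s + b) + b) ≡ ε
  to {b = b} t s refl e = +-cancelʳ-≡ c _ _ (trans (sym (eq t b s)) e)
  from : ∀ {a b} t s → a ≡ b + c → t + ((s + b) + b) ≡ ε → (t + a) + (s + b) ≡ ε + c
  from {b = b} t s refl e = trans (eq t b s) (cong (_+ c) e)
  to′ : ∀ {a b} t s → a ≡ b + suc c → (t + a) + (s + b) ≡ ε + c → t + ((s + b) + suc b) ≡ ε
  to′ {b = b} t s refl e = +-cancelʳ-≡ c _ _ (trans (sym (eq′ t b s)) e)
  from′ : ∀ {a b} t s → a ≡ b + suc c → t + ((s + b) + suc b) ≡ ε → (t + a) + (s + b) ≡ ε + c
  from′ {b = b} t s refl e = trans (eq′ t b s) (cong (_+ c) e)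

-- k(k-1)/2 = 0 + 1 + ... + (k-1), the least sum of k distinct natural numbers.
triangle : ℕ → ℕ
triangle zero    = 0
triangle (suc k) = triangle k + k

-- Serves in two ways. For `M` = 0 the set y on the left is empty, which turns the charge 0 count
-- into a count of single k-subsets; for fixed `k` it compares charge k with charge 0.
count-shifts : ∀ k N M ε → count none (k + N) M k (ε + triangle k) ≡ count none N (k + M) 0 ε
count-shifts zero    N M ε = cong (count none N M 0) (+-identityʳ ε)
count-shifts (suc k) N M ε = begin
  count none (suc k + N) M (suc k) (ε + (triangle k + k))
    ≡⟨ cong (count none (suc k + N) M (suc k)) (sym (+-assoc ε (triangle k) k)) ⟩
  count none (suc k + N) M (suc k) (ε + triangle k + k)
    ≡⟨ count-shift (k + N) M k (ε + triangle k) ⟩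
  count none (k + N) (suc M) k (ε + triangle k)
    ≡⟨ count-shifts k N (suc M) ε ⟩
  count none N (k + suc M) 0 ε
    ≡⟨ cong (λ m → count none N m 0 ε) (+-suc k M) ⟩
  count none N (suc k + M) 0 ε ∎
  where open ≡-Reasoning

subsetsBySum : (N k s : ℕ) → ℕ
subsetsBySum N k s = sumSubsets none N λ a t → δ a k * δ t s

subsetsBySum-small : ∀ N k {s} → s < triangle k → subsetsBySum N k s ≡ 0
subsetsBySum-small zero    (suc k) _ = δδ-≢ {0} λ ()
subsetsBySum-small (suc N) (suc k) {s} s<△ =
  trans (sumSubsets-bottom N _) (cong₂ _+_ (without0 (suc k ≤? s)) (with0 (k ≤? s)))
  where
  without0 : Dec (suc k ≤ s) → sumSubsets none N (λ a t → δ a (suc k) * δ (t + a) s) ≡ 0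
  without0 (yes k<s) = trans
    (sumSubsets-cong none N λ a t → δδ-cong {a} id id
      (λ { refl e → trans (sym (m+n∸n≡m t (suc k))) (cong (_∸ suc k) e) })
      (λ { refl e → trans (cong (_+ suc k) e) (m∸n+n≡m k<s) }))
    (subsetsBySum-small N (suc k) (≤-<-trans (m∸n≤m s (suc k)) s<△))
  without0 (no k≮s) = sumSubsets-zero none N λ a t → δδ-≢ {a}
    λ { refl refl → k≮s (m≤n+m (suc k) t) }
  with0 : Dec (k ≤ s) → sumSubsets none N (λ a t → δ (suc a) (suc k) * δ (t + a) s) ≡ 0
  with0 (yes k≤s) = trans
    (sumSubsets-cong none N λ a t → δδ-cong {suc a} suc-injective (cong suc)
      (λ { refl e → trans (sym (m+n∸n≡m t a)) (cong (_∸ a) e) })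
      (λ { refl e → trans (cong (_+ a) e) (m∸n+n≡m k≤s) }))
    (subsetsBySum-small N k (+-cancelʳ-< k _ _ (≤-<-trans (≤-reflexive (m∸n+n≡m k≤s)) s<△)))
  with0 (no k≰s) = sumSubsets-zero none N λ a t → δδ-≢ {suc a}
    λ { refl refl → k≰s (m≤n+m a t) }

-- Partitions in an N × k box, as k-subsets of {0, …, N+k-1}.
inBox : (N k ε : ℕ) → ℕ
inBox N k ε = subsetsBySum (N + k) k (ε + triangle k)

-- The q-Pascal rule. If 0 lies in the subset, one of the k+1 parts is empty and is dropped;
-- otherwise all k+1 parts are positive and each is lowered by 1.
inBox-rec : ∀ N k ε → inBox (suc N) (suc k) ε ≡ inBox (suc N) k ε + shift (suc k) (inBox N (suc k)) ε
inBox-rec N k ε = begin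
  inBox (suc N) (suc k) ε
    ≡⟨ sumSubsets-bottom (N + suc k) _ ⟩
  sumSubsets none (N + suc k) (λ a t → δ a (suc k) * δ (t + a) x) +
  sumSubsets none (N + suc k) (λ a t → δ (suc a) (suc k) * δ (t + a) x)
    ≡⟨ +-comm _ (sumSubsets none (N + suc k) (λ a t → δ (suc a) (suc k) * δ (t + a) x)) ⟩
  sumSubsets none (N + suc k) (λ a t → δ (suc a) (suc k) * δ (t + a) x) +
  sumSubsets none (N + suc k) (λ a t → δ a (suc k) * δ (t + a) x)
    ≡⟨ cong₂ _+_ with0 (without0 (suc k ≤? ε)) ⟩
  inBox (suc N) k ε + shift (suc k) (inBox N (suc k)) ε ∎
  where
  open ≡-Reasoning
  x = ε + (triangle k + k)
  with0 : sumSubsets none (N + suc k) (λ a t → δ (suc a) (suc k) * δ (t + a) x) ≡ inBox (suc N) k ε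
  with0 = trans
    (sumSubsets-cong none (N + suc k) λ a t → δδ-cong {suc a} suc-injective (cong suc)
      (λ { refl e → +-cancelʳ-≡ a _ _ (trans e (sym (+-assoc ε (triangle a) a))) })
      (λ { refl e → trans (cong (_+ a) e) (+-assoc ε (triangle a) a) }))
    (cong (λ n → subsetsBySum n k (ε + triangle k)) (+-suc N k))
  without0 : Dec (suc k ≤ ε) → sumSubsets none (N + suc k) (λ a t → δ a (suc k) * δ (t + a) x) ≡
             shift (suc k) (inBox N (suc k)) ε
  without0 (yes k<ε) = trans
    (sumSubsets-cong none (N + suc k) λ a t → δδ-cong {a} id id
      (λ { refl e → +-cancelʳ-≡ (suc k) _ _ (trans e (sym y)) })
      (λ { refl e → trans (cong (_+ suc k) e) y }))
    (sym (shift-≤ (suc k) (inBox N (suc k)) k<ε))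
    where
    y : (ε ∸ suc k + triangle (suc k)) + suc k ≡ x
    y = trans (+-assoc (ε ∸ suc k) _ _) (trans (cong (_+_ (ε ∸ suc k)) (+-comm (triangle (suc k)) (suc k)))
        (trans (sym (+-assoc (ε ∸ suc k) _ _)) (cong (_+ triangle (suc k)) (m∸n+n≡m k<ε))))
  without0 (no k≮ε) = trans
    (small-sum (suc k ≤? x))
    (sym (shift-< (suc k) (inBox N (suc k)) (≰⇒> k≮ε)))
    where
    small-sum : Dec (suc k ≤ x) → sumSubsets none (N + suc k) (λ a t → δ a (suc k) * δ (t + a) x) ≡ 0
    small-sum (no k≮x) = sumSubsets-zero none (N + suc k) λ a t → δδ-≢ {a}
      λ { refl e → k≮x (≤-trans (m≤n+m (suc k) t) (≤-reflexive e)) }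
    small-sum (yes k<x) = trans
      (sumSubsets-cong none (N + suc k) λ a t → δδ-cong {a} id id
        (λ { refl e → trans (sym (m+n∸n≡m t (suc k))) (cong (_∸ suc k) e) })
        (λ { refl e → trans (cong (_+ suc k) e) (m∸n+n≡m k<x) }))
      (subsetsBySum-small (N + suc k) (suc k) (+-cancelʳ-< (suc k) _ _
        (≤-<-trans (≤-reflexive (m∸n+n≡m k<x))
          (<-≤-trans (+-monoˡ-< (triangle (suc k)) (≰⇒> k≮ε))
            (≤-reflexive (+-comm (suc k) (triangle (suc k))))))))

-- For ε < N the side N of the box is no constraint, and `inBox-rec` becomes the recursion `P-rec`.
-- The box allows at most k parts, while `P` bounds the parts by k: the two are conjugate.
inBox≡P : ∀ N k ε → ε < N → inBox N k ε ≡ P k ε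
inBox≡P N       zero    ε ε<N = empty (N + 0) ε
  where
  empty : ∀ N ε → subsetsBySum N 0 (ε + 0) ≡ P 0 ε
  empty zero    zero    = cong₂ _*_ (δ-≡ {0} refl) (δ-≡ {0} refl)
  empty zero    (suc ε) = δδ-≢ λ _ ()
  empty (suc N) ε       = cong₂ _+_ (sumSubsets-zero none N λ _ _ → δδ-≢ λ ()) (empty N ε)
inBox≡P (suc N) (suc k) ε ε<1+N = begin
  inBox (suc N) (suc k) ε
    ≡⟨ inBox-rec N k ε ⟩
  inBox (suc N) k ε + shift (suc k) (inBox N (suc k)) ε
    ≡⟨ cong₂ _+_ (inBox≡P (suc N) k ε ε<1+N) (shift-local k ε λ {m} m<ε →
         inBox≡P N (suc k) m (<-≤-trans m<ε (s≤s⁻¹ ε<1+N))) ⟩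
  P k ε + shift (suc k) (P (suc k)) ε
    ≡⟨ P-rec k ε ⟨
  P (suc k) ε ∎
  where open ≡-Reasoning

count-none₀ : ∀ {N M ε} → ε < N → ε ≤ M → count none N M 0 ε ≡ p ε
count-none₀ {N} {M} {ε} ε<N ε≤M = begin
  count none N M 0 ε
    ≡⟨ cong (λ m → count none N m 0 ε) (+-identityʳ M) ⟨
  count none N (M + 0) 0 ε
    ≡⟨ count-shifts M N 0 ε ⟨
  count none (M + N) 0 M (ε + triangle M)
    ≡⟨ cong (λ n → count none n 0 M (ε + triangle M)) (+-comm M N) ⟩
  count none (N + M) 0 M (ε + triangle M)
    ≡⟨ sumSubsets-cong none (N + M) (λ a t → cong (λ z → δ a M * δ z (ε + triangle M)) (+-identityʳ t)) ⟩
  inBox N M ε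
    ≡⟨ inBox≡P N M ε ε<N ⟩
  P M ε
    ≡⟨ P-stable ε≤M ⟩
  p ε ∎
  where open ≡-Reasoning

count-none : ∀ k {N M ε} → ε < N → ε ≤ k + M → count none (k + N) M k (ε + triangle k) ≡ p ε
count-none k {N} {M} {ε} ε<N ε≤k+M = trans (count-shifts k N M ε) (count-none₀ ε<N ε≤k+M)

-- Insertion of a mode, monotonicity, and independence of the truncation

count-insert : ∀ {χ χ′ r} N M c ε → r < M → χ r ≡ false → χ′ r ≡ true →
  (∀ {i} → i ≢ r → χ i ≡ χ′ i) →
  count χ N M (suc c) ε ≡ count χ′ N M c (ε + suc r) + count χ′ N M (suc c) ε
count-insert {χ} {χ′} {r} N M c ε r<M χr χ′r χ≡χ′ = trans
  (sumSubsets-cong none N λ a t → trans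
    (sumSubsets-cong χ M λ b s → sym (move a t b s))
    (trans (sumSubsets-insert M (δ-monomial c (ε + suc r) a t) r<M χr χ′r χ≡χ′)
           (cong (_+_ (sumSubsets χ′ M (δ-monomial c (ε + suc r) a t)))
                 (sumSubsets-cong χ′ M λ b s → move a t b s))))
  (sumSubsets-⊕ none N _ _)
  where
  open +-*-Solver
  eq : ∀ t b s → t + (r + s + suc b) ≡ t + (s + b) + suc r
  eq t b s = solve 4 (λ t r s b → t :+ (r :+ s :+ (con 1 :+ b)) := t :+ (s :+ b) :+ (con 1 :+ r)) refl t r s b
  move : ∀ a t b s → δ-monomial c (ε + suc r) a t (suc b) (r + s) ≡ δ-monomial (suc c) ε a t b s
  move a t b s = δδ-cong {a} (λ e → trans e (sym (+-suc b c))) (λ e → trans e (+-suc b c))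
    (λ _ e → +-cancelʳ-≡ (suc r) _ _ (trans (sym (eq t b s)) e))
    (λ _ e → trans (eq t b s) (cong (_+ suc r) e))

-- Positive charge forces x to be nonempty, so its largest element can be raised by one.
count-raise : ∀ χ N M c ε → count χ N M (suc c) ε ≤ count χ (suc N) M (suc c) (suc ε)
count-raise χ N M c ε = sumSubsets-raise N
  (sumSubsets-zero χ M λ b s → cong (_* δ (s + b) ε) (δ-≢ λ 0≡ → 0≢1+n (trans 0≡ (+-suc b c))))
  (λ a t → ≤-reflexive (sumSubsets-cong χ M λ b s → δδ-cong {suc a} id id
    (λ _ → cong suc) (λ _ → suc-injective)))

count-sucˡ : ∀ χ N M c ε → ε < N → count χ (suc N) M c ε ≡ count χ N M c ε
count-sucˡ χ N M c ε ε<N = cong (_+ count χ N M c ε)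
  (sumSubsets-zero none N λ a t → sumSubsets-zero χ M λ b s → δδ-≢ {suc a}
    λ { _ refl → <⇒≱ ε<N (≤-trans (m≤m+n N t) (m≤m+n (N + t) _)) })

-- The boundary case ε = N. If N ∈ x, charge 0 forces y to be nonempty, and an element of y costs at
-- least 1 more.
count-sucˡ₀ : ∀ χ N M → count χ (suc N) M 0 N ≡ count χ N M 0 N
count-sucˡ₀ χ N M = cong (_+ count χ N M 0 N)
  (sumSubsets-zero none N λ a t → sumSubsets-zero χ M λ b s → δδ-≢ {suc a} {b + 0} (exceeds a t b s))
  where
  exceeds : ∀ a t b s → suc a ≡ b + 0 → N + t + (s + b) ≢ N
  exceeds a t zero    s () e
  exceeds a t (suc b) s _  e = m≢1+m+n N {t + (s + b)} (trans (sym e)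
    (solve 4 (λ n t s b → n :+ t :+ (s :+ (con 1 :+ b)) := con 1 :+ (n :+ (t :+ (s :+ b)))) refl N t s b))
    where open +-*-Solver

count-sucʳ : ∀ χ N M c ε → ε ≤ M → χ M ≡ false → count χ N (suc M) c ε ≡ count χ N M c ε
count-sucʳ χ N M c ε ε≤M χM = sumSubsets-cong none N λ a t → cong₂ _+_
  (sumSubsets-zero χ M λ b s → δδ-≢ {a} λ { _ refl →
    <⇒≱ (s≤s ε≤M) (≤-trans (s≤s (≤-trans (m≤m+n M s) (m≤m+n (M + s) b)))
      (≤-trans (≤-reflexive (sym (+-suc (M + s) b))) (m≤n+m (M + s + suc b) t))) })
  (cong (λ z → if z then 0 else sumSubsets χ M (δ-monomial c ε a t)) χM)

count-stableˡ : ∀ χ {N N′} M c ε → ε < N → N ≤ N′ → count χ N′ M c ε ≡ count χ N M c ε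
count-stableˡ χ M c ε ε<N N≤N′ with ≤⇒≤′ N≤N′
... | ≤′-refl           = refl
... | ≤′-step {N′} N≤′N′ = trans (count-sucˡ χ N′ M c ε (<-≤-trans ε<N (≤′⇒≤ N≤′N′)))
  (count-stableˡ χ M c ε ε<N (≤′⇒≤ N≤′N′))

count-stableʳ : ∀ χ N {M M′} c ε → ε ≤ M → (∀ {i} → M ≤ i → χ i ≡ false) → M ≤ M′ →
                count χ N M′ c ε ≡ count χ N M c ε
count-stableʳ χ N c ε ε≤M χ-none M≤M′ with ≤⇒≤′ M≤M′
... | ≤′-refl           = refl
... | ≤′-step {M′} M≤′M′ = trans
  (count-sucʳ χ N M′ c ε (≤-trans ε≤M (≤′⇒≤ M≤′M′)) (χ-none (≤′⇒≤ M≤′M′)))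
  (count-stableʳ χ N c ε ε≤M χ-none (≤′⇒≤ M≤′M′))

member : List ℕ → ℕ → Bool
member R i = does (i ∈? R)

bound : List ℕ → ℕ
bound []      = 0
bound (r ∷ R) = suc r + bound R

∈⇒<bound : ∀ {R i} → i ∈ R → i < bound R
∈⇒<bound {r ∷ R} (here refl)  = m≤m+n (suc r) (bound R)
∈⇒<bound {r ∷ R} (there i∈R) = ≤-trans (∈⇒<bound i∈R) (m≤n+m (bound R) (suc r))

member-bound : ∀ R {i} → bound R ≤ i → member R i ≡ false
member-bound R {i} b≤i = dec-false (i ∈? R) λ i∈R → <⇒≱ (∈⇒<bound i∈R) b≤i

-- The number of monomials of charge c with R ⊆ {m_1, …, m_b} and energy ε as in δ-monomial.
Z : List ℕ → ℕ → ℕ → ℕ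
Z R c ε = count (member R) (suc ε) (ε + bound R) c ε

Z≡count : ∀ R {N M} c ε → ε < N → ε ≤ M → bound R ≤ M → Z R c ε ≡ count (member R) N M c ε
Z≡count R {N} {M} c ε ε<N ε≤M b≤M = begin
  Z R c ε
    ≡⟨ count-stableʳ (member R) (suc ε) c ε (m≤m+n ε _) (λ le → member-bound R (≤-trans (m≤n+m (bound R) ε) le)) (m≤n+m (ε + bound R) M) ⟨
  count (member R) (suc ε) (M + (ε + bound R)) c ε
    ≡⟨ count-stableʳ (member R) (suc ε) c ε ε≤M (λ le → member-bound R (≤-trans b≤M le)) (m≤m+n M _) ⟩
  count (member R) (suc ε) M c ε
    ≡⟨ count-stableˡ (member R) M c ε ≤-refl ε<N ⟨
  count (member R) N M c ε ∎
  where open ≡-Reasoning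

-- The lowest monomial of charge k has L(0)-eigenvalue k²/2. The energy of `δ-monomial` is less by
-- k/2, which leaves `triangle k`; above this level partitions are counted.
Z-[] : ∀ k ε → Z [] k (ε + triangle k) ≡ p ε
Z-[] k ε = trans
  (Z≡count [] {k + suc (ε + triangle k)} {ε + triangle k} k (ε + triangle k) (m≤n+m _ k) ≤-refl z≤n)
  (count-none k (s≤s (m≤m+n ε _)) (≤-trans (m≤m+n ε (triangle k)) (m≤n+m _ k)))

Z-insert : ∀ {r R} → r ∉ R → ∀ c ε → Z R (suc c) ε ≡ Z (r ∷ R) c (ε + suc r) + Z (r ∷ R) (suc c) ε
Z-insert {r} {R} r∉R c ε = begin
  Z R (suc c) ε
    ≡⟨ Z≡count R (suc c) ε (m≤n⇒m≤n+o _ ≤-refl) (m≤m+n ε _)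
         (≤-trans (m≤n+m (bound R) (suc r)) (m≤n+m _ ε)) ⟩
  count (member R) N M (suc c) ε
    ≡⟨ count-insert N M c ε (≤-trans (m≤m+n (suc r) (bound R)) (m≤n+m _ ε))
         (dec-false (r ∈? R) r∉R) (dec-true (r ∈? (r ∷ R)) (here refl)) agree ⟩
  count (member (r ∷ R)) N M c (ε + suc r) + count (member (r ∷ R)) N M (suc c) ε
    ≡⟨ cong₂ _+_ (Z≡count (r ∷ R) c (ε + suc r) ≤-refl (+-monoʳ-≤ ε (m≤m+n (suc r) (bound R))) (m≤n+m _ ε))
                 (Z≡count (r ∷ R) (suc c) ε (m≤n⇒m≤n+o _ ≤-refl) (m≤m+n ε _) (m≤n+m _ ε)) ⟨
  Z (r ∷ R) c (ε + suc r) + Z (r ∷ R) (suc c) ε ∎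
  where
  open ≡-Reasoning
  N = suc ε + suc r
  M = ε + bound (r ∷ R)
  agree : ∀ {i} → i ≢ r → member R i ≡ member (r ∷ R) i
  agree {i} i≢r = cases (i ∈? R)
    where
    cases : Dec (i ∈ R) → member R i ≡ member (r ∷ R) i
    cases (yes i∈R) = trans (dec-true (i ∈? R) i∈R) (sym (dec-true (i ∈? (r ∷ R)) (there i∈R)))
    cases (no  i∉R) = trans (dec-false (i ∈? R) i∉R)
      (sym (dec-false (i ∈? (r ∷ R)) λ { (here i≡r) → i≢r i≡r ; (there i∈R) → i∉R i∈R }))

Z-mono : ∀ R c ε → Z R (suc c) ε ≤ Z R (suc c) (suc ε)
Z-mono R c ε = ≤-trans
  (≤-reflexive (Z≡count R {M = suc ε + bound R} (suc c) ε ≤-refl (≤-trans (n≤1+n ε) (m≤m+n (suc ε) _)) (m≤n+m (bound R) (suc ε))))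
  (count-raise (member R) (suc ε) (suc ε + bound R) c ε)

-- Asymptotics

-- f = o(p)
record Small (f : ℕ → ℤ) : Set where
  constructor small
  field
    negligible : ∀ K → Eventually λ ℓ → K * ∣ f ℓ ∣ ≤ p ℓ

open Small

small-≤ : ∀ {f g} → Small g → (∀ ℓ → ∣ f ℓ ∣ ≤ ∣ g ℓ ∣) → Small f
negligible (small-≤ g-small f≤g) K = let (N , h) = negligible g-small K in
  N , λ ℓ ℓ≥ → ≤-trans (*-monoʳ-≤ K (f≤g ℓ)) (h ℓ ℓ≥)

small-cong : ∀ {f g} → Small g → (∀ ℓ → f ℓ ≡ g ℓ) → Small f
small-cong g-small f≡g = small-≤ g-small (≤-reflexive ∘ cong ∣_∣ ∘ f≡g)

small-0 : Small (λ _ → + 0)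
negligible small-0 K = 0 , λ ℓ _ → ≤-trans (≤-reflexive (*-zeroʳ K)) z≤n

small-+ : ∀ {f g} → Small f → Small g → Small (λ ℓ → f ℓ ℤ.+ g ℓ)
negligible (small-+ {f} {g} small-f small-g) K =
  let (M , hf) = negligible small-f (2 * K) ; (N , hg) = negligible small-g (2 * K) in
  M ⊔ N , λ ℓ ℓ≥ → *-cancelˡ-≤ 2 (begin
    2 * (K * ∣ f ℓ ℤ.+ g ℓ ∣)         ≤⟨ *-monoʳ-≤ 2 (*-monoʳ-≤ K (ℤ.∣i+j∣≤∣i∣+∣j∣ (f ℓ) (g ℓ))) ⟩
    2 * (K * (∣ f ℓ ∣ + ∣ g ℓ ∣))
      ≡⟨ solve 3 (λ K a b → con 2 :* (K :* (a :+ b)) := con 2 :* K :* a :+ con 2 :* K :* b) refl K ∣ f ℓ ∣ ∣ g ℓ ∣ ⟩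
    2 * K * ∣ f ℓ ∣ + 2 * K * ∣ g ℓ ∣
      ≤⟨ +-mono-≤ (hf ℓ (m⊔n≤o⇒m≤o M N ℓ≥)) (hg ℓ (m⊔n≤o⇒n≤o M N ℓ≥)) ⟩
    p ℓ + p ℓ                          ≡⟨ solve 1 (λ p → p :+ p := con 2 :* p) refl (p ℓ) ⟩
    2 * p ℓ                            ∎)
  where
  open ≤-Reasoning
  open +-*-Solver

small-neg : ∀ {f} → Small f → Small (λ ℓ → ℤ.- f ℓ)
small-neg {f} small-f = small-≤ small-f (λ ℓ → ≤-reflexive (ℤ.∣-i∣≡∣i∣ (f ℓ)))

small-- : ∀ {f g} → Small f → Small g → Small (λ ℓ → f ℓ ℤ.- g ℓ)
small-- small-f small-g = small-+ small-f (small-neg small-g)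

small-* : ∀ c {f} → Small f → Small (λ ℓ → c ℤ.* f ℓ)
negligible (small-* c {f} small-f) K = let (N , h) = negligible small-f (K * ∣ c ∣) in N , λ ℓ ℓ≥ → ≤-trans
  (≤-reflexive (trans (cong (K *_) (ℤ.abs-* c (f ℓ))) (sym (*-assoc K ∣ c ∣ ∣ f ℓ ∣)))) (h ℓ ℓ≥)

small-cancel : ∀ c .{{_ : NonZero ∣ c ∣}} {f} → Small (λ ℓ → c ℤ.* f ℓ) → Small f
small-cancel c {f} small-cf = small-≤ small-cf λ ℓ →
  ≤-trans (m≤n*m ∣ f ℓ ∣ ∣ c ∣) (≤-reflexive (sym (ℤ.abs-* c (f ℓ))))

-- By `p-slow 1`, p(ℓ+1) ≤ 2 p(ℓ) eventually, so a delay costs only a constant factor. The opposite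
-- direction, `small-advance`, rests on monotonicity of p.
small-delay : ∀ s {f} → Small f → Small (λ ℓ → f (ℓ + s))
small-delay zero    {f} small-f = small-cong small-f (cong f ∘ +-identityʳ)
small-delay (suc s) {f} small-f = small-cong (small-delay s delay₁) (λ ℓ → cong f (+-suc ℓ s))
  where
  open ≤-Reasoning
  delay₁ : Small (f ∘ suc)
  negligible delay₁ K = let (M , h) = negligible small-f (2 * K) ; (N , slow) = p-slow 1 in
    M ⊔ N , λ ℓ ℓ≥ → *-cancelˡ-≤ 2 (begin
      2 * (K * ∣ f (suc ℓ) ∣)   ≡⟨ *-assoc 2 K ∣ f (suc ℓ) ∣ ⟨
      2 * K * ∣ f (suc ℓ) ∣     ≤⟨ h (suc ℓ) (m≤n⇒m≤1+n (m⊔n≤o⇒m≤o M N ℓ≥)) ⟩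
      p (suc ℓ)                 ≤⟨ m≤n+m∸n (p (suc ℓ)) (p ℓ) ⟩
      p ℓ + (p (suc ℓ) ∸ p ℓ)   ≤⟨ +-monoʳ-≤ (p ℓ) (≤-trans (m≤m+n _ 0)
                                     (≤-trans (slow ℓ (m⊔n≤o⇒n≤o M N ℓ≥)) (m≤m+n (p ℓ) 0))) ⟩
      2 * p ℓ                   ∎)

small-advance : ∀ s {f} → Small (λ ℓ → f (ℓ + s)) → Small f
negligible (small-advance s {f} delayed) K = let (N , h) = negligible delayed K in N + s , λ ℓ ℓ≥ → begin
  K * ∣ f ℓ ∣               ≡⟨ cong (λ m → K * ∣ f m ∣) (m∸n+n≡m (m+n≤o⇒n≤o N ℓ≥)) ⟨
  K * ∣ f (ℓ ∸ s + s) ∣     ≤⟨ h (ℓ ∸ s) (m+n≤o⇒m≤o∸n N ℓ≥) ⟩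
  p (ℓ ∸ s)                 ≤⟨ p-mono (m∸n≤m ℓ s) ⟩
  p ℓ                       ∎
  where open ≤-Reasoning

small-increments : ∀ (f : ℕ → ℤ) → Small (λ ℓ → f (suc ℓ) ℤ.- f ℓ) → ∀ s → Small (λ ℓ → f (ℓ + s) ℤ.- f ℓ)
small-increments f small-f zero    = small-cong small-0
  (λ ℓ → trans (cong (λ m → f m ℤ.- f ℓ) (+-identityʳ ℓ)) (ℤ.+-inverseʳ (f ℓ)))
small-increments f small-f (suc s) = small-cong
  (small-+ (small-delay s small-f) (small-increments f small-f s))
  (λ ℓ → trans (cong (λ m → f m ℤ.- f ℓ) (+-suc ℓ s))
    (solve 3 (λ a b c → a :- c := (a :- b) :+ (b :- c)) refl (f (suc (ℓ + s))) (f (ℓ + s)) (f ℓ)))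
  where open ℤ.+-*-Solver

∣-∣-≤ : ∀ {m n} → m ≤ n → ∣ + n ℤ.- + m ∣ ≡ n ∸ m
∣-∣-≤ {m} {n} m≤n = cong ∣_∣ (trans (ℤ.m-n≡m⊖n n m) (ℤ.⊖-≥ m≤n))

p-increments : ∀ s → Small (λ ℓ → + p (ℓ + s) ℤ.- + p ℓ)
p-increments = small-increments (λ ℓ → + p ℓ) (small λ K → let (N , slow) = p-slow K in N , λ ℓ ℓ≥ →
  ≤-trans (≤-reflexive (cong (K *_) (∣-∣-≤ (p-mono (n≤1+n ℓ))))) (slow ℓ ℓ≥))

-- Charge c + 1, since Z R is monotone in the energy (Z-mono) only for positive charges.
z : List ℕ → ℕ → ℕ → ℤ
z R c ℓ = + Z R (suc c) ℓ

z-[]-asymptotic : ∀ c → Small (λ ℓ → z [] c ℓ ℤ.- + p ℓ)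
z-[]-asymptotic c = small-advance △ (small-cong
  (small-neg (p-increments △))
  (λ ℓ → trans (cong (λ m → + m ℤ.- + p (ℓ + △)) (Z-[] (suc c) ℓ))
    (solve 2 (λ a b → a :- b := :- (b :- a)) refl (+ p ℓ) (+ p (ℓ + △)))))
  where
  open ℤ.+-*-Solver
  △ = triangle (suc c)

z-increments : ∀ {R} → Unique R → ∀ c s → Small (λ ℓ → z R c (ℓ + s) ℤ.- z R c ℓ)
z-increments {R} R! c = small-increments (z R c) (go R! c)
  where
  go : ∀ {R} → Unique R → ∀ c → Small (λ ℓ → z R c (suc ℓ) ℤ.- z R c ℓ)
  go {[]} [] c = small-advance (triangle (suc c)) (small-cong
    (p-increments 1)
    (λ ℓ → cong₂ (λ m n → + m ℤ.- + n) (trans (Z-[] (suc c) (suc ℓ)) (cong p (+-comm 1 ℓ))) (Z-[] (suc c) ℓ)))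
  -- Both summands of Z-insert are nondecreasing, so their increments are bounded by that of the sum.
  go {r ∷ R} (r# ∷ R!) c = small-advance (suc r) (small-≤ (go R! (suc c))
    (λ ℓ → begin
      ∣ z (r ∷ R) c (suc (ℓ + suc r)) ℤ.- z (r ∷ R) c (ℓ + suc r) ∣
        ≡⟨ ∣-∣-≤ (Z-mono (r ∷ R) c (ℓ + suc r)) ⟩
      a′ ℓ ∸ a ℓ
        ≡⟨ [m+n]∸[m+o]≡n∸o (b ℓ) (a′ ℓ) (a ℓ) ⟨
      (b ℓ + a′ ℓ) ∸ (b ℓ + a ℓ)
        ≤⟨ ∸-mono (≤-trans (+-monoˡ-≤ (a′ ℓ) (Z-mono (r ∷ R) (suc c) ℓ)) (≤-reflexive (+-comm (b (suc ℓ)) (a′ ℓ))))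
                  (≤-reflexive (+-comm (a ℓ) (b ℓ))) ⟩
      (a′ ℓ + b (suc ℓ)) ∸ (a ℓ + b ℓ)
        ≡⟨ cong₂ _∸_ (Z-insert (All¬⇒¬Any r#) (suc c) (suc ℓ)) (Z-insert (All¬⇒¬Any r#) (suc c) ℓ) ⟨
      Z R (2 + c) (suc ℓ) ∸ Z R (2 + c) ℓ
        ≡⟨ ∣-∣-≤ (Z-mono R (suc c) ℓ) ⟨
      ∣ z R (suc c) (suc ℓ) ℤ.- z R (suc c) ℓ ∣ ∎))
    where
    open ≤-Reasoning
    a a′ b : ℕ → ℕ
    a  ℓ = Z (r ∷ R) (suc c) (ℓ + suc r)
    a′ ℓ = Z (r ∷ R) (suc c) (suc (ℓ + suc r))
    b  ℓ = Z (r ∷ R) (2 + c) ℓ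

z-insert : ∀ {r R} → Unique (r ∷ R) → ∀ c →
           Small (λ ℓ → z R (suc c) ℓ ℤ.- (z (r ∷ R) c ℓ ℤ.+ z (r ∷ R) (suc c) ℓ))
z-insert {r} {R} rR!@(r# ∷ _) c = small-cong
  (z-increments rR! c (suc r))
  (λ ℓ → trans (cong (λ m → + m ℤ.- (z (r ∷ R) c ℓ ℤ.+ z (r ∷ R) (suc c) ℓ)) (Z-insert (All¬⇒¬Any r#) (suc c) ℓ))
    (solve 3 (λ a b c → (a :+ c) :- (b :+ c) := a :- b) refl
      (z (r ∷ R) c (ℓ + suc r)) (z (r ∷ R) c ℓ) (z (r ∷ R) (suc c) ℓ)))
  where open ℤ.+-*-Solver

-- Dropping a prescribed mode can only increase the count, at the price of a higher charge, and
-- without prescribed modes the count is p up to o(p). The constant 2 is the same for all charges,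
-- and only the threshold depends on `c`; `d-small` relies on this.
Z-upper : ∀ {R} → Unique R → ∀ c → Eventually λ ℓ → Z R (suc c) ℓ ≤ 2 * p ℓ
Z-upper {[]} [] c = let (N , h) = negligible (z-[]-asymptotic c) 1 in N , λ ℓ ℓ≥ → begin
  Z [] (suc c) ℓ
    ≡⟨ cong ∣_∣ (solve 2 (λ z p → z := p :+ (z :- p)) refl (z [] c ℓ) (+ p ℓ)) ⟩
  ∣ + p ℓ ℤ.+ (z [] c ℓ ℤ.- + p ℓ) ∣
    ≤⟨ ℤ.∣i+j∣≤∣i∣+∣j∣ (+ p ℓ) (z [] c ℓ ℤ.- + p ℓ) ⟩
  p ℓ + ∣ z [] c ℓ ℤ.- + p ℓ ∣
    ≤⟨ +-monoʳ-≤ (p ℓ) (≤-trans (m≤m+n _ 0) (≤-trans (h ℓ ℓ≥) (m≤m+n (p ℓ) 0))) ⟩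
  2 * p ℓ ∎
  where
  open ≤-Reasoning
  open ℤ.+-*-Solver
Z-upper {r ∷ R} (r# ∷ R!) c = let (N , h) = Z-upper R! (suc c) in N , λ ℓ ℓ≥ → begin
  Z (r ∷ R) (suc c) ℓ                                       ≤⟨ later ℓ (suc r) ⟩
  Z (r ∷ R) (suc c) (ℓ + suc r)                             ≤⟨ m≤m+n _ _ ⟩
  Z (r ∷ R) (suc c) (ℓ + suc r) + Z (r ∷ R) (2 + c) ℓ        ≡⟨ Z-insert (All¬⇒¬Any r#) (suc c) ℓ ⟨
  Z R (2 + c) ℓ                                             ≤⟨ h ℓ ℓ≥ ⟩
  2 * p ℓ                                                   ∎
  where
  open ≤-Reasoning
  later : ∀ ℓ s → Z (r ∷ R) (suc c) ℓ ≤ Z (r ∷ R) (suc c) (ℓ + s)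
  later ℓ zero    = ≤-reflexive (cong (Z (r ∷ R) (suc c)) (sym (+-identityʳ ℓ)))
  later ℓ (suc s) = ≤-trans (later ℓ s) (≤-trans (Z-mono (r ∷ R) c (ℓ + s))
    (≤-reflexive (cong (Z (r ∷ R) (suc c)) (sym (+-suc ℓ s)))))

-- Asymptotically, u(c) + u(c+1) does not depend on c, so u(c+2) - u(c+1) = d only depends on
-- the parity of c. As u = v(c) + v(c+1), the sequence v grows by d over every second step, and
-- d vanishes because v is bounded.
module _ {R r r′} (rrR! : Unique (r′ ∷ r ∷ R)) (N : ℕ) .{{_ : NonZero N}}
         (equi : ∀ c → Small (λ ℓ → + N ℤ.* z R c ℓ ℤ.- + p ℓ)) where

  open ℤ.+-*-Solver

  private
    rR! : Unique (r ∷ R)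
    rR! = unique-tail rrR!

    u v d : ℕ → ℕ → ℤ
    u = z (r ∷ R)
    v = z (r′ ∷ r ∷ R)
    d c ℓ = u (2 + c) ℓ ℤ.- u (1 + c) ℓ

    period : ∀ c → Small (λ ℓ → u (2 + c) ℓ ℤ.- u c ℓ)
    period c = small-cancel (+ N) (small-cong
      (small-+ (small-* (+ N) (small-- (z-insert rR! c) (z-insert rR! (suc c))))
               (small-- (equi (2 + c)) (equi (1 + c))))
      (λ ℓ → solve 7 (λ N u₀ u₁ u₂ z₁ z₂ p → N :* (u₂ :- u₀) :=
               N :* ((z₁ :- (u₀ :+ u₁)) :- (z₂ :- (u₁ :+ u₂))) :+ ((N :* z₂ :- p) :- (N :* z₁ :- p)))
               refl (+ N) (u c ℓ) (u (1 + c) ℓ) (u (2 + c) ℓ) (z R (1 + c) ℓ) (z R (2 + c) ℓ) (+ p ℓ)))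

    d-period : ∀ k c → Small (λ ℓ → d (k * 2 + c) ℓ ℤ.- d c ℓ)
    d-period zero    c = small-cong small-0 (λ ℓ → ℤ.+-inverseʳ (d c ℓ))
    d-period (suc k) c = small-cong
      (small-+ (small-- (period (2 + k * 2 + c)) (period (1 + k * 2 + c))) (d-period k c))
      (λ ℓ → solve 6 (λ u₁ u₂ u₃ u₄ a b → (u₄ :- u₃) :- (a :- b) :=
               ((u₄ :- u₂) :- (u₃ :- u₁)) :+ ((u₂ :- u₁) :- (a :- b))) refl
               (u (1 + k * 2 + c) ℓ) (u (2 + k * 2 + c) ℓ) (u (3 + k * 2 + c) ℓ) (u (4 + k * 2 + c) ℓ)
               (u (2 + c) ℓ) (u (1 + c) ℓ))

    v-step : ∀ c → Small (λ ℓ → (v (2 + c) ℓ ℤ.- v c ℓ) ℤ.- d c ℓ)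
    v-step c = small-cong
      (small-- (z-insert rrR! c) (z-insert rrR! (suc c)))
      (λ ℓ → solve 5 (λ v₀ v₁ v₂ u₁ u₂ → (v₂ :- v₀) :- (u₂ :- u₁) :=
               (u₁ :- (v₀ :+ v₁)) :- (u₂ :- (v₁ :+ v₂))) refl
               (v c ℓ) (v (1 + c) ℓ) (v (2 + c) ℓ) (u (1 + c) ℓ) (u (2 + c) ℓ))

    v-growth : ∀ k c → Small (λ ℓ → (v (k * 2 + c) ℓ ℤ.- v c ℓ) ℤ.- + k ℤ.* d c ℓ)
    v-growth zero    c = small-cong
      small-0 (λ ℓ → trans (cong₂ ℤ._-_ (ℤ.+-inverseʳ (v c ℓ)) (ℤ.*-zeroˡ (d c ℓ))) refl)
    v-growth (suc k) c = small-cong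
      (small-+ (v-step (k * 2 + c)) (small-+ (d-period k c) (v-growth k c)))
      (λ ℓ → trans (cong (λ y → (v (2 + k * 2 + c) ℓ ℤ.- v c ℓ) ℤ.- y) (ℤ.suc-* (+ k) (d c ℓ)))
        (solve 6 (λ v₂ v₁ v₀ k d d′ → (v₂ :- v₀) :- (d :+ k :* d) :=
                   ((v₂ :- v₁) :- d′) :+ ((d′ :- d) :+ ((v₁ :- v₀) :- k :* d))) refl
                   (v (2 + k * 2 + c) ℓ) (v (k * 2 + c) ℓ) (v c ℓ) (+ k) (d c ℓ) (d (k * 2 + c) ℓ)))

    d-small : ∀ c → Small (d c)
    negligible (d-small c) K =
      -- Eventually k |d| ≤ 2p + 2p + p, from the two values of `v` and the error `e`. This is 5p,
      -- so k = 5K leaves K |d| ≤ p.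
      let k = 5 * K
          (N₀ , h₀) = negligible (v-growth k c) 1
          (N₁ , h₁) = Z-upper rrR! (k * 2 + c)
          (N₂ , h₂) = Z-upper rrR! c
      in N₀ ⊔ (N₁ ⊔ N₂) , λ ℓ ℓ≥ →
        let ℓ≥′ = m⊔n≤o⇒n≤o N₀ (N₁ ⊔ N₂) ℓ≥
            e = (v (k * 2 + c) ℓ ℤ.- v c ℓ) ℤ.- + k ℤ.* d c ℓ
        in *-cancelˡ-≤ 5 (begin
          5 * (K * ∣ d c ℓ ∣)
            ≡⟨ *-assoc 5 K ∣ d c ℓ ∣ ⟨
          k * ∣ d c ℓ ∣
            ≡⟨ ℤ.abs-* (+ k) (d c ℓ) ⟨
          ∣ + k ℤ.* d c ℓ ∣
            ≡⟨ cong ∣_∣ (solve 3 (λ w w′ kd → kd := (w :- w′) :- ((w :- w′) :- kd)) refl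
                 (v (k * 2 + c) ℓ) (v c ℓ) (+ k ℤ.* d c ℓ)) ⟩
          ∣ (v (k * 2 + c) ℓ ℤ.- v c ℓ) ℤ.- e ∣
            ≤⟨ ℤ.∣i-j∣≤∣i∣+∣j∣ (v (k * 2 + c) ℓ ℤ.- v c ℓ) e ⟩
          ∣ v (k * 2 + c) ℓ ℤ.- v c ℓ ∣ + ∣ e ∣
            ≤⟨ +-mono-≤ (ℤ.∣i-j∣≤∣i∣+∣j∣ (v (k * 2 + c) ℓ) (v c ℓ))
                        (≤-trans (m≤m+n ∣ e ∣ 0) (h₀ ℓ (m⊔n≤o⇒m≤o N₀ (N₁ ⊔ N₂) ℓ≥))) ⟩
          (∣ v (k * 2 + c) ℓ ∣ + ∣ v c ℓ ∣) + p ℓ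
            ≤⟨ +-monoˡ-≤ (p ℓ) (+-mono-≤ (h₁ ℓ (m⊔n≤o⇒m≤o N₁ N₂ ℓ≥′)) (h₂ ℓ (m⊔n≤o⇒n≤o N₁ N₂ ℓ≥′))) ⟩
          (2 * p ℓ + 2 * p ℓ) + p ℓ
            ≡⟨ ℕ-solve 1 (λ p → (ℕ-con 2 ℕ:* p ℕ:+ ℕ-con 2 ℕ:* p) ℕ:+ p ℕ:= ℕ-con 5 ℕ:* p) refl (p ℓ) ⟩
          5 * p ℓ ∎)
      where
      open ≤-Reasoning
      open +-*-Solver using () renaming
        (solve to ℕ-solve; con to ℕ-con; _:*_ to infixl 7 _ℕ:*_; _:+_ to infixl 6 _ℕ:+_; _:=_ to infix 4 _ℕ:=_)

  equidistributed-insert : ∀ c → Small (λ ℓ → + (2 * N) ℤ.* z (r ∷ R) c ℓ ℤ.- + p ℓ)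
  equidistributed-insert c = small-cong
    -- `d` minus the period difference is u(c) - u(c+1); subtracting z(c+1) - (u(c) + u(c+1)) leaves
    -- 2 u(c) - z(c+1).
    (small-+ (small-* (+ N) (small-- (small-- (d-small c) (period c)) (z-insert rR! c))) (equi (1 + c)))
    (λ ℓ → trans (cong (λ y → y ℤ.* u c ℓ ℤ.- + p ℓ) (ℤ.pos-* 2 N))
      (solve 6 (λ N u₀ u₁ u₂ z₁ p → con (+ 2) :* N :* u₀ :- p :=
                N :* (((u₂ :- u₁) :- (u₂ :- u₀)) :- (z₁ :- (u₀ :+ u₁))) :+ (N :* z₁ :- p)) refl
                (+ N) (u c ℓ) (u (1 + c) ℓ) (u (2 + c) ℓ) (z R (1 + c) ℓ) (+ p ℓ)))

fresh : ∀ {R} → Unique R → Unique (bound R ∷ R)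
fresh {R} R! = ¬Any⇒All¬ R (λ b∈R → <-irrefl refl (∈⇒<bound b∈R)) ∷ R!

equidistributed⁺ : ∀ {R} → Unique R → ∀ c → Small (λ ℓ → + (2 ^ length R) ℤ.* z R c ℓ ℤ.- + p ℓ)
equidistributed⁺ {[]}    []             c = small-cong
  (z-[]-asymptotic c) (λ ℓ → cong (ℤ._- + p ℓ) (ℤ.*-identityˡ (z [] c ℓ)))
-- The auxiliary mode r′ is `bound (r ∷ R)`, which exceeds every prescribed mode.
equidistributed⁺ {r ∷ R} rR!@(_ ∷ R!) = equidistributed-insert (fresh rR!) (2 ^ length R)
  {{m^n≢0 2 (length R)}} (equidistributed⁺ R!)

-- With n = |R| + 1, charge 0 is obtained by releasing `r`: the count is Z_R - Z_{R∪r} at charge 1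
-- up to a shift of the energy, and 1/2^(n-1) - 1/2^n = 1/2^n. The nonempty list supplies this `r`.
equidistributed : ∀ {r R} → Unique (r ∷ R) →
  Small (λ ℓ → + (2 ^ length (r ∷ R)) ℤ.* + Z (r ∷ R) 0 ℓ ℤ.- + p ℓ)
equidistributed {r} {R} rR!@(r# ∷ R!) = small-advance (suc r) (small-cong
  (small-- (small-* (+ 2) (equidistributed⁺ R! 0))
    (small-+ (small-cong (equidistributed⁺ rR! 0)
                         (λ ℓ → cong (λ y → y ℤ.* z (r ∷ R) 0 ℓ ℤ.- + p ℓ) (sym (ℤ.pos-* 2 (2 ^ length R)))))
             (p-increments (suc r))))
  (λ ℓ → trans (cong₂ (λ a b → a ℤ.* b ℤ.- + p (ℓ + suc r)) (ℤ.pos-* 2 (2 ^ length R)) (removed ℓ))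
    (solve 5 (λ N z u p q → con (+ 2) :* N :* (z :- u) :- q :=
       con (+ 2) :* (N :* z :- p) :- ((con (+ 2) :* N :* u :- p) :+ (q :- p))) refl
       (+ (2 ^ length R)) (z R 0 ℓ) (z (r ∷ R) 0 ℓ) (+ p ℓ) (+ p (ℓ + suc r)))))
  where
  open ℤ.+-*-Solver
  removed : ∀ ℓ → + Z (r ∷ R) 0 (ℓ + suc r) ≡ z R 0 ℓ ℤ.- z (r ∷ R) 0 ℓ
  removed ℓ = trans
    (solve 2 (λ a b → a := (a :+ b) :- b) refl (+ Z (r ∷ R) 0 (ℓ + suc r)) (z (r ∷ R) 0 ℓ))
    (cong (λ m → + m ℤ.- z (r ∷ R) 0 ℓ) (sym (Z-insert (All¬⇒¬Any r#) 0 ℓ)))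

-- Number operators on Fock space

module _ {m ℓm} (𝓕 : FockSpace m ℓm) where

  open FockSpace 𝓕
  private
    module ℂᴿ = CommutativeRing ℂ-commutativeRing
  open import Algebra.Properties.Ring ℂᴿ.ring using (+-inverseʳ-unique; -‿involutive)
  open import Algebra.Module.Properties.LeftModule space using (inverseˡ-uniqueᴹ; -ᴹ-involutive)
  open import Relation.Binary.Reasoning.Setoid ≈ᴹ-setoid
  open LeftModuleMorphisms rawLeftModule rawLeftModule using (module IsLeftModuleHomomorphism)
  module ψ-hom k  = IsLeftModuleHomomorphism (ψ-linear k)
  module ψ*-hom k = IsLeftModuleHomomorphism (ψ*-linear k)

  -- For k ≥ 0 the product is normally ordered: `ψ (+ k)` kills the vacuum, and on a monomial it
  -- removes the factor `ψ* -[1+ k ]`, which is then put back.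
  number : ℕ → Carrierᴹ → Carrierᴹ
  number k v = ψ* -[1+ k ] (ψ (+ k) v)

  number-cong : ∀ k {v w} → v ≈ᴹ w → number k v ≈ᴹ number k w
  number-cong k = ψ*-hom.⟦⟧-cong -[1+ k ] ∘ ψ-hom.⟦⟧-cong (+ k)

  number-0 : ∀ k → number k 0ᴹ ≈ᴹ 0ᴹ
  number-0 k = ≈ᴹ-trans (ψ*-hom.⟦⟧-cong -[1+ k ] (ψ-hom.0ᴹ-homo (+ k))) (ψ*-hom.0ᴹ-homo -[1+ k ])

  A≡number : ∀ k v → A (+ k) v ≡ number k v
  A≡number k v = cong₂ (λ i j → ψ* i (ψ j v)) (lower k)
    (cong (λ i → ℤ.- i ℤ.- + 1) (lower k))
    where
    lower : ∀ k → ℤ.- (+ k) ℤ.- + 1 ≡ -[1+ k ]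
    lower zero    = refl
    lower (suc k) = cong (-[1+_] ∘ suc) (+-identityʳ k)

  anticommute : ∀ {v w} → v +ᴹ w ≈ᴹ 0ᴹ → v ≈ᴹ -ᴹ w
  anticommute {v} {w} = inverseˡ-uniqueᴹ v w

  number-ψ : ∀ k n v → number k (ψ -[1+ n ] v) ≈ᴹ ψ -[1+ n ] (number k v)
  number-ψ k n v = begin
    ψ* -[1+ k ] (ψ (+ k) (ψ -[1+ n ] v))
      ≈⟨ ψ*-hom.⟦⟧-cong -[1+ k ] (anticommute ([ψ,ψ]₊ (+ k) -[1+ n ] v)) ⟩
    ψ* -[1+ k ] (-ᴹ ψ -[1+ n ] (ψ (+ k) v))
      ≈⟨ ψ*-hom.-ᴹ-homo -[1+ k ] _ ⟩
    -ᴹ ψ* -[1+ k ] (ψ -[1+ n ] (ψ (+ k) v))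
      -- Two negative indices plus 1 stay negative, so `δ₀` evaluates to 0. The two signs collected
      -- by moving past `ψ -[1+ n ]` cancel.
      ≈⟨ -ᴹ‿cong (anticommute (≈ᴹ-trans ([ψ*,ψ]₊ -[1+ k ] -[1+ n ] (ψ (+ k) v)) (*ₗ-zeroˡ _))) ⟩
    -ᴹ (-ᴹ ψ -[1+ n ] (number k v))
      ≈⟨ -ᴹ-involutive _ ⟩
    ψ -[1+ n ] (number k v) ∎

  mode-sum : ∀ k m → -[1+ m ] ℤ.+ + k ℤ.+ + 1 ≡ + k ℤ.- + m
  mode-sum k m = trans (cong (λ i → i ℤ.+ + k ℤ.+ + 1) (cong ℤ.-_ (ℤ.pos-+ 1 m)))
    (solve 2 (λ k m → :- (con (+ 1) :+ m) :+ k :+ con (+ 1) := k :- m) refl (+ k) (+ m))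
    where open ℤ.+-*-Solver

  number-ψ*-≢ : ∀ {k m} → k ≢ m → ∀ v → number k (ψ* -[1+ m ] v) ≈ᴹ ψ* -[1+ m ] (number k v)
  number-ψ*-≢ {k} {m} k≢m v = begin
    ψ* -[1+ k ] (ψ (+ k) (ψ* -[1+ m ] v))
      ≈⟨ ψ*-hom.⟦⟧-cong -[1+ k ] (anticommute (≈ᴹ-trans (+ᴹ-comm _ _)
           (≈ᴹ-trans ([ψ*,ψ]₊ -[1+ m ] (+ k) v) (≈ᴹ-trans (*ₗ-congʳ δ≈0) (*ₗ-zeroˡ v))))) ⟩
    ψ* -[1+ k ] (-ᴹ ψ* -[1+ m ] (ψ (+ k) v))
      ≈⟨ ψ*-hom.-ᴹ-homo -[1+ k ] _ ⟩
    -ᴹ ψ* -[1+ k ] (ψ* -[1+ m ] (ψ (+ k) v))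
      ≈⟨ -ᴹ‿cong (anticommute ([ψ*,ψ*]₊ -[1+ k ] -[1+ m ] (ψ (+ k) v))) ⟩
    -ᴹ (-ᴹ ψ* -[1+ m ] (number k v))
      ≈⟨ -ᴹ-involutive _ ⟩
    ψ* -[1+ m ] (number k v) ∎
    where
    i = -[1+ m ] ℤ.+ + k ℤ.+ + 1
    δ≈0 : δ₀ i ≈ℂ 0ℂ
    δ≈0 = ℂᴿ.reflexive (cong (if_then 1ℂ else 0ℂ)
      (dec-false (i ℤ.≟ + 0) λ i≡0 → k≢m (ℤ.+-injective (ℤ.i-j≡0⇒i≡j (+ k) (+ m)
        (trans (sym (mode-sum k m)) i≡0)))))

  -- The anticommutator being 1, ψψ* v = v - ψ*ψ v, and the last term vanishes when the mode is not
  -- yet occupied.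
  number-ψ*-≡ : ∀ k v → number k v ≈ᴹ 0ᴹ → number k (ψ* -[1+ k ] v) ≈ᴹ ψ* -[1+ k ] v
  number-ψ*-≡ k v empty = ψ*-hom.⟦⟧-cong -[1+ k ] (begin
    ψ (+ k) (ψ* -[1+ k ] v)                       ≈⟨ +ᴹ-identityˡ _ ⟨
    0ᴹ +ᴹ ψ (+ k) (ψ* -[1+ k ] v)                 ≈⟨ +ᴹ-congʳ empty ⟨
    number k v +ᴹ ψ (+ k) (ψ* -[1+ k ] v)         ≈⟨ [ψ*,ψ]₊ -[1+ k ] (+ k) v ⟩
    δ₀ i *ₗ v                                     ≈⟨ *ₗ-congʳ δ≈1 ⟩
    1ℂ *ₗ v                                       ≈⟨ *ₗ-identityˡ v ⟩
    v                                             ∎)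
    where
    i = -[1+ k ] ℤ.+ + k ℤ.+ + 1
    δ≈1 : δ₀ i ≈ℂ 1ℂ
    δ≈1 = ℂᴿ.reflexive (cong (if_then 1ℂ else 0ℂ)
      (dec-true (i ℤ.≟ + 0) (trans (mode-sum k k) (ℤ.+-inverseʳ (+ k)))))

  ⟦_⟧* : List ℕ → Carrierᴹ
  ⟦_⟧* = foldr (λ m → ψ* -[1+ m ]) 𝟏

  number-∉* : ∀ {k ms} → k ∉ ms → number k ⟦ ms ⟧* ≈ᴹ 0ᴹ
  number-∉* {k} {[]}     _    = ≈ᴹ-trans (ψ*-hom.⟦⟧-cong -[1+ k ] (ψ-𝟏 k)) (ψ*-hom.0ᴹ-homo -[1+ k ])
  number-∉* {k} {m ∷ ms} k∉   = ≈ᴹ-trans (number-ψ*-≢ (k∉ ∘ here) ⟦ ms ⟧*)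
    (≈ᴹ-trans (ψ*-hom.⟦⟧-cong -[1+ m ] (number-∉* (k∉ ∘ there))) (ψ*-hom.0ᴹ-homo -[1+ m ]))

  number-∈* : ∀ {k ms} → Decreasing ms → k ∈ ms → number k ⟦ ms ⟧* ≈ᴹ ⟦ ms ⟧*
  number-∈* {k} {m ∷ ms} (m> ∷ _)   (here refl) = number-ψ*-≡ k ⟦ ms ⟧*
    (number-∉* λ k∈ms → <-irrefl refl (All.lookup m> k∈ms))
  number-∈* {k} {m ∷ ms} (m> ∷ ms↓) (there k∈ms)  = ≈ᴹ-trans
    (number-ψ*-≢ (λ k≡m → <-irrefl k≡m (All.lookup m> k∈ms)) ⟦ ms ⟧*)
    (ψ*-hom.⟦⟧-cong -[1+ m ] (number-∈* ms↓ k∈ms))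

  number-ψs : ∀ k ns {v w} → number k v ≈ᴹ w →
              number k (foldr (λ n → ψ -[1+ n ]) v ns) ≈ᴹ foldr (λ n → ψ -[1+ n ]) w ns
  number-ψs k []       v≈w = v≈w
  number-ψs k (n ∷ ns) v≈w = ≈ᴹ-trans (number-ψ k n _) (ψ-hom.⟦⟧-cong -[1+ n ] (number-ψs k ns v≈w))

  ψs-0 : ∀ ns → foldr (λ n → ψ -[1+ n ]) 0ᴹ ns ≈ᴹ 0ᴹ
  ψs-0 []       = ≈ᴹ-refl
  ψs-0 (n ∷ ns) = ≈ᴹ-trans (ψ-hom.⟦⟧-cong -[1+ n ] (ψs-0 ns)) (ψ-hom.0ᴹ-homo -[1+ n ])

  number-∈ : ∀ {k} μ → k ∈ ms μ → number k ⟦ μ ⟧ ≈ᴹ ⟦ μ ⟧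
  number-∈ {k} μ k∈ms = number-ψs k (ns μ) (number-∈* (ms↓ μ) k∈ms)

  number-∉ : ∀ {k} μ → k ∉ ms μ → number k ⟦ μ ⟧ ≈ᴹ 0ᴹ
  number-∉ {k} μ k∉ms = ≈ᴹ-trans (number-ψs k (ns μ) (number-∉* k∉ms)) (ψs-0 (ns μ))

  As : ∀ {n} → Vec ℤ n → Carrierᴹ → Carrierᴹ
  As = Vec.foldr′ (λ k X → A k ∘ X) id

  A-cong : ∀ k {v w} → v ≈ᴹ w → A (+ k) v ≈ᴹ number k w
  A-cong k {v} v≈w = ≈ᴹ-trans (≈ᴹ-reflexive (A≡number k v)) (number-cong k v≈w)

  As-⊆ : ∀ {n} (r : Vec ℕ n) μ → All (_∈ ms μ) (toList r) → As (map +_ r) ⟦ μ ⟧ ≈ᴹ ⟦ μ ⟧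
  As-⊆ []      μ []         = ≈ᴹ-refl
  As-⊆ (k ∷ r) μ (k∈ ∷ r⊆) = ≈ᴹ-trans (A-cong k (As-⊆ r μ r⊆)) (number-∈ μ k∈)

  As-⊈ : ∀ {n} (r : Vec ℕ n) μ → ¬ All (_∈ ms μ) (toList r) → As (map +_ r) ⟦ μ ⟧ ≈ᴹ 0ᴹ
  As-⊈ []      μ r⊈ = contradiction [] r⊈
  As-⊈ (k ∷ r) μ r⊈ with All.all? (_∈? ms μ) (toList r)
  ... | no  r⊈′ = ≈ᴹ-trans (A-cong k (As-⊈ r μ r⊈′)) (number-0 k)
  ... | yes r⊆  = ≈ᴹ-trans (A-cong k (As-⊆ r μ r⊆)) (number-∉ μ (λ k∈ → r⊈ (k∈ ∷ r⊆)))

  open Bases space using (combination; coefficient)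

  coordinate-0 : ∀ {v} μ → v ≈ᴹ 0ᴹ → coordinate μ v ≈ℂ 0ℂ
  coordinate-0 {v} μ v≈0 = let (xs , v≈xs) = spans v in
    independent xs (≈ᴹ-trans (≈ᴹ-sym v≈xs) v≈0) μ

  -- `coordinate` reads the expansion chosen for `v`. Prepending -1 times `μ` to it gives an
  -- expansion of zero, and independence then forces -1 + `coordinate μ v` ≈ 0.
  coordinate-1 : ∀ {v} μ → v ≈ᴹ ⟦ μ ⟧ → coordinate μ v ≈ℂ 1ℂ
  coordinate-1 {v} μ v≈μ = ℂᴿ.trans (+-inverseʳ-unique (-ℂ 1ℂ) _ (ℂᴿ.trans
    (ℂᴿ.reflexive (sym (cong
      (λ b → if b then -ℂ 1ℂ +ℂ coordinate μ v else coordinate μ v) (dec-true (μ ≟ᴹ μ) refl))))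
    (independent ((-ℂ 1ℂ , μ) ∷ xs) vanishes μ))) (-‿involutive 1ℂ)
    where
    xs = proj₁ (spans v)
    vanishes : -ℂ 1ℂ *ₗ ⟦ μ ⟧ +ᴹ combination ⟦_⟧ xs ≈ᴹ 0ᴹ
    vanishes = begin
      -ℂ 1ℂ *ₗ ⟦ μ ⟧ +ᴹ combination ⟦_⟧ xs   ≈⟨ +ᴹ-congˡ (≈ᴹ-trans (≈ᴹ-sym (proj₂ (spans v))) v≈μ) ⟩
      -ℂ 1ℂ *ₗ ⟦ μ ⟧ +ᴹ ⟦ μ ⟧                ≈⟨ +ᴹ-congˡ (*ₗ-identityˡ ⟦ μ ⟧) ⟨
      -ℂ 1ℂ *ₗ ⟦ μ ⟧ +ᴹ 1ℂ *ₗ ⟦ μ ⟧          ≈⟨ *ₗ-distribʳ ⟦ μ ⟧ (-ℂ 1ℂ) 1ℂ ⟨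
      (-ℂ 1ℂ +ℂ 1ℂ) *ₗ ⟦ μ ⟧                  ≈⟨ *ₗ-congʳ (ℂᴿ.-‿inverseˡ 1ℂ) ⟩
      0ℂ *ₗ ⟦ μ ⟧                           ≈⟨ *ₗ-zeroˡ ⟦ μ ⟧ ⟩
      0ᴹ                                    ∎

  coordinate-As : ∀ {n} (r : Vec ℕ n) μ → coordinate μ (As (map +_ r) ⟦ μ ⟧) ≈ℂ
                  (if does (All.all? (_∈? ms μ) (toList r)) then 1ℂ else 0ℂ)
  coordinate-As r μ with All.all? (_∈? ms μ) (toList r)
  ... | yes r⊆ = coordinate-1 μ (As-⊆ r μ r⊆)
  ... | no  r⊈ = coordinate-0 μ (As-⊈ r μ r⊈)

-- The trace as a counting function

module _ where
  private
    module ℂᴿ = CommutativeRing ℂ-commutativeRing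
  open import Algebra.Properties.Ring ℂᴿ.ring using (+-cancelʳ)
  open import Relation.Binary.Reasoning.Setoid ℂ-setoid

  sum-applyUpTo-cong : ∀ {f g : ℕ → ℂ} B (j : ℕ → ℕ) → (∀ {i} → i < B → f (j i) ≈ℂ g (j i)) →
                       sum (List.map f (applyUpTo j B)) ≈ℂ sum (List.map g (applyUpTo j B))
  sum-applyUpTo-cong zero    j f≈g = ℂᴿ.refl
  sum-applyUpTo-cong (suc B) j f≈g = ℂᴿ.+-cong (f≈g (s≤s z≤n)) (sum-applyUpTo-cong B (j ∘ suc) (f≈g ∘ s≤s))

  -- In degree ℓ all terms but `f 0 *ℂ g ℓ` involve lower coefficients, already known to agree.
  -- Applied to `qq∞`, this identifies `b` with the trace.
  ⊛-cancelˡ : ∀ {f g h} → f 0 ≈ℂ 1ℂ → (∀ ℓ → (f ⊛ g) ℓ ≈ℂ (f ⊛ h) ℓ) → ∀ ℓ → g ℓ ≈ℂ h ℓ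
  ⊛-cancelˡ {f} {g} {h} f₀≈1 fg≈fh ℓ = go (suc ℓ) ≤-refl
    where
    go : ∀ B {ℓ} → ℓ < B → g ℓ ≈ℂ h ℓ
    go (suc B) {ℓ} ℓ<B = begin
      g ℓ             ≈⟨ ℂᴿ.*-identityˡ (g ℓ) ⟨
      1ℂ *ℂ g ℓ       ≈⟨ ℂᴿ.*-congʳ f₀≈1 ⟨
      f 0 *ℂ g ℓ      ≈⟨ +-cancelʳ (rest h) _ _ (begin
        f 0 *ℂ g ℓ +ℂ rest h   ≈⟨ ℂᴿ.+-congˡ (sum-applyUpTo-cong ℓ suc λ {i} i<ℓ → ℂᴿ.*-congˡ
                                    (go B (<-≤-trans (∸-monoʳ-< {o = 0} ℕ.z<s i<ℓ) (ℕ.s≤s⁻¹ ℓ<B)))) ⟨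
        f 0 *ℂ g ℓ +ℂ rest g   ≈⟨ fg≈fh ℓ ⟩
        f 0 *ℂ h ℓ +ℂ rest h   ∎) ⟩
      f 0 *ℂ h ℓ      ≈⟨ ℂᴿ.*-congʳ f₀≈1 ⟩
      1ℂ *ℂ h ℓ       ≈⟨ ℂᴿ.*-identityˡ (h ℓ) ⟩
      h ℓ             ∎
      where
      rest : (ℕ → ℂ) → ℂ
      rest g = sum (List.map (λ i → f i *ℂ g (ℓ ∸ i)) (applyUpTo suc ℓ))

-- Enumerated monomials as sums over subsets

iverson : ∀ {a} {A : Set a} → Dec A → ℕ
iverson a? = if does a? then 1 else 0

iverson-yes : ∀ {a} {A : Set a} (a? : Dec A) → A → iverson a? ≡ 1
iverson-yes a? a = cong (if_then 1 else 0) (dec-true a? a)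

iverson-no : ∀ {a} {A : Set a} (a? : Dec A) → ¬ A → iverson a? ≡ 0
iverson-no a? ¬a = cong (if_then 1 else 0) (dec-false a? ¬a)

sum-filter : ∀ {A : Set} {P : A → Set} (P? : Decidable P) (f : A → ℕ) xs →
             ℕ.sum (List.map f (filter P? xs)) ≡ ℕ.sum (List.map (λ x → iverson (P? x) * f x) xs)
sum-filter P? f []       = refl
sum-filter P? f (x ∷ xs) with does (P? x)
... | true  = cong₂ _+_ (sym (*-identityˡ (f x))) (sum-filter P? f xs)
... | false = sum-filter P? f xs

sum-cartesianProductWith : ∀ {A B C : Set} (g : A → B → C) (f : C → ℕ) xs ys →
  ℕ.sum (List.map f (cartesianProductWith g xs ys)) ≡ ℕ.sum (List.map (λ x → ℕ.sum (List.map (f ∘ g x) ys)) xs)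
sum-cartesianProductWith g f []       ys = refl
sum-cartesianProductWith g f (x ∷ xs) ys = begin
  ℕ.sum (List.map f (List.map (g x) ys ++ cartesianProductWith g xs ys))
    ≡⟨ cong ℕ.sum (map-++ f (List.map (g x) ys) _) ⟩
  ℕ.sum (List.map f (List.map (g x) ys) ++ List.map f (cartesianProductWith g xs ys))
    ≡⟨ sum-++ (List.map f (List.map (g x) ys)) _ ⟩
  ℕ.sum (List.map f (List.map (g x) ys)) + ℕ.sum (List.map f (cartesianProductWith g xs ys))
    ≡⟨ cong₂ _+_ (cong ℕ.sum (sym (map-∘ ys))) (sum-cartesianProductWith g f xs ys) ⟩
  ℕ.sum (List.map (f ∘ g x) ys) + ℕ.sum (List.map (λ x → ℕ.sum (List.map (f ∘ g x) ys)) xs) ∎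
  where open ≡-Reasoning

-- The indicator that every i < M with `χ i` lies in `ys`, as a product whose top factor splits off
-- in step with `decreasingBelow` and `sumSubsets`.
covers : (ℕ → Bool) → ℕ → List ℕ → ℕ
covers χ zero    ys = 1
covers χ (suc M) ys = (if χ M then iverson (M ∈? ys) else 1) * covers χ M ys

covers-∷ : ∀ χ M y {ys} → M ≤ y → covers χ M (y ∷ ys) ≡ covers χ M ys
covers-∷ χ zero    y M≤y = refl
covers-∷ χ (suc M) y {ys} M<y = cong₂ (λ a b → (if χ M then a else 1) * b)
  (same (M ∈? ys)) (covers-∷ χ M y (<⇒≤ M<y))
  where
  same : Dec (M ∈ ys) → iverson (M ∈? (y ∷ ys)) ≡ iverson (M ∈? ys)
  same (yes M∈) = trans (iverson-yes (M ∈? (y ∷ ys)) (there M∈)) (sym (iverson-yes (M ∈? ys) M∈))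
  same (no  M∉) = trans (iverson-no (M ∈? (y ∷ ys)) λ { (here M≡y) → <⇒≢ M<y M≡y ; (there M∈) → M∉ M∈ })
                        (sym (iverson-no (M ∈? ys) M∉))

sum-map-decreasingBelow : ∀ M (g : List ℕ → ℕ) →
  ℕ.sum (List.map (g ∘ proj₁) (decreasingBelow (suc M))) ≡
  ℕ.sum (List.map (g ∘ (M ∷_) ∘ proj₁) (decreasingBelow M)) + ℕ.sum (List.map (g ∘ proj₁) (decreasingBelow M))
sum-map-decreasingBelow M g = trans (cong ℕ.sum (map-++ (g ∘ proj₁) (List.map _ D) (List.map _ D)))
  (trans (sum-++ (List.map (g ∘ proj₁) (List.map _ D)) _)
         (cong₂ (λ a b → ℕ.sum a + ℕ.sum b) (sym (map-∘ D)) (sym (map-∘ D))))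
  where
  D = decreasingBelow M

sum-decreasingBelow : ∀ χ M (f : ℕ → ℕ → ℕ) →
  ℕ.sum (List.map ((λ ys → covers χ M ys * f (length ys) (ℕ.sum ys)) ∘ proj₁) (decreasingBelow M)) ≡
  sumSubsets χ M f
sum-decreasingBelow χ zero    f = trans (+-identityʳ _) (+-identityʳ _)
sum-decreasingBelow χ (suc M) f = trans (sum-map-decreasingBelow M _) (cong₂ _+_
  (trans (cong ℕ.sum (map-cong (λ (ys , _) → cong (_* f (suc (length ys)) (M + ℕ.sum ys)) (with-M (χ M) ys)) D))
         (sum-decreasingBelow χ M (λ b s → f (suc b) (M + s))))
  (without-M (χ M)))
  where
  D = decreasingBelow M
  with-M : ∀ c ys → (if c then iverson (M ∈? (M ∷ ys)) else 1) * covers χ M (M ∷ ys) ≡ covers χ M ys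
  with-M true  ys = trans (cong (_* covers χ M (M ∷ ys)) (iverson-yes (M ∈? (M ∷ ys)) (here refl)))
    (trans (*-identityˡ _) (covers-∷ χ M M ≤-refl))
  with-M false ys = trans (*-identityˡ _) (covers-∷ χ M M ≤-refl)
  without-M : ∀ c → ℕ.sum (List.map ((λ ys → (if c then iverson (M ∈? ys) else 1) * covers χ M ys *
                                         f (length ys) (ℕ.sum ys)) ∘ proj₁) D) ≡
                    (if c then 0 else sumSubsets χ M f)
  without-M true  = trans (cong ℕ.sum (map-cong {g = λ _ → 0} (λ (ys , ys<M , _) →
      cong (λ z → z * covers χ M ys * f (length ys) (ℕ.sum ys))
        (iverson-no (M ∈? ys) λ M∈ → <-irrefl refl (All.lookup ys<M M∈))) D)) (zeros D)
    where
    zeros : ∀ {A : Set} (xs : List A) → ℕ.sum (List.map (λ _ → 0) xs) ≡ 0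
    zeros []       = refl
    zeros (x ∷ xs) = zeros xs
  without-M false = trans (cong ℕ.sum (map-cong (λ (ys , _) →
      cong (_* f (length ys) (ℕ.sum ys)) (*-identityˡ (covers χ M ys))) D))
    (sum-decreasingBelow χ M f)

covers-none : ∀ M ys → covers none M ys ≡ 1
covers-none zero    ys = refl
covers-none (suc M) ys = trans (*-identityˡ _) (covers-none M ys)

covers-1 : ∀ χ M ys → (∀ {i} → χ i ≡ true → i ∈ ys) → covers χ M ys ≡ 1
covers-1 χ zero    ys χ⊆ = refl
covers-1 χ (suc M) ys χ⊆ = cong₂ _*_ (factor (χ M) refl) (covers-1 χ M ys χ⊆)
  where
  factor : ∀ c → χ M ≡ c → (if c then iverson (M ∈? ys) else 1) ≡ 1
  factor true  χM = iverson-yes (M ∈? ys) (χ⊆ χM)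
  factor false χM = refl

covers-0 : ∀ χ M ys {i} → i < M → χ i ≡ true → i ∉ ys → covers χ M ys ≡ 0
covers-0 χ (suc M) ys {i} i<1+M χi i∉ = cases (i ℕ.≟ M)
  where
  factor : ℕ
  factor = if χ M then iverson (M ∈? ys) else 1
  cases : Dec (i ≡ M) → factor * covers χ M ys ≡ 0
  cases (yes refl) = cong (_* covers χ M ys)
    (trans (cong (if_then iverson (M ∈? ys) else 1) χi) (iverson-no (M ∈? ys) i∉))
  cases (no i≢M) = trans (cong (factor *_) (covers-0 χ M ys (≤∧≢⇒< (ℕ.s≤s⁻¹ i<1+M) i≢M) χi i∉))
    (*-zeroʳ factor)

member⇒∈ : ∀ R {i} → member R i ≡ true → i ∈ R
member⇒∈ R {i} eq = cases (i ∈? R)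
  where
  cases : Dec (i ∈ R) → i ∈ R
  cases (yes i∈R) = i∈R
  cases (no  i∉R) = contradiction (trans (sym eq) (dec-false (i ∈? R) i∉R)) λ ()

covers-member : ∀ {R M} → bound R ≤ M → ∀ ys → covers (member R) M ys ≡ iverson (All.all? (_∈? ys) R)
covers-member {R} {M} b≤M ys = cases (All.all? (_∈? ys) R)
  where
  cases : Dec (All (_∈ ys) R) → covers (member R) M ys ≡ iverson (All.all? (_∈? ys) R)
  cases (yes R⊆) = trans (covers-1 (member R) M ys (All.lookup R⊆ ∘ member⇒∈ R))
                         (sym (iverson-yes (All.all? (_∈? ys) R) R⊆))
  cases (no  R⊈) = let (i , i∈R , i∉ys) = find (¬All⇒Any¬ (_∈? ys) R R⊈) in
    trans (covers-0 (member R) M ys (<-≤-trans (∈⇒<bound i∈R) b≤M) (dec-true (i ∈? R) i∈R) i∉ys)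
          (sym (iverson-no (All.all? (_∈? ys) R) R⊈))

sum-odd : ∀ xs → ℕ.sum (List.map (λ k → 2 * k + 1) xs) ≡ 2 * ℕ.sum xs + length xs
sum-odd []       = refl
sum-odd (x ∷ xs) = trans (cong (_+_ (2 * x + 1)) (sum-odd xs))
  (solve 3 (λ x s l → (con 2 :* x :+ con 1) :+ (con 2 :* s :+ l) := con 2 :* (x :+ s) :+ (con 1 :+ l)) refl
    x (ℕ.sum xs) (length xs))
  where open +-*-Solver

level? : ∀ ℓ μ → Dec (charge μ ≡ + 0 × 2·energy μ ≡ 2 * ℓ)
level? ℓ μ = (charge μ ℤ.≟ + 0) ×-dec (2·energy μ ℕ.≟ 2 * ℓ)

iverson-level : ∀ ℓ μ → iverson (level? ℓ μ) ≡
  δ-monomial 0 ℓ (length (ns μ)) (ℕ.sum (ns μ)) (length (ms μ)) (ℕ.sum (ms μ))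
iverson-level ℓ μ = cases (level? ℓ μ)
  where
  open ≡-Reasoning
  open +-*-Solver
  a = length (ns μ)
  t = ℕ.sum (ns μ)
  b = length (ms μ)
  s = ℕ.sum (ms μ)
  energy : a ≡ b → 2·energy μ ≡ 2 * (t + (s + b))
  energy a≡b = begin
    2·energy μ                       ≡⟨ cong₂ _+_ (sum-odd (ns μ)) (sum-odd (ms μ)) ⟩
    (2 * t + a) + (2 * s + b)        ≡⟨ cong (λ a → (2 * t + a) + (2 * s + b)) a≡b ⟩
    (2 * t + b) + (2 * s + b)
      ≡⟨ solve 3 (λ t s b → (con 2 :* t :+ b) :+ (con 2 :* s :+ b) := con 2 :* (t :+ (s :+ b))) refl t s b ⟩
    2 * (t + (s + b))                ∎
  to : charge μ ≡ + 0 → a ≡ b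
  to = ℤ.+-injective ∘ ℤ.i-j≡0⇒i≡j (+ a) (+ b)
  from : a ≡ b → charge μ ≡ + 0
  from a≡b = trans (cong (λ a → + a ℤ.- + b) a≡b) (ℤ.+-inverseʳ (+ b))
  cases : Dec (charge μ ≡ + 0 × 2·energy μ ≡ 2 * ℓ) → iverson (level? ℓ μ) ≡ δ-monomial 0 ℓ a t b s
  cases (yes (c≡0 , e≡)) = trans (iverson-yes (level? ℓ μ) (c≡0 , e≡)) (sym (cong₂ _*_
    (δ-≡ (trans (to c≡0) (sym (+-identityʳ b))))
    (δ-≡ (*-cancelˡ-≡ _ _ 2 (trans (sym (energy (to c≡0))) e≡)))))
  cases (no ¬level) = trans (iverson-no (level? ℓ μ) ¬level) (sym (δδ-≢ {a} λ a≡ e≡ →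
    ¬level (from (trans a≡ (+-identityʳ b)) , trans (energy (trans a≡ (+-identityʳ b))) (cong (2 *_) e≡))))

count-monomials₀ : ∀ R {ℓ} → bound R ≤ ℓ →
  ℕ.sum (List.map (λ μ → iverson (All.all? (_∈? ms μ) R)) (monomials₀ ℓ)) ≡ Z R 0 ℓ
count-monomials₀ R {ℓ} b≤ℓ = begin
  ℕ.sum (List.map included (monomials₀ ℓ))
    ≡⟨ sum-filter (level? ℓ) included (cartesianProductWith monomial D D) ⟩
  ℕ.sum (List.map (λ μ → iverson (level? ℓ μ) * included μ) (cartesianProductWith monomial D D))
    ≡⟨ sum-cartesianProductWith monomial _ D D ⟩
  ℕ.sum (List.map (λ x → ℕ.sum (List.map (λ y → iverson (level? ℓ (monomial x y)) * included (monomial x y)) D)) D)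
    ≡⟨ cong ℕ.sum (map-cong (λ x → trans (cong ℕ.sum (map-cong (inner x) D))
         (sum-decreasingBelow (member R) ℓ (δ-monomial 0 ℓ (length (proj₁ x)) (ℕ.sum (proj₁ x))))) D) ⟩
  ℕ.sum (List.map (λ x → sumSubsets (member R) ℓ (δ-monomial 0 ℓ (length (proj₁ x)) (ℕ.sum (proj₁ x)))) D)
    ≡⟨ cong ℕ.sum (map-cong (λ x → trans (sym (*-identityˡ _))
         (cong (_* sumSubsets (member R) ℓ (δ-monomial 0 ℓ (length (proj₁ x)) (ℕ.sum (proj₁ x))))
               (sym (covers-none ℓ (proj₁ x))))) D) ⟩
  ℕ.sum (List.map ((λ xs → covers none ℓ xs * sumSubsets (member R) ℓ (δ-monomial 0 ℓ (length xs) (ℕ.sum xs))) ∘ proj₁) D)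
    ≡⟨ sum-decreasingBelow none ℓ (λ a t → sumSubsets (member R) ℓ (δ-monomial 0 ℓ a t)) ⟩
  count (member R) ℓ ℓ 0 ℓ
    -- `monomials₀` lists entries below ℓ, whereas `Z` also admits ℓ in x; at charge 0 and energy ℓ
    -- this adds nothing.
    ≡⟨ count-sucˡ₀ (member R) ℓ ℓ ⟨
  count (member R) (suc ℓ) ℓ 0 ℓ
    ≡⟨ Z≡count R 0 ℓ ≤-refl ≤-refl b≤ℓ ⟨
  Z R 0 ℓ ∎
  where
  open ≡-Reasoning
  D = decreasingBelow ℓ
  included : Monomial → ℕ
  included μ = iverson (All.all? (_∈? ms μ) R)
  Entry : Set
  Entry = ∃ λ xs → All (_< ℓ) xs × Decreasing xs
  monomial : Entry → Entry → Monomial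
  monomial (ns , _ , ns↓) (ms , _ , ms↓) = mono ns ms ns↓ ms↓
  inner : ∀ x y → iverson (level? ℓ (monomial x y)) * included (monomial x y) ≡
    covers (member R) ℓ (proj₁ y) * δ-monomial 0 ℓ (length (proj₁ x)) (ℕ.sum (proj₁ x)) (length (proj₁ y)) (ℕ.sum (proj₁ y))
  inner x y = trans (*-comm (iverson (level? ℓ (monomial x y))) _)
    (cong₂ _*_ (sym (covers-member {R} b≤ℓ (proj₁ y))) (iverson-level ℓ (monomial x y)))

-- Rational and complex estimates

toℚᵘ-/ : ∀ i d → toℚᵘ (i / suc d) ℚᵘ.≃ mkℚᵘ i d
toℚᵘ-/ i d = ℚ.toℚᵘ-fromℚᵘ (mkℚᵘ i d)

+-/1 : ∀ i j → (i ℤ.+ j) / 1 ≡ i / 1 ℚ.+ j / 1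
+-/1 i j = ℚ.toℚᵘ-injective (begin
  toℚᵘ ((i ℤ.+ j) / 1)              ≈⟨ toℚᵘ-/ (i ℤ.+ j) 0 ⟩
  mkℚᵘ (i ℤ.+ j) 0                  ≈⟨ *≡* (cong (ℤ._* + 1) (cong₂ ℤ._+_ (sym (ℤ.*-identityʳ i)) (sym (ℤ.*-identityʳ j)))) ⟩
  mkℚᵘ i 0 ℚᵘ.+ mkℚᵘ j 0            ≈⟨ ℚᵘ.+-cong (toℚᵘ-/ i 0) (toℚᵘ-/ j 0) ⟨
  toℚᵘ (i / 1) ℚᵘ.+ toℚᵘ (j / 1)    ≈⟨ ℚ.toℚᵘ-homo-+ (i / 1) (j / 1) ⟨
  toℚᵘ (i / 1 ℚ.+ j / 1)            ∎)
  where open import Relation.Binary.Reasoning.Setoid ℚᵘ.≃-setoid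

/-*-cancel : ∀ i N .{{_ : NonZero N}} → i / N ℚ.* (+ N / 1) ≡ i / 1
/-*-cancel i (suc d) = ℚ.toℚᵘ-injective (begin
  toℚᵘ (i / suc d ℚ.* (+ suc d / 1))               ≈⟨ ℚ.toℚᵘ-homo-* (i / suc d) (+ suc d / 1) ⟩
  toℚᵘ (i / suc d) ℚᵘ.* toℚᵘ (+ suc d / 1)         ≈⟨ ℚᵘ.*-cong (toℚᵘ-/ i d) (toℚᵘ-/ (+ suc d) 0) ⟩
  mkℚᵘ i d ℚᵘ.* mkℚᵘ (+ suc d) 0
    ≈⟨ *≡* (trans (ℤ.*-identityʳ (i ℤ.* + suc d)) (cong (λ n → i ℤ.* + suc n) (sym (*-identityʳ d)))) ⟩
  mkℚᵘ i 0                                         ≈⟨ toℚᵘ-/ i 0 ⟨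
  toℚᵘ (i / 1)                                     ∎)
  where open import Relation.Binary.Reasoning.Setoid ℚᵘ.≃-setoid

*-/1 : ∀ i j → (i ℤ.* j) / 1 ≡ i / 1 ℚ.* (j / 1)
*-/1 i j = ℚ.toℚᵘ-injective (begin
  toℚᵘ ((i ℤ.* j) / 1)              ≈⟨ toℚᵘ-/ (i ℤ.* j) 0 ⟩
  mkℚᵘ i 0 ℚᵘ.* mkℚᵘ j 0            ≈⟨ ℚᵘ.*-cong (toℚᵘ-/ i 0) (toℚᵘ-/ j 0) ⟨
  toℚᵘ (i / 1) ℚᵘ.* toℚᵘ (j / 1)    ≈⟨ ℚ.toℚᵘ-homo-* (i / 1) (j / 1) ⟨
  toℚᵘ (i / 1 ℚ.* (j / 1))          ∎)
  where open import Relation.Binary.Reasoning.Setoid ℚᵘ.≃-setoid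

-‿/1 : ∀ i → (ℤ.- i) / 1 ≡ ℚ.- (i / 1)
-‿/1 (+ zero)  = refl
-‿/1 (+ suc n) = refl
-‿/1 -[1+ n ]  = solve 1 (λ x → x := :- (:- x)) refl (+ suc n / 1)
  where open ℚ.+-*-Solver

/1-mono : ∀ {m n} → m ≤ n → + m / 1 ℚ.≤ + n / 1
/1-mono {m} {n} m≤n = ℚ.toℚᵘ-cancel-≤ (begin
  toℚᵘ (+ m / 1)   ≃⟨ toℚᵘ-/ (+ m) 0 ⟩
  mkℚᵘ (+ m) 0     ≤⟨ *≤* (ℤ.*-monoʳ-≤-nonNeg (+ 1) (ℤ.+≤+ m≤n)) ⟩
  mkℚᵘ (+ n) 0     ≃⟨ toℚᵘ-/ (+ n) 0 ⟨
  toℚᵘ (+ n / 1)   ∎)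
  where open ℚᵘ.≤-Reasoning

/1-pos : ∀ n .{{_ : NonZero n}} → Positive (+ n / 1)
/1-pos (suc n) = ℚ.normalize-pos (suc n) 1

∣/1∣ : ∀ i → ℚ.∣ i / 1 ∣ ≡ + ℤ.∣ i ∣ / 1
∣/1∣ (+ n)    = ℚ.0≤p⇒∣p∣≡p (/1-mono {0} {n} z≤n)
∣/1∣ -[1+ n ] = trans (ℚ.∣-p∣≡∣p∣ (+ suc n / 1)) (ℚ.0≤p⇒∣p∣≡p (/1-mono {0} {suc n} z≤n))

/-approx : ∀ z q N .{{_ : NonZero N}} K → K ℕ.* ℤ.∣ + N ℤ.* + z ℤ.- + q ∣ ≤ q →
           (+ K / 1) ℚ.* ℚ.∣ + z / 1 ℚ.- (+ q / N) ∣ ℚ.≤ + q / N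
/-approx z q N K close = ℚ.*-cancelʳ-≤-pos N′ {{/1-pos N}} (begin
  K′ ℚ.* ℚ.∣ x ℚ.- v ∣ ℚ.* N′
    ≡⟨ ℚ.*-assoc K′ ℚ.∣ x ℚ.- v ∣ N′ ⟩
  K′ ℚ.* (ℚ.∣ x ℚ.- v ∣ ℚ.* N′)
    ≡⟨ cong (λ y → K′ ℚ.* (ℚ.∣ x ℚ.- v ∣ ℚ.* y)) (ℚ.0≤p⇒∣p∣≡p (/1-mono {0} {N} z≤n)) ⟨
  K′ ℚ.* (ℚ.∣ x ℚ.- v ∣ ℚ.* ℚ.∣ N′ ∣)
    ≡⟨ cong (K′ ℚ.*_) (ℚ.∣p*q∣≡∣p∣*∣q∣ (x ℚ.- v) N′) ⟨
  K′ ℚ.* ℚ.∣ (x ℚ.- v) ℚ.* N′ ∣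
    ≡⟨ cong (λ y → K′ ℚ.* ℚ.∣ y ∣) scaled ⟩
  K′ ℚ.* ℚ.∣ i / 1 ∣
    ≡⟨ cong (K′ ℚ.*_) (∣/1∣ i) ⟩
  K′ ℚ.* (+ ℤ.∣ i ∣ / 1)
    ≡⟨ *-/1 (+ K) (+ ℤ.∣ i ∣) ⟨
  (+ K ℤ.* + ℤ.∣ i ∣) / 1
    ≡⟨ cong (_/ 1) (ℤ.pos-* K ℤ.∣ i ∣) ⟨
  + (K ℕ.* ℤ.∣ i ∣) / 1
    ≤⟨ /1-mono close ⟩
  + q / 1
    ≡⟨ /-*-cancel (+ q) N ⟨
  v ℚ.* N′ ∎)
  where
  open ℚ.≤-Reasoning
  open ℚ.+-*-Solver
  i = + N ℤ.* + z ℤ.- + q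
  x = + z / 1
  v = + q / N
  K′ = + K / 1
  N′ = + N / 1
  scaled : (x ℚ.- v) ℚ.* N′ ≡ i / 1
  scaled = trans (solve 3 (λ x v n → (x :- v) :* n := n :* x :- v :* n) refl x v N′)
    (trans (cong₂ ℚ._-_ (sym (*-/1 (+ N) (+ z))) (/-*-cancel (+ q) N))
    (trans (cong ((+ N ℤ.* + z) / 1 ℚ.+_) (sym (-‿/1 (+ q))))
           (sym (+-/1 (+ N ℤ.* + z) (ℤ.- + q)))))

-- The product is the numerator of `ε`, a positive integer. Hence the denominator of `ε` is a
-- sufficient constant K in `Small`.
archimedean : ∀ ε → .{{Positive ε}} → 1ℚ ℚ.≤ ε ℚ.* (+ ↧ₙ ε / 1)
archimedean ε@record{} = begin
  1ℚ                              ≤⟨ /1-mono {1} {ℤ.∣ ↥ ε ∣} (numerator ε) ⟩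
  + ℤ.∣ ↥ ε ∣ / 1                 ≡⟨ cong (_/ 1) (ℤ.0≤i⇒+∣i∣≡i (nonneg ε)) ⟩
  ↥ ε / 1                         ≡⟨ /-*-cancel (↥ ε) (↧ₙ ε) ⟨
  (↥ ε / ↧ₙ ε) ℚ.* (+ ↧ₙ ε / 1)   ≡⟨ cong (ℚ._* (+ ↧ₙ ε / 1)) (ℚ.↥p/↧p≡p ε) ⟩
  ε ℚ.* (+ ↧ₙ ε / 1)              ∎
  where
  open ℚ.≤-Reasoning
  numerator : ∀ ε → .{{Positive ε}} → 1 ≤ ℤ.∣ ↥ ε ∣
  numerator (ℚ.mkℚ (+ suc n) d c) = s≤s z≤n
  nonneg : ∀ ε → .{{Positive ε}} → + 0 ℤ.≤ ↥ ε
  nonneg (ℚ.mkℚ (+ suc n) d c) = ℤ.+≤+ z≤n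

square-mono : ∀ {y w} → ℚ.∣ y ∣ ℚ.≤ w → y ℚ.* y ℚ.≤ w ℚ.* w
square-mono {y} {w} y≤w = begin
  y ℚ.* y           ≡⟨ square ⟨
  ℚ.∣ y ∣ ℚ.* ℚ.∣ y ∣   ≤⟨ ℚ.*-monoˡ-≤-nonNeg ℚ.∣ y ∣ {{ℚ.∣-∣-nonNeg y}} y≤w ⟩
  ℚ.∣ y ∣ ℚ.* w       ≤⟨ ℚ.*-monoʳ-≤-nonNeg w {{ℚ.nonNegative (ℚ.≤-trans (ℚ.0≤∣p∣ y) y≤w)}} y≤w ⟩
  w ℚ.* w           ∎
  where
  open ℚ.≤-Reasoning
  open ℚ.+-*-Solver
  square : ℚ.∣ y ∣ ℚ.* ℚ.∣ y ∣ ≡ y ℚ.* y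
  square with ℚ.∣p∣≡p∨∣p∣≡-p y
  ... | inj₁ eq = cong (λ z → z ℚ.* z) eq
  ... | inj₂ eq = trans (cong (λ z → z ℚ.* z) eq) (solve 1 (λ y → :- y :* :- y := y :* y) refl y)

/-approx² : ∀ z q N .{{_ : NonZero N}} ε → .{{_ : Positive ε}} →
  ↧ₙ ε ℕ.* ℤ.∣ + N ℤ.* + z ℤ.- + q ∣ ≤ q →
  (+ z / 1 ℚ.- (+ q / N)) ℚ.* (+ z / 1 ℚ.- (+ q / N)) ℚ.≤ ε ℚ.* ε ℚ.* ((+ q / N) ℚ.* (+ q / N))
/-approx² z q N ε close = ℚ.≤-trans (square-mono {y} {ε ℚ.* v} (begin
  ℚ.∣ y ∣                              ≡⟨ ℚ.*-identityˡ ℚ.∣ y ∣ ⟨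
  1ℚ ℚ.* ℚ.∣ y ∣                       ≤⟨ ℚ.*-monoʳ-≤-nonNeg ℚ.∣ y ∣ {{ℚ.∣-∣-nonNeg y}} (archimedean ε) ⟩
  ε ℚ.* (+ ↧ₙ ε / 1) ℚ.* ℚ.∣ y ∣       ≡⟨ ℚ.*-assoc ε _ ℚ.∣ y ∣ ⟩
  ε ℚ.* ((+ ↧ₙ ε / 1) ℚ.* ℚ.∣ y ∣)     ≤⟨ ℚ.*-monoˡ-≤-nonNeg ε {{ℚ.pos⇒nonNeg ε}} (/-approx z q N (↧ₙ ε) close) ⟩
  ε ℚ.* v                            ∎))
  (ℚ.≤-reflexive (solve 2 (λ e v → (e :* v) :* (e :* v) := e :* e :* (v :* v)) refl ε v))
  where
  open ℚ.≤-Reasoning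
  open ℚ.+-*-Solver
  v = + q / N
  y = + z / 1 ℚ.- v

p≤∣p∣ : ∀ p → p ℚ.≤ ℚ.∣ p ∣
p≤∣p∣ p with ℚ.∣p∣≡p∨∣p∣≡-p p
... | inj₁ eq = ℚ.≤-reflexive (sym eq)
... | inj₂ eq = ℚ.≤-trans
  (subst (ℚ._≤ 0ℚ) (solve 1 (λ p → :- (:- p) := p) refl p)
    (ℚ.neg-antimono-≤ (subst (0ℚ ℚ.≤_) eq (ℚ.0≤∣p∣ p))))
  (ℚ.0≤∣p∣ p)
  where open ℚ.+-*-Solver

≤ℝ-from-≃ : ∀ {x y w} → x ≃ y → (∀ n → seq y n ℚ.≤ seq w n) → x ≤ℝ w
≤ℝ-from-≃ {x} {y} {w} x≃y y≤w = mk≤ λ ε → let (N , close) = null x≃y ε in N , λ n n≥ → begin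
  seq x n                          ≡⟨ solve 2 (λ x y → x := y :+ (x :- y)) refl (seq x n) (seq y n) ⟩
  seq y n ℚ.+ (seq x n ℚ.- seq y n) ≤⟨ ℚ.+-mono-≤ (y≤w n) (ℚ.≤-trans (p≤∣p∣ (seq x n ℚ.- seq y n)) (close n n≥)) ⟩
  seq w n ℚ.+ ε                    ∎
  where
  open ℚ.≤-Reasoning
  open ℚ.+-*-Solver

∣∣²-cong : ∀ {z w} → z ≈ℂ w → ∣ z ∣² ≃ ∣ w ∣²
∣∣²-cong z≈w = +ℝ-cong (*ℝ-cong (re≃ z≈w) (re≃ z≈w)) (*ℝ-cong (im≃ z≈w) (im≃ z≈w))

ℚ⇒ℂ : ℚ → ℂ
ℚ⇒ℂ x = ℝ⇒ℂ (fromℚ x)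

∣-∣²-≤ : ∀ {b} x v ε → b ≈ℂ ℚ⇒ℂ x → (x ℚ.- v) ℚ.* (x ℚ.- v) ℚ.≤ ε ℚ.* ε ℚ.* (v ℚ.* v) →
         ∣ b -ℂ ℚ⇒ℂ v ∣² ≤ℝ fromℚ (ε ℚ.* ε) *ℝ ∣ ℚ⇒ℂ v ∣²
∣-∣²-≤ {b} x v ε b≈x bound = ≤ℝ-from-≃ {∣ b -ℂ ℚ⇒ℂ v ∣²} {∣ ℚ⇒ℂ x -ℂ ℚ⇒ℂ v ∣²}
  {fromℚ (ε ℚ.* ε) *ℝ ∣ ℚ⇒ℂ v ∣²}
  (∣∣²-cong {b -ℂ ℚ⇒ℂ v} {ℚ⇒ℂ x -ℂ ℚ⇒ℂ v} (CommutativeRing.+-congʳ ℂ-commutativeRing b≈x))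
  λ _ → ℚ.≤-trans (ℚ.≤-reflexive (ℚ.+-identityʳ ((x ℚ.- v) ℚ.* (x ℚ.- v))))
    (ℚ.≤-trans bound (ℚ.≤-reflexive (cong (ε ℚ.* ε ℚ.*_) (sym (ℚ.+-identityʳ (v ℚ.* v))))))

ι : ℕ → ℂ
ι n = ℚ⇒ℂ (+ n / 1)

ι-+ : ∀ m n → ι m +ℂ ι n ≈ℂ ι (m ℕ.+ n)
ι-+ m n = ≃-pointwise (λ _ → sym (+-/1 (+ m) (+ n))) , ≃-pointwise (λ _ → refl)

sum-indicator : ∀ {A : Set} (f : A → ℂ) {P : A → Set} (P? : ∀ x → Dec (P x)) →
  (∀ x → f x ≈ℂ (if does (P? x) then 1ℂ else 0ℂ)) →
  ∀ xs → sum (List.map f xs) ≈ℂ ι (ℕ.sum (List.map (iverson ∘ P?) xs))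
sum-indicator f P? f≈ []       = CommutativeRing.refl ℂ-commutativeRing
sum-indicator f P? f≈ (x ∷ xs) = begin
  f x +ℂ sum (List.map f xs)                              ≈⟨ +-cong (trans′ (f≈ x) (indicator (does (P? x)))) (sum-indicator f P? f≈ xs) ⟩
  ι (iverson (P? x)) +ℂ ι (ℕ.sum (List.map (iverson ∘ P?) xs))  ≈⟨ ι-+ (iverson (P? x)) _ ⟩
  ι (iverson (P? x) ℕ.+ ℕ.sum (List.map (iverson ∘ P?) xs))     ∎
  where
  open CommutativeRing ℂ-commutativeRing using (+-cong) renaming (trans to trans′; refl to refl′)
  open import Relation.Binary.Reasoning.Setoid ℂ-setoid
  indicator : ∀ c → (if c then 1ℂ else 0ℂ) ≈ℂ ι (if c then 1 else 0)
  indicator true  = refl′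
  indicator false = refl′

-- From the Fock space trace to the asymptotics

decreasing⇒unique : ∀ {n} {r : Vec ℕ n} → AllPairs _>_ r → Unique (toList r)
decreasing⇒unique []          = []
decreasing⇒unique (r> ∷ rest) = head≢ r> ∷ decreasing⇒unique rest
  where
  head≢ : ∀ {k n} {r : Vec ℕ n} → VecAll.All (k >_) r → All (k ≢_) (toList r)
  head≢ []          = []
  head≢ (k> ∷ rest) = >⇒≢ k> ∷ head≢ rest

-- An exact identity. The restriction on ℓ ensures that the modes below ℓ, over which `monomials₀ ℓ`
-- is enumerated, include all of `r`.
coefficient-asymptotic : ∀ {m ℓm} (𝓕 : FockSpace m ℓm) {n} (r : Vec ℕ n) (b : PowerSeries) →
  (∀ ℓ → (qq∞ ⊛ b) ℓ ≈ℂ FockSpace.F 𝓕 (map +_ r) ℓ) →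
  ∀ ℓ → bound (toList r) ≤ ℓ → b ℓ ≈ℂ ι (Z (toList r) 0 ℓ)
coefficient-asymptotic 𝓕 r b qqb≈F ℓ b≤ℓ = begin
  -- The constant term of `qq∞` computes to 1, so reflexivity suffices for it.
  b ℓ                                    ≈⟨ ⊛-cancelˡ {qq∞} {b} {trace₀ X} ≈-refl qqb≈F ℓ ⟩
  trace₀ X ℓ                             ≈⟨ sum-indicator (λ μ → coordinate μ (X ⟦ μ ⟧)) (λ μ → All.all? (_∈? ms μ) (toList r))
                                              (coordinate-As 𝓕 r) (monomials₀ ℓ) ⟩
  ι (ℕ.sum (List.map (λ μ → iverson (All.all? (_∈? ms μ) (toList r))) (monomials₀ ℓ)))
                                         ≡⟨ cong ι (count-monomials₀ (toList r) b≤ℓ) ⟩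
  ι (Z (toList r) 0 ℓ)                   ∎
  where
  open FockSpace 𝓕
  open CommutativeRing ℂ-commutativeRing using () renaming (refl to ≈-refl)
  open import Relation.Binary.Reasoning.Setoid ℂ-setoid
  X = As 𝓕 (map +_ r)

theorem3p3 : ∀ {m ℓm} (𝓕 : FockSpace m ℓm)
    (n : ℕ) → n ≥ 1 →
    (r : Vec ℕ n) → AllPairs _>_ r →
    (b : PowerSeries) →
    (∀ ℓ → (qq∞ ⊛ b) ℓ ≈ℂ FockSpace.F 𝓕 (map +_ r) ℓ) →
    b ∼ (λ ℓ → ℝ⇒ℂ (fromℚ ((+ p ℓ / (2 ^ n)) {{m^n≢0 2 n}})))
theorem3p3 𝓕 (suc n) _ r@(r₁ ∷ rs) r↓ b qqb≈F ε =
  let (N , close) = Small.negligible (equidistributed (decreasing⇒unique r↓)) (↧ₙ ε)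
  in N ℕ.⊔ bound R , λ ℓ ℓ≥ → ∣-∣²-≤ (+ Z R 0 ℓ / 1) ((+ p ℓ / 2 ^ suc n) {{m^n≢0 2 (suc n)}}) ε
       (coefficient-asymptotic 𝓕 r b qqb≈F ℓ (m⊔n≤o⇒n≤o N (bound R) ℓ≥))
       (/-approx² (Z R 0 ℓ) (p ℓ) (2 ^ suc n) {{m^n≢0 2 (suc n)}} ε
         (subst (λ k → ↧ₙ ε ℕ.* ℤ.∣ + (2 ^ k) ℤ.* + Z R 0 ℓ ℤ.- + p ℓ ∣ ≤ p ℓ) (cong suc (length-toList rs))
           (close ℓ (m⊔n≤o⇒m≤o N (bound R) ℓ≥))))
  where
  R = toList r
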